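{- Let $m=m(n)$ and $s=s(n)$ be positive integers such that $m=o\!\left(\frac{s^2}{(\log n)^2}\right)$ as $n\to\infty$. Let $A$ be chosen uniformly at random from the family of all sets $A\subseteq[n]=\{1,\dots,n\}$ with $|A|=s$ and $|A+A|\le m$. Then there exists a sequence $\eta_n\to0$ such that, with probability tending to $1$ as $n\to\infty$, there is an arithmetic progression $P\subseteq\mathbb{Z}$ with $|P|\le m/2+\eta_n m$ and $|A\setminus P|\le \eta_n s$.
   Context: For $A\subseteq\mathbb{Z}$, $A+A=\{a_1+a_2:a_1,a_2\in A\}$. Logarithms are base $2$. The random set is only defined for $n$ such that the family is nonempty. -}

module Defs where

open import Data.Bool using (Bool; true; false; _∧_; not; if_then_else_)
open import Data.Nat as ℕ using (ℕ; zero; suc; _+_; _^_; _≡ᵇ_; _≤ᵇ_)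
open import Data.Nat.Logarithm using (⌊log₂_⌋)
open import Data.Integer as ℤ using (ℤ; +_)
open import Data.Fin using (Fin; toℕ)
open import Data.Vec using (Vec; []; _∷_; lookup)
open import Data.List using (List; []; _∷_; _++_; map; upTo; allFin; filterᵇ; length)
open import Data.Nat.ListAction using (sum)
open import Data.Bool.ListAction using (any)
open import Data.List.Membership.Propositional using (_∈_)
open import Data.List.Relation.Unary.All using (All)
open import Data.List.Relation.Unary.Unique.Propositional using (Unique)
open import Data.Rational as ℚ using (ℚ; 0ℚ; 1ℚ; ½; _≤_; _<_; ∣_∣)
open import Data.Product using (Σ; ∃; _×_)
open import Relation.Nullary.Decidable using (⌊_⌋)

ℕ→ℚ : ℕ → ℚ
ℕ→ℚ k = (+ k) ℚ./ 1

-- A subset A ⊆ [n] = {1,…,n} is a vector of n booleans;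
-- position i : Fin n stands for the integer toℕ i + 1.
Subset : ℕ → Set
Subset n = Vec Bool n

elem : ∀ {n} → Fin n → ℤ
elem i = + suc (toℕ i)

allSubsets : (n : ℕ) → List (Subset n)
allSubsets zero = [] ∷ []
allSubsets (suc n) = map (false ∷_) (allSubsets n) ++ map (true ∷_) (allSubsets n)

countFin : ∀ {n} → (Fin n → Bool) → ℕ
countFin {n} f = sum (map (λ i → if f i then 1 else 0) (allFin n))

anyFin : ∀ {n} → (Fin n → Bool) → Bool
anyFin {n} f = any f (allFin n)

card : ∀ {n} → Subset n → ℕ
card A = countFin (lookup A)

-- |A + A| : the sums of two elements of A ⊆ [n] are (i+1)+(j+1) with
-- i,j < n, so it is the number of t < n + n such that t = i + j for
-- some i, j ∈ A (shift by 2).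
sumsetSize : ∀ {n} → Subset n → ℕ
sumsetSize {n} A =
  countFin {n + n} (λ t → anyFin {n} (λ i → anyFin {n} (λ j →
    lookup A i ∧ (lookup A j ∧ (toℕ i + toℕ j ≡ᵇ toℕ t)))))

family : (n s m : ℕ) → List (Subset n)
family n s m = filterᵇ (λ A → (card A ≡ᵇ s) ∧ (sumsetSize A ≤ᵇ m)) (allSubsets n)

inAP : ℤ → ℤ → ℕ → ℤ → Bool
inAP a d k x = any (λ i → ⌊ (a ℤ.+ (+ i) ℤ.* d) ℤ.≟ x ⌋) (upTo k)

outsideAP : ∀ {n} → Subset n → ℤ → ℤ → ℕ → ℕ
outsideAP A a d k = countFin (λ i → lookup A i ∧ not (inAP a d k (elem i)))

-- There is an arithmetic progression P ⊆ ℤ with |P| ≤ m/2 + η m and |A \ P| ≤ η s.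
-- P = {a + i d : i < k} with common difference d ≥ 1 has exactly k elements;
-- every finite AP in ℤ has this form.
GoodAP : ∀ {n} → (m s : ℕ) → (η : ℚ) → Subset n → Set
GoodAP m s η A =
  Σ ℤ λ a → Σ ℤ λ d → Σ ℕ λ k →
    (+ 1 ℤ.≤ d)
    × (ℕ→ℚ k ≤ (½ ℚ.* ℕ→ℚ m) ℚ.+ (η ℚ.* ℕ→ℚ m))
    × (ℕ→ℚ (outsideAP A a d k) ≤ η ℚ.* ℕ→ℚ s)

-- m = o(s² / (log n)²):  for every ε > 0, eventually m (log₂ n)² ≤ ε s².
-- (log₂ n is replaced by ⌊log₂ n⌋ — asymptotically equivalent.)
LittleOSqOverLogSq : (m s : ℕ → ℕ) → Set
LittleOSqOverLogSq m s =
  ∀ (ε : ℚ) → 0ℚ < ε → ∃ λ N → ∀ n → N ℕ.≤ n →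
    ℕ→ℚ (m n ℕ.* (⌊log₂ n ⌋ ^ 2)) ≤ ε ℚ.* ℕ→ℚ (s n ^ 2)

TendsToZero : (ℕ → ℚ) → Set
TendsToZero η = ∀ (ε : ℚ) → 0ℚ < ε → ∃ λ N → ∀ n → N ℕ.≤ n → ∣ η n ∣ ≤ ε

-- Pr[A good] ≥ 1 - ε for A uniform in the (nonempty) family:
-- there are at least (1-ε)|family| distinct members of the family that are good.
ProbAtLeast : (n s m : ℕ) → (Subset n → Set) → ℚ → Set
ProbAtLeast n s m P ε =
  Σ (List (Subset n)) λ G →
    Unique G × All (_∈ family n s m) G × All P G
    × ((1ℚ ℚ.- ε) ℚ.* ℕ→ℚ (length (family n s m)) ≤ ℕ→ℚ (length G))

{-# OPTIONS --safe #-}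
module Submission where

open import Defs
open import Data.Nat using (ℕ; _≤_; _<_)
open import Data.Rational using (ℚ; 0ℚ)
open import Data.List using (length)
open import Data.Product using (Σ; ∃; _×_)

open import Data.Bool using (Bool; true; false; _∧_; _∨_; not; if_then_else_; T?) renaming (T to True)
open import Data.Bool.ListAction using (any)
open import Data.Empty using (⊥; ⊥-elim)
open import Data.Fin using (Fin; toℕ; fromℕ<)
open import Data.Fin.Properties using (toℕ-fromℕ<)
open import Data.Integer as ℤ using (ℤ)
import Data.Integer.Properties as ℤ
open import Data.List using (List; []; _∷_; _++_; map; concatMap; upTo; filterᵇ; tabulate; allFin)
open import Data.List.Membership.Propositional using (_∈_; lose)
open import Data.List.Membership.Propositional.Properties using (∈-concatMap⁺; ∈-map⁺; ∈-map⁻; ∈-upTo⁺; ∈-allFin)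
open import Data.List.Properties using (length-++; length-map; length-upTo; map-tabulate)
open import Data.List.Relation.Unary.All as All using ()
open import Data.List.Relation.Unary.AllPairs using ([]; _∷_)
open import Data.List.Relation.Unary.All using ([])
open import Data.List.Relation.Unary.Any using (here; there)
open import Data.List.Relation.Unary.Unique.Propositional using (Unique)
import Data.List.Relation.Unary.Unique.Propositional.Properties as Unique
open import Data.Nat hiding (_≤_; _<_; ℕ)
open import Data.Nat.Divisibility using (_∣_; divides; m%n≡0⇒n∣m)
open import Data.Nat.DivMod using (_%_; _/_; m%n<n; m≡m%n+[m/n]*n; [m+n]%n≡m%n; m<n⇒m%n≡m; m≥n⇒m/n>0; m/n*n≤m)
open import Data.Nat.ListAction using (sum)
open import Data.Nat.Logarithm using (⌊log₂_⌋; ⌊log₂⌋-mono-≤; ⌊log₂[2^n]⌋≡n)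
open import Data.Nat.Properties
open import Data.Nat.Tactic.RingSolver using (solve-∀)
open import Data.Product using (_,_; proj₁; proj₂)
import Data.Rational as ℚ
open import Data.Rational using (1ℚ; ½; mkℚ)
import Data.Rational.Properties as ℚ
open import Data.Rational.Solver using (module +-*-Solver)
open import Data.Rational.Unnormalised as ℚᵘ using (mkℚᵘ; *≡*; *≤*)
import Data.Rational.Unnormalised.Properties as ℚᵘ
open import Data.Sum using (_⊎_; inj₁; inj₂)
open import Data.Unit using (tt)
open import Data.Vec using ([]; _∷_; lookup)
import Data.Vec.Properties as Vec
open import Function using (_∘_; id)
open import Relation.Binary.PropositionalEquality
open import Relation.Nullary using (¬_; yes; no)
open import Relation.Nullary.Decidable using (⌊_⌋)

-- Fix a small η.  Every A with |A| = s and |A + A| ≤ m lies in one of 2^o(s) containers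
-- C which come with a set D ⊆ A + A such that either |C| < (1 - δ) m/2 or almost all
-- pairs of C have their sum in D.  One starts from C = {1, …, n} and D = ∅.  As long as
-- many pairs of C have sums outside D, there are many x in C with many elements of x + C
-- outside D.  Either A contains few of them, and the others are deleted from C; or A
-- contains a set X of 2Eθ of them.  In the latter case one greedily adds y + X to D, for
-- y in A, as long as this adds at least θ elements; since D ⊆ A + A this happens at most
-- m/θ times, and afterwards all y with at least θ elements of y + X outside D are deleted
-- from C.  Each round moves a constant fraction of |C| and is described by O(θ + m/θ)
-- elements of {1, …, n}; as m = o(s²/log² n), one can take θ = o(s/log n) with θ² ≥ m.
--
-- If almost all pairs of C have their sum in D and |D| ≤ m ≤ (2 + δ)|C|, then C is
-- almost closed under addition modulo the difference of its (essentially) extreme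
-- elements, hence close to a subgroup, that is, C is almost contained in a progression P
-- of length at most (1/2 + η) m.
--
-- The containers with |C| < (1 - δ) m/2, and the sets A ⊆ C with more than η s elements
-- outside P, account for a fraction 2^-Ω(s) of binom(m/2, s) sets only, while all the
-- s-subsets of an interval of length m/2 belong to the family.

-- The potential argument needs |C| = O(m) at the start, while n may be far larger than m. So 2Eθ
-- arbitrary elements X of A are first used once to cut {1, ..., n} down to at most 2m elements.
-- From then on |C| - |D| falls by at least m/8E per round, and 24E rounds are enough.
--
-- The constants are chosen backwards from g = 1/η. An element outside P gets weight l = 8^g, enough
-- to beat both a factor 2^s lost in comparing binomial coefficients and the number of containers.
-- For this P may miss at most |C|/6l elements, whence T = 12l. Markov's inequality turns an average
-- into an exceptional set and costs a square each time: F = 9T² makes the defects average small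
-- enough, and E = 2F² does the same for the missing pairs. A thin container saves (F/(F+1))^s, so
-- 2^w containers are affordable when F w ≤ s.
--
-- All these constants depend on η alone. Hence the hypothesis is used only in the form Z m log² n ≤
-- s² with a constant Z for each g, and η may tend to 0 along a diagonal.

-- To derive a ≤ b from l ≤ r it suffices to exhibit a polynomial identity
-- a + r + t ≡ b + l; the identity is then left to the ring solver.
≤-from : ∀ {a b l r} t → a + r + t ≡ b + l → l ≤ r → a ≤ b
≤-from {a} {b} {l} {r} t eq l≤r = +-cancelʳ-≤ l a b (begin
  a + l      ≤⟨ +-monoʳ-≤ a l≤r ⟩
  a + r      ≤⟨ m≤m+n (a + r) t ⟩
  a + r + t  ≡⟨ eq ⟩
  b + l      ∎)
  where open ≤-Reasoning

infixl 6 _⊹_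
_⊹_ : ∀ {a b c d} → a ≤ b → c ≤ d → a + c ≤ b + d
_⊹_ = +-mono-≤

infixl 7 _⊛_
_⊛_ : ∀ c {a b} → a ≤ b → c * a ≤ c * b
c ⊛ p = *-monoʳ-≤ c p

-- Booleans and their values as numbers.

true≢false : true ≡ false → ⊥
true≢false ()

by-cases : (b : Bool) → (b ≡ true) ⊎ (b ≡ false)
by-cases true = inj₁ refl
by-cases false = inj₂ refl

∧-true : ∀ {a b} → a ∧ b ≡ true → (a ≡ true) × (b ≡ true)
∧-true {true} {true} _ = refl , refl

true-∧ : ∀ {a b} → a ≡ true → b ≡ true → a ∧ b ≡ true
true-∧ refl refl = refl

not-true : ∀ {a} → not a ≡ true → a ≡ false
not-true {false} _ = refl

≤ᵇ-true : ∀ {a b} → a ≤ b → (a ≤ᵇ b) ≡ true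
≤ᵇ-true {a} {b} p with a ≤ᵇ b | ≤⇒≤ᵇ p
... | true | _ = refl

true-≤ᵇ : ∀ {a b} → (a ≤ᵇ b) ≡ true → a ≤ b
true-≤ᵇ {a} {b} p = ≤ᵇ⇒≤ a b (subst True (sym p) tt)

false-≤ᵇ : ∀ {a b} → (a ≤ᵇ b) ≡ false → b < a
false-≤ᵇ {a} {b} p = ≰⇒> λ a≤b → true≢false (trans (sym (≤ᵇ-true a≤b)) p)

⟦_⟧ : Bool → ℕ
⟦ b ⟧ = if b then 1 else 0

⟦⟧≤1 : ∀ b → ⟦ b ⟧ ≤ 1
⟦⟧≤1 true = ≤-refl
⟦⟧≤1 false = z≤n

⟦⟧-mono : ∀ {a b} → (a ≡ true → b ≡ true) → ⟦ a ⟧ ≤ ⟦ b ⟧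
⟦⟧-mono {false} _ = z≤n
⟦⟧-mono {true} f rewrite f refl = ≤-refl

-- Finite sums and cardinalities

∑ : ℕ → (ℕ → ℕ) → ℕ
∑ zero f = 0
∑ (suc n) f = f 0 + ∑ n (f ∘ suc)

# : ℕ → (ℕ → Bool) → ℕ
# n p = ∑ n (λ i → ⟦ p i ⟧)

∑-mono : ∀ n {f g : ℕ → ℕ} → (∀ i → i < n → f i ≤ g i) → ∑ n f ≤ ∑ n g
∑-mono zero _ = z≤n
∑-mono (suc n) h = h 0 z<s ⊹ ∑-mono n (λ i i<n → h (suc i) (s<s i<n))

∑-cong : ∀ n {f g : ℕ → ℕ} → (∀ i → i < n → f i ≡ g i) → ∑ n f ≡ ∑ n g
∑-cong n h = ≤-antisym (∑-mono n (λ i l → ≤-reflexive (h i l)))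
                       (∑-mono n (λ i l → ≤-reflexive (sym (h i l))))

∑-+ : ∀ n (f g : ℕ → ℕ) → ∑ n (λ i → f i + g i) ≡ ∑ n f + ∑ n g
∑-+ zero f g = refl
∑-+ (suc n) f g rewrite ∑-+ n (f ∘ suc) (g ∘ suc) =
  interchange (f 0) (g 0) (∑ n (f ∘ suc)) (∑ n (g ∘ suc))
  where
  interchange : ∀ a b c d → a + b + (c + d) ≡ a + c + (b + d)
  interchange = solve-∀

∑-* : ∀ n c (f : ℕ → ℕ) → ∑ n (λ i → c * f i) ≡ c * ∑ n f
∑-* zero c f = sym (*-zeroʳ c)
∑-* (suc n) c f rewrite ∑-* n c (f ∘ suc) = sym (*-distribˡ-+ c (f 0) (∑ n (f ∘ suc)))

∑-const : ∀ n c → ∑ n (λ _ → c) ≡ n * c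
∑-const zero c = refl
∑-const (suc n) c = cong (c +_) (∑-const n c)

∑-zero : ∀ n {f : ℕ → ℕ} → (∀ i → i < n → f i ≡ 0) → ∑ n f ≡ 0
∑-zero n h = trans (∑-cong n h) (trans (∑-const n 0) (*-zeroʳ n))

∑-split : ∀ m n (f : ℕ → ℕ) → ∑ (m + n) f ≡ ∑ m f + ∑ n (λ i → f (m + i))
∑-split zero n f = refl
∑-split (suc m) n f rewrite ∑-split m n (f ∘ suc) = sym (+-assoc (f 0) _ _)

∑-last : ∀ n (f : ℕ → ℕ) → ∑ (suc n) f ≡ ∑ n f + f n
∑-last n f = begin
  ∑ (suc n) f                     ≡⟨ cong (λ k → ∑ k f) (+-comm 1 n) ⟩
  ∑ (n + 1) f                     ≡⟨ ∑-split n 1 f ⟩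
  ∑ n f + (f (n + 0) + 0)         ≡⟨ cong (∑ n f +_) (+-identityʳ _) ⟩
  ∑ n f + f (n + 0)               ≡⟨ cong (λ k → ∑ n f + f k) (+-identityʳ n) ⟩
  ∑ n f + f n                     ∎
  where open ≡-Reasoning

∑-extend : ∀ {m n} → m ≤ n → (f : ℕ → ℕ) → ∑ m f ≤ ∑ n f
∑-extend {m} m≤n f with k , refl ← m≤n⇒∃[o]m+o≡n m≤n =
  ≤-trans (m≤m+n (∑ m f) _) (≤-reflexive (sym (∑-split m k f)))

∑-swap : ∀ m n (f : ℕ → ℕ → ℕ) → ∑ m (λ i → ∑ n (f i)) ≡ ∑ n (λ j → ∑ m (λ i → f i j))
∑-swap zero n f = sym (∑-zero n (λ _ _ → refl))
∑-swap (suc m) n f rewrite ∑-swap m n (f ∘ suc) =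
  sym (∑-+ n (f 0) (λ j → ∑ m (λ i → f (suc i) j)))

#-mono : ∀ n {p q : ℕ → Bool} → (∀ i → i < n → p i ≡ true → q i ≡ true) → # n p ≤ # n q
#-mono n h = ∑-mono n (λ i l → ⟦⟧-mono (h i l))

#≤n : ∀ n p → # n p ≤ n
#≤n n p = ≤-trans (∑-mono n (λ i _ → ⟦⟧≤1 (p i)))
  (≤-reflexive (trans (∑-const n 1) (*-identityʳ n)))

search : ∀ n (p : ℕ → Bool) → (∃ λ i → i < n × p i ≡ true) ⊎ (∀ i → i < n → p i ≡ false)
search zero p = inj₂ λ _ ()
search (suc n) p with by-cases (p n) | search n p
... | inj₁ e | _ = inj₁ (n , ≤-refl , e)
... | inj₂ _ | inj₁ (i , l , e) = inj₁ (i , m<n⇒m<1+n l , e)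
... | inj₂ e | inj₂ none = inj₂ go
  where
  go : ∀ i → i < suc n → p i ≡ false
  go i i≤n with m≤n⇒m<n∨m≡n (s≤s⁻¹ i≤n)
  ... | inj₁ l = none i l
  ... | inj₂ refl = e

least : ∀ n (p : ℕ → Bool) → p n ≡ true →
  ∃ λ d → d ≤ n × p d ≡ true × (∀ e → e < d → p e ≡ false)
least zero p e = 0 , z≤n , e , λ _ ()
least (suc n) p e with by-cases (p 0)
... | inj₁ e0 = 0 , z≤n , e0 , λ _ ()
... | inj₂ f0 with d , l , ed , min ← least n (p ∘ suc) e =
  suc d , s≤s l , ed , λ { zero _ → f0 ; (suc j) j<d → min j (s<s⁻¹ j<d) }

<-unless-last : ∀ {n} (p : ℕ → Bool) → p n ≡ false → ∀ j → j < suc n → p j ≡ true → j < n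
<-unless-last p fn j l ej with m≤n⇒m<n∨m≡n (s≤s⁻¹ l)
... | inj₁ l′ = l′
... | inj₂ refl = ⊥-elim (true≢false (trans (sym ej) fn))

greatest : ∀ n (p : ℕ → Bool) → (∃ λ i → i < n × p i ≡ true) →
  ∃ λ b → b < n × p b ≡ true × (∀ i → i < n → p i ≡ true → i ≤ b)
greatest zero p (_ , () , _)
greatest (suc n) p (i , i<n , e) with by-cases (p n)
... | inj₁ en = n , ≤-refl , en , λ j l _ → s≤s⁻¹ l
... | inj₂ fn with b , b<n , eb , max ← greatest n p (i , <-unless-last p fn i i<n e , e) =
  b , m<n⇒m<1+n b<n , eb , λ j l ej → max j (<-unless-last p fn j l ej) ej

#-positive : ∀ n (p : ℕ → Bool) → 0 < # n p → ∃ λ i → i < n × p i ≡ true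
#-positive n p pos with search n p
... | inj₁ r = r
... | inj₂ none = ⊥-elim (<-irrefl (sym (∑-zero n (λ i l → cong ⟦_⟧ (none i l)))) pos)

-- Periodic sets that are almost closed under addition

-- Subsets of the cyclic group of order N are encoded as N-periodic predicates on ℕ: translation is
-- addition in ℕ, and a sum over one period does not depend on where the period starts (`∑-shift`).
module Periodic (N : ℕ) (β : ℕ → Bool) (per : ∀ z → β (N + z) ≡ β z) where

  ∑-shift : ∀ h (φ : ℕ → ℕ) → (∀ z → φ (N + z) ≡ φ z) → ∑ N (λ i → φ (h + i)) ≡ ∑ N φ
  ∑-shift zero φ p = refl
  ∑-shift (suc h) φ p = trans (∑-shift h (φ ∘ suc) (λ z → trans (cong φ (sym (+-suc N z))) (p (suc z))))
    (+-cancelˡ-≡ (φ 0) _ _ (begin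
      ∑ (suc N) φ    ≡⟨ ∑-last N φ ⟩
      ∑ N φ + φ N    ≡⟨ cong (∑ N φ +_) (trans (cong φ (sym (+-identityʳ N))) (p 0)) ⟩
      ∑ N φ + φ 0    ≡⟨ +-comm (∑ N φ) (φ 0) ⟩
      φ 0 + ∑ N φ    ∎))
    where open ≡-Reasoning

  per+ : ∀ h z → β (h + (N + z)) ≡ β (h + z)
  per+ h z = trans (cong β (swap h N z)) (per (h + z))
    where
    swap : ∀ a b c → a + (b + c) ≡ b + (a + c)
    swap = solve-∀

  defect : ℕ → ℕ
  defect h = # N (λ b → β b ∧ not (β (h + b)))

  defect-periodic : ∀ h → defect (N + h) ≡ defect h
  defect-periodic h = ∑-cong N λ b _ → cong (λ c → ⟦ β b ∧ not c ⟧)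
    (trans (cong β (+-assoc N h b)) (per (h + b)))

  shared : ∀ h → # N β ≡ defect h + # N (λ b → β b ∧ β (h + b))
  shared h = trans (∑-cong N λ b _ → split (β b) (β (h + b))) (∑-+ N _ _)
    where
    split : ∀ a c → ⟦ a ⟧ ≡ ⟦ a ∧ not c ⟧ + ⟦ a ∧ c ⟧
    split true true = refl
    split true false = refl
    split false c = refl

  -- β and its translate have equally many elements in a period, so their two one-sided differences
  -- have the same size.
  defect-sym : ∀ h → # N (λ b → β (h + b) ∧ not (β b)) ≡ defect h
  defect-sym h = +-cancelʳ-≡ (# N (λ b → β b ∧ β (h + b))) _ _ (begin
    # N (λ b → β (h + b) ∧ not (β b)) + # N (λ b → β b ∧ β (h + b))
      ≡⟨ sym (∑-+ N _ _) ⟩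
    ∑ N (λ b → ⟦ β (h + b) ∧ not (β b) ⟧ + ⟦ β b ∧ β (h + b) ⟧)
      ≡⟨ ∑-cong N (λ b _ → split (β (h + b)) (β b)) ⟩
    # N (λ b → β (h + b))
      ≡⟨ ∑-shift h (λ b → ⟦ β b ⟧) (λ z → cong ⟦_⟧ (per z)) ⟩
    # N β
      ≡⟨ shared h ⟩
    defect h + # N (λ b → β b ∧ β (h + b)) ∎)
    where
    open ≡-Reasoning
    split : ∀ a c → ⟦ a ∧ not c ⟧ + ⟦ c ∧ a ⟧ ≡ ⟦ a ⟧
    split true true = refl
    split true false = refl
    split false true = refl
    split false false = refl

  ∧not-triangle : ∀ a b c → ⟦ a ∧ not c ⟧ ≤ ⟦ a ∧ not b ⟧ + ⟦ b ∧ not c ⟧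
  ∧not-triangle true true c = ≤-refl
  ∧not-triangle true false c = ≤-trans (⟦⟧≤1 (not c)) (s≤s z≤n)
  ∧not-triangle false b c = z≤n

  defect-+ : ∀ h k → defect (h + k) ≤ defect k + defect h
  defect-+ h k = begin
    defect (h + k)
      ≤⟨ ∑-mono N (λ b _ → ∧not-triangle (β b) (β (k + b)) (β (h + k + b))) ⟩
    ∑ N (λ b → ⟦ β b ∧ not (β (k + b)) ⟧ + ⟦ β (k + b) ∧ not (β (h + k + b)) ⟧)
      ≡⟨ ∑-+ N _ _ ⟩
    defect k + # N (λ b → β (k + b) ∧ not (β (h + k + b)))
      ≡⟨ cong (defect k +_) (∑-cong N λ b _ → cong (λ c → ⟦ β (k + b) ∧ not (β c) ⟧) (+-assoc h k b)) ⟩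
    defect k + # N (λ b → β (k + b) ∧ not (β (h + (k + b))))
      ≡⟨ cong (defect k +_) (∑-shift k (λ c → ⟦ β c ∧ not (β (h + c)) ⟧)
           (λ z → cong₂ (λ x y → ⟦ x ∧ not y ⟧) (per z) (per+ h z))) ⟩
    defect k + defect h ∎
    where open ≤-Reasoning

  -- Plays the part of subadditivity for the difference h = (h + b) - b, without subtraction in ℕ.
  -- Returning from b + e to e costs `defect b` by symmetry.
  defect-∸ : ∀ h b → defect h ≤ defect b + defect (h + b)
  defect-∸ h b = begin
    defect h
      ≡⟨ sym (∑-shift b (λ c → ⟦ β c ∧ not (β (h + c)) ⟧)
           (λ z → cong₂ (λ x y → ⟦ x ∧ not y ⟧) (per z) (per+ h z))) ⟩
    # N (λ e → β (b + e) ∧ not (β (h + (b + e))))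
      ≤⟨ ∑-mono N (λ e _ → ∧not-triangle (β (b + e)) (β e) (β (h + (b + e)))) ⟩
    ∑ N (λ e → ⟦ β (b + e) ∧ not (β e) ⟧ + ⟦ β e ∧ not (β (h + (b + e))) ⟧)
      ≡⟨ ∑-+ N _ _ ⟩
    # N (λ e → β (b + e) ∧ not (β e)) + # N (λ e → β e ∧ not (β (h + (b + e))))
      ≡⟨ cong₂ _+_ (defect-sym b) (∑-cong N λ e _ → cong (λ c → ⟦ β e ∧ not (β c) ⟧) (sym (+-assoc h b e))) ⟩
    defect b + defect (h + b) ∎
    where open ≤-Reasoning

  defect-N : defect N ≡ 0
  defect-N = ∑-zero N λ b _ → trans (cong (λ c → ⟦ β b ∧ not c ⟧) (per b)) (contra (β b))
    where
    contra : ∀ a → ⟦ a ∧ not a ⟧ ≡ 0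
    contra true = refl
    contra false = refl

  defect-0 : defect 0 ≡ 0
  defect-0 = trans (sym (defect-periodic 0)) (trans (cong defect (+-identityʳ N)) defect-N)

  -- Double counting: an ordered pair of elements of β differs by exactly one h modulo N.
  shared-total : ∑ N (λ h → # N (λ b → β b ∧ β (h + b))) ≡ # N β * # N β
  shared-total = begin
    ∑ N (λ h → # N (λ b → β b ∧ β (h + b)))
      ≡⟨ ∑-swap N N (λ h b → ⟦ β b ∧ β (h + b) ⟧) ⟩
    ∑ N (λ b → ∑ N (λ h → ⟦ β b ∧ β (h + b) ⟧))
      ≡⟨ ∑-cong N (λ b _ → inner b) ⟩
    ∑ N (λ b → # N β * ⟦ β b ⟧)
      ≡⟨ ∑-* N (# N β) (λ b → ⟦ β b ⟧) ⟩
    # N β * # N β ∎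
    where
    open ≡-Reasoning
    ind : ∀ a c → ⟦ a ∧ c ⟧ ≡ ⟦ a ⟧ * ⟦ c ⟧
    ind true true = refl
    ind true false = refl
    ind false c = refl
    inner : ∀ b → ∑ N (λ h → ⟦ β b ∧ β (h + b) ⟧) ≡ # N β * ⟦ β b ⟧
    inner b = begin
      ∑ N (λ h → ⟦ β b ∧ β (h + b) ⟧)
        ≡⟨ ∑-cong N (λ h _ → trans (ind (β b) (β (h + b))) (cong (λ c → ⟦ β b ⟧ * ⟦ β c ⟧) (+-comm h b))) ⟩
      ∑ N (λ h → ⟦ β b ⟧ * ⟦ β (b + h) ⟧)
        ≡⟨ ∑-* N ⟦ β b ⟧ _ ⟩
      ⟦ β b ⟧ * # N (λ h → β (b + h))
        ≡⟨ cong (⟦ β b ⟧ *_) (∑-shift b (λ c → ⟦ β c ⟧) (λ z → cong ⟦_⟧ (per z))) ⟩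
      ⟦ β b ⟧ * # N β
        ≡⟨ *-comm ⟦ β b ⟧ (# N β) ⟩
      # N β * ⟦ β b ⟧ ∎

∑-multiples : ∀ ν d (φ : ℕ → ℕ) → 1 ≤ d → ∑ ν (λ i → φ (i * d)) ≤ ∑ (ν * d) φ
∑-multiples zero d φ _ = z≤n
∑-multiples (suc ν) (suc d) φ 1≤d = begin
  φ 0 + ∑ ν (λ i → φ (suc d + i * suc d))
    ≤⟨ m≤m+n (φ 0) (∑ d (φ ∘ suc)) ⊹ ∑-multiples ν (suc d) (λ j → φ (suc d + j)) 1≤d ⟩
  ∑ (suc d) φ + ∑ (ν * suc d) (λ j → φ (suc d + j))
    ≡⟨ sym (∑-split (suc d) (ν * suc d) φ) ⟩
  ∑ (suc ν * suc d) φ ∎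
  where open ≤-Reasoning

-- The translations that nearly preserve β form a subgroup, because a defect of
-- at most 4K/T is automatically at most 2K/T.
module NearSubgroup (N : ℕ) (1≤N : 1 ≤ N) (β : ℕ → Bool) (per : ∀ z → β (N + z) ≡ β z)
  (T K : ℕ)
  (few : T * # N (λ x → β x ∧ not (T * Periodic.defect N β per x ≤ᵇ K)) ≤ K)
  (many : 6 * K < T * # N β) where

  open Periodic N β per

  large : ℕ → Bool
  large x = β x ∧ not (T * defect x ≤ᵇ K)

  -- If some b has both b and h + b in β with small defect, then h is a difference of two such
  -- elements and inherits the bound 2K/T. Otherwise each b in β either leaves β under h, or is
  -- large, or has h + b large, so T|β| ≤ 4K + K + K, against `many`.
  gap : ∀ h → T * defect h ≤ 4 * K → T * defect h ≤ 2 * K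
  gap h small with search N (λ b → (β b ∧ (T * defect b ≤ᵇ K)) ∧ (β (h + b) ∧ (T * defect (h + b) ≤ᵇ K)))
  ... | inj₁ (b , _ , e) = begin
    T * defect h                               ≤⟨ T ⊛ defect-∸ h b ⟩
    T * (defect b + defect (h + b))            ≡⟨ *-distribˡ-+ T _ _ ⟩
    T * defect b + T * defect (h + b)          ≤⟨ smallᵇ ⊹ smallʰ ⟩
    K + K                                      ≡⟨ cong (K +_) (sym (+-identityʳ K)) ⟩
    2 * K                                      ∎
    where
    open ≤-Reasoning
    both = ∧-true {β b ∧ (T * defect b ≤ᵇ K)} e
    smallᵇ : T * defect b ≤ K
    smallᵇ = true-≤ᵇ (proj₂ (∧-true {β b} (proj₁ both)))
    smallʰ : T * defect (h + b) ≤ K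
    smallʰ = true-≤ᵇ (proj₂ (∧-true {β (h + b)} (proj₂ both)))
  ... | inj₂ none = ⊥-elim (<-irrefl refl (begin-strict
    6 * K                                            <⟨ many ⟩
    T * # N β                                        ≤⟨ T ⊛ cover ⟩
    T * (defect h + # N large + # N large)           ≡⟨ expand T _ _ ⟩
    T * defect h + T * # N large + T * # N large     ≤⟨ small ⊹ few ⊹ few ⟩
    4 * K + K + K                                    ≡⟨ collect K ⟩
    6 * K                                            ∎))
    where
    open ≤-Reasoning
    expand : ∀ t x y → t * (x + y + y) ≡ t * x + t * y + t * y
    expand = solve-∀
    collect : ∀ k → 4 * k + k + k ≡ 6 * k
    collect = solve-∀
    bool : ∀ a c p q → (a ∧ p) ∧ (c ∧ q) ≡ false →
      ⟦ a ⟧ ≤ ⟦ a ∧ not c ⟧ + ⟦ a ∧ not p ⟧ + ⟦ c ∧ not q ⟧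
    bool false c p q _ = z≤n
    bool true false p q _ = s≤s z≤n
    bool true true false q _ = s≤s z≤n
    bool true true true false _ = s≤s z≤n
    cover : # N β ≤ defect h + # N large + # N large
    cover = begin
      # N β
        ≤⟨ ∑-mono N (λ b l → bool (β b) (β (h + b)) _ _ (none b l)) ⟩
      ∑ N (λ b → ⟦ β b ∧ not (β (h + b)) ⟧ + ⟦ large b ⟧ + ⟦ large (h + b) ⟧)
        ≡⟨ ∑-+ N _ _ ⟩
      ∑ N (λ b → ⟦ β b ∧ not (β (h + b)) ⟧ + ⟦ large b ⟧) + # N (λ b → large (h + b))
        ≡⟨ cong₂ _+_ (∑-+ N _ _) (∑-shift h (λ b → ⟦ large b ⟧)
             (λ z → cong₂ (λ x y → ⟦ x ∧ not (T * y ≤ᵇ K) ⟧) (per z) (defect-periodic z))) ⟩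
      defect h + # N large + # N large ∎

  good : ℕ → Set
  good h = T * defect h ≤ 2 * K

  sum-bounds : T * 0 ≤ 2 * K × (∀ {x y} → T * x ≤ 2 * K → T * y ≤ 2 * K → T * (x + y) ≤ 4 * K)
  sum-bounds = ≤-trans (≤-reflexive (*-zeroʳ T)) z≤n , λ {x} {y} p q →
    ≤-trans (≤-reflexive (*-distribˡ-+ T x y)) (≤-trans (p ⊹ q) (≤-reflexive (double K)))
    where
    double : ∀ k → 2 * k + 2 * k ≡ 4 * k
    double = solve-∀

  good-+ : ∀ h k → good h → good k → good (h + k)
  good-+ h k p q = gap (h + k) (≤-trans (T ⊛ defect-+ h k) (proj₂ sum-bounds q p))

  good-∸ : ∀ h k → good k → good (h + k) → good h
  good-∸ h k p q = gap h (≤-trans (T ⊛ defect-∸ h k) (proj₂ sum-bounds p q))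

  good-0 : good 0
  good-0 = subst (λ x → T * x ≤ 2 * K) (sym defect-0) (proj₁ sum-bounds)

  good-N : good N
  good-N = subst (λ x → T * x ≤ 2 * K) (sym defect-N) (proj₁ sum-bounds)

  good-multiple : ∀ d → good d → ∀ j → good (j * d)
  good-multiple d p zero = good-0
  good-multiple d p (suc j) = good-+ d (j * d) p (good-multiple d p j)

  -- Division with remainder: the remainder of x is x minus a multiple of the generator, hence good,
  -- and minimality forces it to vanish.
  minimal-divides : ∀ d → good (suc d) → (∀ e → e < d → (T * defect (suc e) ≤ᵇ 2 * K) ≡ false) →
    ∀ x → good x → suc d ∣ x
  minimal-divides d gd minimal x gx = m%n≡0⇒n∣m x (suc d) (zero-rem (x % suc d) (m%n<n x (suc d))
    (good-∸ (x % suc d) (x / suc d * suc d) (good-multiple (suc d) gd (x / suc d))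
      (subst good (m≡m%n+[m/n]*n x (suc d)) gx)))
    where
    zero-rem : ∀ r → r < suc d → good r → r ≡ 0
    zero-rem zero _ _ = refl
    zero-rem (suc r) r<d gr = ⊥-elim (true≢false (trans (sym (≤ᵇ-true gr)) (minimal r (s<s⁻¹ r<d))))

  -- Bounds the order ν of the subgroup. Each of its ν translations keeps at least |β| - 2K/T
  -- elements of β inside β, while all N translations together keep |β|²; up to the error term this
  -- says ν ≤ |β|.
  count-multiples : ∀ d ν → 1 ≤ d → N ≡ ν * d → good d →
    T * (ν * # N β) ≤ T * (# N β * # N β) + ν * (2 * K)
  count-multiples d ν 1≤d N≡νd gd = begin
    T * (ν * # N β)
      ≡⟨ regroup T ν (# N β) ⟩
    ν * (T * # N β)
      ≡⟨ sym (∑-const ν (T * # N β)) ⟩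
    ∑ ν (λ _ → T * # N β)
      ≤⟨ ∑-mono ν (λ i _ → each i) ⟩
    ∑ ν (λ i → T * common (i * d) + 2 * K)
      ≡⟨ ∑-+ ν _ _ ⟩
    ∑ ν (λ i → T * common (i * d)) + ∑ ν (λ _ → 2 * K)
      ≡⟨ cong₂ _+_ (∑-* ν T (λ i → common (i * d))) (∑-const ν (2 * K)) ⟩
    T * ∑ ν (λ i → common (i * d)) + ν * (2 * K)
      ≤⟨ T ⊛ ∑-multiples ν d common 1≤d ⊹ ≤-refl ⟩
    T * ∑ (ν * d) common + ν * (2 * K)
      ≡⟨ cong (λ k → T * ∑ k common + ν * (2 * K)) (sym N≡νd) ⟩
    T * ∑ N common + ν * (2 * K)
      ≡⟨ cong (λ k → T * k + ν * (2 * K)) shared-total ⟩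
    T * (# N β * # N β) + ν * (2 * K) ∎
    where
    open ≤-Reasoning
    common : ℕ → ℕ
    common h = # N (λ b → β b ∧ β (h + b))
    regroup : ∀ a b c → a * (b * c) ≡ b * (a * c)
    regroup = solve-∀
    each : ∀ i → T * # N β ≤ T * common (i * d) + 2 * K
    each i = begin
      T * # N β                                     ≡⟨ cong (T *_) (shared (i * d)) ⟩
      T * (defect (i * d) + common (i * d))         ≡⟨ *-distribˡ-+ T _ _ ⟩
      T * defect (i * d) + T * common (i * d)       ≡⟨ +-comm (T * defect (i * d)) _ ⟩
      T * common (i * d) + T * defect (i * d)       ≤⟨ +-monoʳ-≤ _ (good-multiple d gd i) ⟩
      T * common (i * d) + 2 * K                    ∎

  generator : ∃ λ d → ∃ λ ν → 1 ≤ d × N ≡ ν * d × (∀ x → good x → d ∣ x)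
    × T * (ν * # N β) ≤ T * (# N β * # N β) + ν * (2 * K)
  -- The shift by one excludes the trivial translation 0. The search succeeds because N acts
  -- trivially and is positive.
  generator with least (pred N) (λ e → T * defect (suc e) ≤ᵇ 2 * K)
                   (≤ᵇ-true (subst good (sym (suc-pred N {{>-nonZero 1≤N}})) good-N))
  ... | d , _ , gd , minimal with minimal-divides d (true-≤ᵇ gd) minimal N good-N
  ...   | divides ν N≡νd = suc d , ν , s≤s z≤n , N≡νd , minimal-divides d (true-≤ᵇ gd) minimal
          , count-multiples (suc d) ν (s≤s z≤n) N≡νd (true-≤ᵇ gd)

-- Stability

∑-window : ∀ N n a (f : ℕ → ℕ) → a + N ≤ n → ∑ N (λ i → f (a + i)) ≤ ∑ n f
∑-window N n a f l = begin
  ∑ N (λ i → f (a + i))              ≤⟨ m≤n+m _ (∑ a f) ⟩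
  ∑ a f + ∑ N (λ i → f (a + i))      ≡⟨ sym (∑-split a N f) ⟩
  ∑ (a + N) f                        ≤⟨ ∑-extend l f ⟩
  ∑ n f                              ∎
  where open ≤-Reasoning

markov : ∀ n c t (p : ℕ → Bool) (f : ℕ → ℕ) →
  c * # n (λ x → p x ∧ not (t * f x ≤ᵇ c)) ≤ t * ∑ n (λ x → ⟦ p x ⟧ * f x)
markov n c t p f = begin
  c * # n (λ x → p x ∧ not (t * f x ≤ᵇ c))        ≡⟨ sym (∑-* n c _) ⟩
  ∑ n (λ x → c * ⟦ p x ∧ not (t * f x ≤ᵇ c) ⟧)    ≤⟨ ∑-mono n (λ x _ → each (p x) (f x)) ⟩
  ∑ n (λ x → t * (⟦ p x ⟧ * f x))                 ≡⟨ ∑-* n t _ ⟩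
  t * ∑ n (λ x → ⟦ p x ⟧ * f x)                   ∎
  where
  open ≤-Reasoning
  each : ∀ b y → c * ⟦ b ∧ not (t * y ≤ᵇ c) ⟧ ≤ t * (⟦ b ⟧ * y)
  each false y = ≤-trans (≤-reflexive (*-zeroʳ c)) z≤n
  each true y with by-cases (t * y ≤ᵇ c)
  ... | inj₁ e rewrite e = ≤-trans (≤-reflexive (*-zeroʳ c)) z≤n
  ... | inj₂ e rewrite e = ≤-trans (≤-reflexive (*-identityʳ c))
        (≤-trans (<⇒≤ (false-≤ᵇ e)) (≤-reflexive (cong (t *_) (sym (+-identityʳ y)))))

∧-not-true : ∀ c {p} → p ≡ true → ⟦ c ∧ not p ⟧ ≡ 0
∧-not-true true refl = refl
∧-not-true false _ = refl

¬true⇒false : ∀ {b} → ¬ (b ≡ true) → b ≡ false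
¬true⇒false {true} h = ⊥-elim (h refl)
¬true⇒false {false} _ = refl

-- A small degree means that D nearly contains x + C; `misses` counts the ordered pairs of C whose
-- sum escapes D.
deg : ℕ → (C D : ℕ → Bool) → ℕ → ℕ
deg n C D x = # n (λ y → C y ∧ not (D (x + y)))

misses : ℕ → (C D : ℕ → Bool) → ℕ
misses n C D = ∑ n (λ x → ⟦ C x ⟧ * deg n C D x)

few-large-deg : ∀ n (C D : ℕ → Bool) F → 1 ≤ # n C → F * F * misses n C D ≤ # n C * # n C →
  F * # n (λ x → C x ∧ not (F * deg n C D x ≤ᵇ # n C)) ≤ # n C
few-large-deg n C D F 1≤κ closed = *-cancelˡ-≤ κ {{>-nonZero 1≤κ}} (begin
  κ * (F * X)                ≡⟨ regroup κ F X ⟩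
  F * (κ * X)                ≤⟨ F ⊛ markov n κ F C (deg n C D) ⟩
  F * (F * misses n C D)     ≡⟨ sym (*-assoc F F _) ⟩
  F * F * misses n C D       ≤⟨ closed ⟩
  κ * κ                      ∎)
  where
  open ≤-Reasoning
  κ = # n C
  X = # n (λ x → C x ∧ not (F * deg n C D x ≤ᵇ κ))
  regroup : ∀ a b c → a * (b * c) ≡ b * (a * c)
  regroup = solve-∀

-- The ends a and a + N are the extreme elements of C of small degree. Writing the length of the
-- ambient interval as a + (N + suc r) lets sums be split at both ends without subtraction.
module Interval (C D : ℕ → Bool) (m T a N r : ℕ)
  (8≤T : 8 ≤ T)
  (F≤κ : 9 * (T * T) ≤ # (a + (N + suc r)) C)
  (D≤m : # (a + (N + suc r) + (a + (N + suc r))) D ≤ m)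
  (dense : 9 * (T * T) * m ≤ (2 * (9 * (T * T)) + 2) * # (a + (N + suc r)) C)
  (closed : 9 * (T * T) * (9 * (T * T)) * misses (a + (N + suc r)) C D
            ≤ # (a + (N + suc r)) C * # (a + (N + suc r)) C)
  (low : ∀ x → x < a → C x ≡ true →
    (9 * (T * T) * deg (a + (N + suc r)) C D x ≤ᵇ # (a + (N + suc r)) C) ≡ false)
  (high : ∀ i → i < r → C (a + (N + suc i)) ≡ true →
    (9 * (T * T) * deg (a + (N + suc r)) C D (a + (N + suc i)) ≤ᵇ # (a + (N + suc r)) C) ≡ false)
  (small-a : 9 * (T * T) * deg (a + (N + suc r)) C D a ≤ # (a + (N + suc r)) C)
  (small-b : 9 * (T * T) * deg (a + (N + suc r)) C D (a + N) ≤ # (a + (N + suc r)) C)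
  where

  n κ F : ℕ
  n = a + (N + suc r)
  κ = # n C
  F = 9 * (T * T)

  B X : ℕ
  B = # N (λ z → C (a + z))
  X = # n (λ x → C x ∧ not (F * deg n C D x ≤ᵇ κ))

  1≤T : 1 ≤ T
  1≤T = ≤-trans (s≤s z≤n) 8≤T

  1≤F : 1 ≤ F
  1≤F = ≤-trans (s≤s z≤n) (9 ⊛ *-mono-≤ 1≤T 1≤T)

  1≤κ : 1 ≤ κ
  1≤κ = ≤-trans 1≤F F≤κ

  instance
    nonZero-κ : NonZero κ
    nonZero-κ = >-nonZero 1≤κ
    nonZero-T : NonZero T
    nonZero-T = >-nonZero 1≤T

  FX≤κ : F * X ≤ κ
  FX≤κ = few-large-deg n C D F 1≤κ closed

  -- The elements of C outside [a , a + N] are among the few of large degree.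
  #-restrict : ∀ (p : ℕ → Bool) → (∀ x → p x ≡ true → C x ≡ true) →
    # n p ≤ # N (λ z → p (a + z)) + ⟦ p (a + N) ⟧ + X
  #-restrict p p⊆C = begin
    # n p
      ≡⟨ split p ⟩
    # a p + (# N (λ z → p (a + z)) + (⟦ p (a + (N + 0)) ⟧ + # r (λ i → p (a + (N + suc i)))))
      ≤⟨ #-mono a (λ x l e → true-∧ (p⊆C x e) (cong not (low x l (p⊆C x e))))
         ⊹ (≤-refl {# N (λ z → p (a + z))} ⊹ (≤-reflexive (cong (λ k → ⟦ p (a + k) ⟧) (+-identityʳ N))
         ⊹ #-mono r (λ i l e → true-∧ (p⊆C _ e) (cong not (high i l (p⊆C _ e)))))) ⟩
    # a x′ + (# N (λ z → p (a + z)) + (⟦ p (a + N) ⟧ + # r (λ i → x′ (a + (N + suc i)))))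
      ≤⟨ ≤-from (# N (λ z → x′ (a + z)) + ⟦ x′ (a + (N + 0)) ⟧)
           (rearrange (# a x′) (# N (λ z → p (a + z))) ⟦ p (a + N) ⟧ (# r (λ i → x′ (a + (N + suc i))))
              (# N (λ z → x′ (a + z))) ⟦ x′ (a + (N + 0)) ⟧)
           (≤-refl {0}) ⟩
    # N (λ z → p (a + z)) + ⟦ p (a + N) ⟧ + (# a x′ + (# N (λ z → x′ (a + z)) + (⟦ x′ (a + (N + 0)) ⟧ + # r (λ i → x′ (a + (N + suc i))))))
      ≡⟨ cong (# N (λ z → p (a + z)) + ⟦ p (a + N) ⟧ +_) (sym (split x′)) ⟩
    # N (λ z → p (a + z)) + ⟦ p (a + N) ⟧ + X ∎
    where
    open ≤-Reasoning
    x′ : ℕ → Bool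
    x′ x = C x ∧ not (F * deg n C D x ≤ᵇ κ)
    split : ∀ q → # n q ≡ # a q + (# N (λ z → q (a + z)) + (⟦ q (a + (N + 0)) ⟧ + # r (λ i → q (a + (N + suc i)))))
    split q = trans (∑-split a (N + suc r) _) (cong (# a q +_) (∑-split N (suc r) _))
    rearrange : ∀ a b c d e f → a + (b + (c + d)) + 0 + (e + f) ≡ b + c + (a + (e + (f + d))) + 0
    rearrange = solve-∀

  κ≤B+1+X : κ ≤ B + 1 + X
  κ≤B+1+X = ≤-trans (#-restrict C (λ _ e → e)) (≤-refl {B} ⊹ ⟦⟧≤1 (C (a + N)) ⊹ ≤-refl)

  -- One κ pays for the elements of large degree, the other, through F ≤ κ, for the endpoint a + N
  -- that the half-open window of `B` omits.
  Fκ≤FB+2κ : F * κ ≤ F * B + 2 * κ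
  Fκ≤FB+2κ = ≤-from 0 (identity F κ B X) (F ⊛ κ≤B+1+X ⊹ FX≤κ ⊹ F≤κ)
    where
    identity : ∀ F κ B X → F * κ + (F * (B + 1 + X) + κ + κ) + 0 ≡ F * B + 2 * κ + (F * κ + F * X + F)
    identity = solve-∀

  B≤κ : B ≤ κ
  B≤κ = ∑-window N n a _ (+-monoʳ-≤ a (m≤m+n N (suc r)))

  1≤N : 1 ≤ N
  1≤N = n≢0⇒n>0 λ N≡0 → <-irrefl refl (*-cancelʳ-≤ 3 2 κ (begin
    3 * κ            ≤⟨ *-monoˡ-≤ κ 3≤F ⟩
    F * κ            ≤⟨ Fκ≤FB+2κ ⟩
    F * B + 2 * κ    ≡⟨ cong (λ b → F * b + 2 * κ) (n≤0⇒n≡0 (subst (B ≤_) N≡0 (#≤n N _))) ⟩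
    F * 0 + 2 * κ    ≡⟨ cong (_+ 2 * κ) (*-zeroʳ F) ⟩
    2 * κ            ∎))
    where
    open ≤-Reasoning
    3≤F : 3 ≤ F
    3≤F = ≤-trans (s≤s (s≤s (s≤s z≤n))) (9 ⊛ *-mono-≤ 1≤T 1≤T)

  instance
    nonZero-N : NonZero N
    nonZero-N = >-nonZero 1≤N

  -- The part of C in the window, read modulo N; this identifies the two ends a and a + N.
  β : ℕ → Bool
  β z = C (a + z % N)

  per : ∀ z → β (N + z) ≡ β z
  per z = cong (λ k → C (a + k)) (trans (cong (_% N) (+-comm N z)) ([m+n]%n≡m%n z N))

  β-below : ∀ z → z < N → β z ≡ C (a + z)
  β-below z l = cong (λ k → C (a + k)) (m<n⇒m%n≡m l)

  #β : # N β ≡ B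
  #β = ∑-cong N (λ z l → cong ⟦_⟧ (β-below z l))

  open Periodic N β per

  a+N≤n : a + N ≤ n
  a+N≤n = +-monoʳ-≤ a (m≤m+n N (suc r))

  -- Elements of D in the window of sums, sorted by whether their residue lies in β. The first kind
  -- already uses up almost all of |D| ≤ m, so the second kind is rare.
  inner outer : ℕ
  inner = # (N + N) (λ z → D (a + a + z) ∧ β z)
  outer = # (N + N) (λ z → D (a + a + z) ∧ not (β z))

  -- Adding a sends the window to the first N places after 2a and adding a + N sends it to the next
  -- N. The two images are disjoint and have the same residues; only the missing pairs at a and a +
  -- N are lost.
  2B≤ : B + B ≤ inner + (deg n C D a + deg n C D (a + N))
  2B≤ = begin
    B + B
      ≤⟨ half₁ ⊹ half₂ ⟩
    # N (λ z → D (a + a + z) ∧ β z) + deg n C D a + (# N (λ z → D (a + a + (N + z)) ∧ β (N + z)) + deg n C D (a + N))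
      ≡⟨ rearrange (# N (λ z → D (a + a + z) ∧ β z)) _ (# N (λ z → D (a + a + (N + z)) ∧ β (N + z))) _ ⟩
    # N (λ z → D (a + a + z) ∧ β z) + # N (λ z → D (a + a + (N + z)) ∧ β (N + z)) + (deg n C D a + deg n C D (a + N))
      ≡⟨ cong (_+ (deg n C D a + deg n C D (a + N))) (sym (∑-split N N _)) ⟩
    inner + (deg n C D a + deg n C D (a + N)) ∎
    where
    open ≤-Reasoning
    rearrange : ∀ a b c d → a + b + (c + d) ≡ a + c + (b + d)
    rearrange = solve-∀
    bool : ∀ c d → ⟦ c ⟧ ≤ ⟦ d ∧ c ⟧ + ⟦ c ∧ not d ⟧
    bool true true = ≤-refl
    bool true false = ≤-refl
    bool false d = z≤n
    half₁ : B ≤ # N (λ z → D (a + a + z) ∧ β z) + deg n C D a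
    half₁ = begin
      B ≤⟨ ∑-mono N (λ z _ → bool (C (a + z)) (D (a + a + z))) ⟩
      ∑ N (λ z → ⟦ D (a + a + z) ∧ C (a + z) ⟧ + ⟦ C (a + z) ∧ not (D (a + a + z)) ⟧)
        ≡⟨ ∑-+ N _ _ ⟩
      # N (λ z → D (a + a + z) ∧ C (a + z)) + # N (λ z → C (a + z) ∧ not (D (a + a + z)))
        ≡⟨ cong₂ _+_ (∑-cong N (λ z l → cong (λ c → ⟦ D (a + a + z) ∧ c ⟧) (sym (β-below z l))))
                     (∑-cong N (λ z _ → cong (λ c → ⟦ C (a + z) ∧ not (D c) ⟧) (+-assoc a a z))) ⟩
      # N (λ z → D (a + a + z) ∧ β z) + # N (λ z → C (a + z) ∧ not (D (a + (a + z))))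
        ≤⟨ +-monoʳ-≤ _ (∑-window N n a _ a+N≤n) ⟩
      # N (λ z → D (a + a + z) ∧ β z) + deg n C D a ∎
    half₂ : B ≤ # N (λ z → D (a + a + (N + z)) ∧ β (N + z)) + deg n C D (a + N)
    half₂ = begin
      B ≤⟨ ∑-mono N (λ z _ → bool (C (a + z)) (D (a + a + (N + z)))) ⟩
      ∑ N (λ z → ⟦ D (a + a + (N + z)) ∧ C (a + z) ⟧ + ⟦ C (a + z) ∧ not (D (a + a + (N + z))) ⟧)
        ≡⟨ ∑-+ N _ _ ⟩
      # N (λ z → D (a + a + (N + z)) ∧ C (a + z)) + # N (λ z → C (a + z) ∧ not (D (a + a + (N + z))))
        ≡⟨ cong₂ _+_ (∑-cong N (λ z l → cong (λ c → ⟦ D (a + a + (N + z)) ∧ c ⟧) (sym (trans (per z) (β-below z l)))))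
                     (∑-cong N (λ z _ → cong (λ c → ⟦ C (a + z) ∧ not (D c) ⟧) (reassoc a N z))) ⟩
      # N (λ z → D (a + a + (N + z)) ∧ β (N + z)) + # N (λ z → C (a + z) ∧ not (D (a + N + (a + z))))
        ≤⟨ +-monoʳ-≤ _ (∑-window N n a _ a+N≤n) ⟩
      # N (λ z → D (a + a + (N + z)) ∧ β (N + z)) + deg n C D (a + N) ∎
      where
      reassoc : ∀ a N z → a + a + (N + z) ≡ a + N + (a + z)
      reassoc = solve-∀

  inner+outer≤m : inner + outer ≤ m
  inner+outer≤m = begin
    inner + outer
      ≡⟨ sym (∑-+ (N + N) _ _) ⟩
    ∑ (N + N) (λ z → ⟦ D (a + a + z) ∧ β z ⟧ + ⟦ D (a + a + z) ∧ not (β z) ⟧)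
      ≡⟨ ∑-cong (N + N) (λ z _ → bool (D (a + a + z)) (β z)) ⟩
    # (N + N) (λ z → D (a + a + z))
      ≤⟨ ∑-window (N + N) (n + n) (a + a) _
           (≤-trans (≤-reflexive (rearrange a N)) (a+N≤n ⊹ a+N≤n)) ⟩
    # (n + n) D
      ≤⟨ D≤m ⟩
    m ∎
    where
    open ≤-Reasoning
    rearrange : ∀ a N → a + a + (N + N) ≡ a + N + (a + N)
    rearrange = solve-∀
    bool : ∀ d c → ⟦ d ∧ c ⟧ + ⟦ d ∧ not c ⟧ ≡ ⟦ d ⟧
    bool true true = refl
    bool true false = refl
    bool false c = refl

  -- The 8 collects 2 from the density hypothesis, 1 from each of the degrees of a and a + N, and 2
  -- for each of the two replacements of `B` by κ.
  Fouter≤8κ : F * outer ≤ 8 * κ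
  Fouter≤8κ = ≤-from 0 (identity F outer inner κ B m (deg n C D a) (deg n C D (a + N)))
    (F ⊛ 2B≤ ⊹ F ⊛ inner+outer≤m ⊹ small-a ⊹ small-b ⊹ dense ⊹ 2 ⊛ Fκ≤FB+2κ)
    where
    identity : ∀ F o i κ B m x y →
      F * o + (F * (i + (x + y)) + F * m + κ + κ + (2 * F + 2) * κ + 2 * (F * B + 2 * κ)) + 0
      ≡ 8 * κ + (F * (B + B) + F * (i + o) + F * x + F * y + F * m + 2 * (F * κ))
    identity = solve-∀

  2Fκ≤Fm+6κ : 2 * (F * κ) ≤ F * m + 6 * κ
  2Fκ≤Fm+6κ = ≤-from (F * outer) (identity F outer inner κ B m (deg n C D a) (deg n C D (a + N)))
    (F ⊛ 2B≤ ⊹ F ⊛ inner+outer≤m ⊹ small-a ⊹ small-b ⊹ 2 ⊛ Fκ≤FB+2κ)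
    where
    identity : ∀ F o i κ B m x y →
      2 * (F * κ) + (F * (i + (x + y)) + F * m + κ + κ + 2 * (F * B + 2 * κ)) + F * o
      ≡ F * m + 6 * κ + (F * (B + B) + F * (i + o) + F * x + F * y + 2 * (F * κ))
    identity = solve-∀

  2Tκ≤Tm+2κ : 2 * (T * κ) ≤ T * m + 2 * κ
  2Tκ≤Tm+2κ = *-cancelˡ-≤ (9 * T) {{m*n≢0 9 T}} (begin
    9 * T * (2 * (T * κ))            ≡⟨ shape₁ T κ ⟩
    2 * (F * κ)                      ≤⟨ 2Fκ≤Fm+6κ ⟩
    F * m + 6 * κ                    ≤⟨ +-monoʳ-≤ (F * m) (≤-trans (≤-reflexive (sym (*-identityˡ (6 * κ))))
                                          (*-monoˡ-≤ (6 * κ) 1≤T)) ⟩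
    F * m + T * (6 * κ)              ≤⟨ ≤-from (12 * (T * κ)) (shape₂ T m κ) (≤-refl {0}) ⟩
    9 * T * (T * m + 2 * κ)          ∎)
    where
    open ≤-Reasoning
    shape₁ : ∀ T κ → 9 * T * (2 * (T * κ)) ≡ 2 * (9 * (T * T) * κ)
    shape₁ = solve-∀
    shape₂ : ∀ T m κ → 9 * (T * T) * m + T * (6 * κ) + 0 + 12 * (T * κ) ≡ 9 * T * (T * m + 2 * κ) + 0
    shape₂ = solve-∀

  Tκ≤TB+κ : T * κ ≤ T * B + κ
  Tκ≤TB+κ = *-cancelˡ-≤ (9 * T) {{m*n≢0 9 T}} (begin
    9 * T * (T * κ)              ≡⟨ shape₁ T κ ⟩
    F * κ                        ≤⟨ Fκ≤FB+2κ ⟩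
    F * B + 2 * κ                ≤⟨ +-monoʳ-≤ (F * B) (≤-trans (≤-reflexive (sym (*-identityˡ (2 * κ))))
                                          (*-monoˡ-≤ (2 * κ) 1≤T)) ⟩
    F * B + T * (2 * κ)          ≤⟨ ≤-from (7 * (T * κ)) (shape₂ T B κ) (≤-refl {0}) ⟩
    9 * T * (T * B + κ)          ∎)
    where
    open ≤-Reasoning
    shape₁ : ∀ T κ → 9 * T * (T * κ) ≡ 9 * (T * T) * κ
    shape₁ = solve-∀
    shape₂ : ∀ T B κ → 9 * (T * T) * B + T * (2 * κ) + 0 + 7 * (T * κ) ≡ 9 * T * (T * B + κ) + 0
    shape₂ = solve-∀

  many : 6 * κ < T * # N β
  many = subst (λ b → 6 * κ < T * b) (sym #β)
    (≤-from 0 (shape κ T B) (Tκ≤TB+κ ⊹ *-monoˡ-≤ κ 8≤T ⊹ 1≤κ))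
    where
    shape : ∀ κ T B → 1 + 6 * κ + (T * B + κ + T * κ + κ) + 0 ≡ T * B + (T * κ + 8 * κ + 1)
    shape = solve-∀

  -- If x and y lie in β and x + y does not, then 2a + x + y is either outside D, which makes a
  -- missing pair, or one of the `outer` elements; for fixed x each of these is hit at most once.
  sum-defect : ∑ N (λ x → ⟦ β x ⟧ * defect x) ≤ misses n C D + B * outer
  sum-defect = begin
    ∑ N (λ x → ⟦ β x ⟧ * defect x)
      ≤⟨ ∑-mono N each ⟩
    ∑ N (λ x → ⟦ C (a + x) ⟧ * deg n C D (a + x) + outer * ⟦ C (a + x) ⟧)
      ≡⟨ trans (∑-+ N _ _) (cong (∑ N (λ x → ⟦ C (a + x) ⟧ * deg n C D (a + x)) +_) (∑-* N outer _)) ⟩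
    ∑ N (λ x → ⟦ C (a + x) ⟧ * deg n C D (a + x)) + outer * B
      ≤⟨ ∑-window N n a (λ x → ⟦ C x ⟧ * deg n C D x) a+N≤n ⊹ ≤-reflexive (*-comm outer B) ⟩
    misses n C D + B * outer ∎
    where
    open ≤-Reasoning
    bool : ∀ b c d → ⟦ b ∧ not c ⟧ ≤ ⟦ b ∧ not d ⟧ + ⟦ d ∧ not c ⟧
    bool true c true = ≤-refl
    bool true c false = ≤-trans (⟦⟧≤1 (not c)) (s≤s z≤n)
    bool false c d = z≤n
    reassoc : ∀ a x y → a + a + (x + y) ≡ a + x + (a + y)
    reassoc = solve-∀
    defect≤ : ∀ x → x < N → defect x ≤ deg n C D (a + x) + outer
    defect≤ x x<N = begin
      defect x
        ≤⟨ ∑-mono N (λ y _ → bool (β y) (β (x + y)) (D (a + a + (x + y)))) ⟩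
      ∑ N (λ y → ⟦ β y ∧ not (D (a + a + (x + y))) ⟧ + ⟦ D (a + a + (x + y)) ∧ not (β (x + y)) ⟧)
        ≡⟨ ∑-+ N _ _ ⟩
      # N (λ y → β y ∧ not (D (a + a + (x + y)))) + # N (λ y → D (a + a + (x + y)) ∧ not (β (x + y)))
        ≡⟨ cong (_+ # N (λ y → D (a + a + (x + y)) ∧ not (β (x + y))))
             (∑-cong N (λ y l → cong₂ (λ p q → ⟦ p ∧ not (D q) ⟧) (β-below y l) (reassoc a x y))) ⟩
      # N (λ y → C (a + y) ∧ not (D (a + x + (a + y)))) + # N (λ y → D (a + a + (x + y)) ∧ not (β (x + y)))
        ≤⟨ ∑-window N n a (λ y → ⟦ C y ∧ not (D (a + x + y)) ⟧) a+N≤n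
           ⊹ ∑-window N (N + N) x (λ z → ⟦ D (a + a + z) ∧ not (β z) ⟧) (+-monoˡ-≤ N (<⇒≤ x<N)) ⟩
      deg n C D (a + x) + outer ∎
    each : ∀ x → x < N → ⟦ β x ⟧ * defect x ≤ ⟦ C (a + x) ⟧ * deg n C D (a + x) + outer * ⟦ C (a + x) ⟧
    each x x<N = begin
      ⟦ β x ⟧ * defect x
        ≡⟨ cong (λ c → ⟦ c ⟧ * defect x) (β-below x x<N) ⟩
      ⟦ C (a + x) ⟧ * defect x
        ≤⟨ ⟦ C (a + x) ⟧ ⊛ defect≤ x x<N ⟩
      ⟦ C (a + x) ⟧ * (deg n C D (a + x) + outer)
        ≡⟨ shape ⟦ C (a + x) ⟧ (deg n C D (a + x)) outer ⟩
      ⟦ C (a + x) ⟧ * deg n C D (a + x) + outer * ⟦ C (a + x) ⟧ ∎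
      where
      shape : ∀ c d o → c * (d + o) ≡ c * d + o * c
      shape = solve-∀

  -- The 9 in `F` is this 1 + 8. The defects now sum to at most κ²/T², so Markov's inequality with
  -- threshold κ/T leaves at most κ/T exceptions.
  F-sum-defect : F * ∑ N (λ x → ⟦ β x ⟧ * defect x) ≤ 9 * (κ * κ)
  F-sum-defect = begin
    F * ∑ N (λ x → ⟦ β x ⟧ * defect x)       ≤⟨ F ⊛ sum-defect ⟩
    F * (misses n C D + B * outer)           ≡⟨ shape₁ F (misses n C D) B outer ⟩
    F * misses n C D + B * (F * outer)       ≤⟨ F-misses ⊹ *-mono-≤ B≤κ Fouter≤8κ ⟩
    κ * κ + κ * (8 * κ)                      ≡⟨ shape₂ κ ⟩
    9 * (κ * κ)                              ∎
    where
    open ≤-Reasoning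
    shape₁ : ∀ F x B o → F * (x + B * o) ≡ F * x + B * (F * o)
    shape₁ = solve-∀
    shape₂ : ∀ κ → κ * κ + κ * (8 * κ) ≡ 9 * (κ * κ)
    shape₂ = solve-∀
    F-misses : F * misses n C D ≤ κ * κ
    F-misses = ≤-trans (≤-trans (≤-reflexive (sym (*-identityˡ _))) (*-monoˡ-≤ (F * misses n C D) 1≤F))
      (≤-trans (≤-reflexive (sym (*-assoc F F _))) closed)

  W : ℕ
  W = # N (λ x → β x ∧ not (T * defect x ≤ᵇ κ))

  few : T * W ≤ κ
  few = *-cancelˡ-≤ κ (*-cancelˡ-≤ (9 * T) {{m*n≢0 9 T}} (begin
    9 * T * (κ * (T * W))                            ≡⟨ shape₁ T κ W ⟩
    F * (κ * W)                                      ≤⟨ F ⊛ markov N κ T β defect ⟩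
    F * (T * ∑ N (λ x → ⟦ β x ⟧ * defect x))         ≡⟨ shape₂ F T _ ⟩
    T * (F * ∑ N (λ x → ⟦ β x ⟧ * defect x))         ≤⟨ T ⊛ F-sum-defect ⟩
    T * (9 * (κ * κ))                                ≡⟨ shape₃ T κ ⟩
    9 * T * (κ * κ)                                  ∎))
    where
    open ≤-Reasoning
    shape₁ : ∀ T κ w → 9 * T * (κ * (T * w)) ≡ 9 * (T * T) * (κ * w)
    shape₁ = solve-∀
    shape₂ : ∀ F T s → F * (T * s) ≡ T * (F * s)
    shape₂ = solve-∀
    shape₃ : ∀ T κ → T * (9 * (κ * κ)) ≡ 9 * T * (κ * κ)
    shape₃ = solve-∀

  open NearSubgroup N 1≤N β per T κ few many

  module _ (d ν : ℕ) (N≡νd : N ≡ ν * d) (d∣good : ∀ x → good x → d ∣ x) where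

    -- An element off P either lies outside the window, or has an offset that is no multiple of d,
    -- hence not good, hence of defect above κ/T; both kinds are rare. The endpoint a + N is the
    -- term j = ν of the progression.
    outside : ∀ (P : ℕ → Bool) → (∀ j → j ≤ ν → P (a + j * d) ≡ true) → T * # n (λ x → C x ∧ not (P x)) ≤ 2 * κ
    outside P P-AP = begin
      T * # n (λ x → C x ∧ not (P x))
        ≤⟨ T ⊛ #-restrict (λ x → C x ∧ not (P x)) (λ x e → proj₁ (∧-true {C x} e)) ⟩
      T * (# N (λ z → C (a + z) ∧ not (P (a + z))) + ⟦ C (a + N) ∧ not (P (a + N)) ⟧ + X)
        ≤⟨ T ⊛ (#-mono N uncovered ⊹ ≤-reflexive end ⊹ ≤-refl) ⟩
      T * (W + 0 + X)
        ≡⟨ shape T W X ⟩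
      T * W + T * X
        ≤⟨ few ⊹ ≤-trans (*-monoˡ-≤ X T≤F) FX≤κ ⟩
      κ + κ
        ≡⟨ cong (κ +_) (sym (+-identityʳ κ)) ⟩
      2 * κ ∎
      where
      open ≤-Reasoning
      shape : ∀ T w x → T * (w + 0 + x) ≡ T * w + T * x
      shape = solve-∀
      T≤F : T ≤ F
      T≤F = ≤-trans (≤-trans (≤-reflexive (sym (*-identityˡ T))) (*-monoˡ-≤ T 1≤T)) (m≤n*m (T * T) 9)
      end : ⟦ C (a + N) ∧ not (P (a + N)) ⟧ ≡ 0
      end = ∧-not-true (C (a + N)) (trans (cong (λ k → P (a + k)) N≡νd) (P-AP ν ≤-refl))
      covered : ∀ z → z < N → d ∣ z → P (a + z) ≡ true
      covered z z<N (divides j z≡jd) = trans (cong (λ k → P (a + k)) z≡jd)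
        (P-AP j (<⇒≤ (*-cancelʳ-< d j ν (subst₂ _<_ z≡jd N≡νd z<N))))
      uncovered : ∀ z → z < N → C (a + z) ∧ not (P (a + z)) ≡ true → β z ∧ not (T * defect z ≤ᵇ κ) ≡ true
      uncovered z z<N e = true-∧ {β z} (trans (β-below z z<N) (proj₁ both)) (cong not (¬true⇒false λ t →
        true≢false (trans (sym (covered z z<N (d∣good z (≤-trans (true-≤ᵇ t) (m≤m+n κ (κ + 0))))))
          (not-true (proj₂ both)))))
        where
        both : C (a + z) ≡ true × not (P (a + z)) ≡ true
        both = ∧-true {C (a + z)} {not (P (a + z))} e

  Tν≤Tκ+3ν : ∀ ν → T * (ν * # N β) ≤ T * (# N β * # N β) + ν * (2 * κ) → T * ν ≤ T * κ + 3 * ν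
  Tν≤Tκ+3ν ν l = *-cancelˡ-≤ κ (≤-from 0 (shape T κ ν B)
    (subst (λ b → T * (ν * b) ≤ T * (b * b) + ν * (2 * κ)) #β l ⊹ ν ⊛ Tκ≤TB+κ ⊹ T ⊛ *-mono-≤ B≤κ B≤κ))
    where
    shape : ∀ T κ ν B → κ * (T * ν) + (T * (B * B) + ν * (2 * κ) + ν * (T * B + κ) + T * (κ * κ)) + 0
      ≡ κ * (T * κ + 3 * ν) + (T * (ν * B) + ν * (T * κ) + T * (B * B))
    shape = solve-∀

  length-bound : ∀ ν → T * ν ≤ T * κ + 3 * ν → 2 * (T * ν) ≤ (T + 8) * m
  length-bound ν l = go T 8≤T l 2Tκ≤Tm+2κ
    where
    go : ∀ T → 8 ≤ T → T * ν ≤ T * κ + 3 * ν → 2 * (T * κ) ≤ T * m + 2 * κ → 2 * (T * ν) ≤ (T + 8) * m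
    -- Here 5 + t = T - 3 and 7 + t = T - 1. Eliminating κ reduces the claim to T³ ≤ (T + 8)(T -
    -- 1)(T - 3), whose slack 4T² - 29T + 24 is the polynomial 48 + 35t + 4t².
    go T 8≤T p q with t , refl ← m≤n⇒∃[o]m+o≡n 8≤T =
      *-cancelˡ-≤ ((5 + t) * (7 + t)) (≤-from (m * (48 + 35 * t + 4 * (t * t))) (shape t ν κ m)
        (2 * (8 + t) * (7 + t) ⊛ p ⊹ (8 + t) * (8 + t) ⊛ q))
      where
      shape : ∀ t ν κ m → (5 + t) * (7 + t) * (2 * ((8 + t) * ν))
        + (2 * (8 + t) * (7 + t) * ((8 + t) * κ + 3 * ν) + (8 + t) * (8 + t) * ((8 + t) * m + 2 * κ))
        + m * (48 + 35 * t + 4 * (t * t))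
        ≡ (5 + t) * (7 + t) * ((8 + t + 8) * m)
          + (2 * (8 + t) * (7 + t) * ((8 + t) * ν) + (8 + t) * (8 + t) * (2 * ((8 + t) * κ)))
      shape = solve-∀

  progression : ∃ λ d → ∃ λ ν → 1 ≤ d × 2 * (T * ν) ≤ (T + 8) * m × 2 * (T * κ) ≤ T * m + 2 * κ
    × (∀ (P : ℕ → Bool) → (∀ j → j ≤ ν → P (a + j * d) ≡ true) → T * # n (λ x → C x ∧ not (P x)) ≤ 2 * κ)
  progression = let d , ν , 1≤d , N≡νd , d∣good , l = generator in
    d , ν , 1≤d , length-bound ν (Tν≤Tκ+3ν ν l) , 2Tκ≤Tm+2κ , outside d ν N≡νd d∣good

∧-false : ∀ {a b} → a ∧ b ≡ false → a ≡ true → b ≡ false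
∧-false e refl = e

-- Let a and b be the extreme elements of C of small degree.  Then a + C and b + C
-- are almost disjoint and almost fill D, so C is almost closed under addition
-- modulo b - a.
stability : ∀ n (C D : ℕ → Bool) m T → 8 ≤ T → 9 * (T * T) ≤ # n C → # (n + n) D ≤ m →
  9 * (T * T) * m ≤ (2 * (9 * (T * T)) + 2) * # n C →
  9 * (T * T) * (9 * (T * T)) * misses n C D ≤ # n C * # n C →
  ∃ λ a → ∃ λ d → ∃ λ ν → 1 ≤ d × 2 * (T * ν) ≤ (T + 8) * m × 2 * (T * # n C) ≤ T * m + 2 * # n C
    × (∀ (P : ℕ → Bool) → (∀ j → j ≤ ν → P (a + j * d) ≡ true) →
         T * # n (λ x → C x ∧ not (P x)) ≤ 2 * # n C)
stability n C D m T 8≤T F≤κ D≤m dense closed =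
  let b , b<n , Gb , max = greatest n G (#-positive n G G-positive)
      a , a≤b , Ga , min = least b G Gb
      N , a+N≡b = m≤n⇒∃[o]m+o≡n a≤b
      r , 1+b+r≡n = m≤n⇒∃[o]m+o≡n b<n
      b′ : G (a + N) ≡ true
      b′ = subst (λ x → G x ≡ true) (sym a+N≡b) Gb
      n≡ : n ≡ a + (N + suc r)
      n≡ = trans (sym 1+b+r≡n) (trans (cong (λ x → suc (x + r)) (sym a+N≡b)) (shape a N r))
      high : ∀ i → i < r → C (a + (N + suc i)) ≡ true →
        (F * deg n C D (a + (N + suc i)) ≤ᵇ # n C) ≡ false
      high i i<r Cx = ∧-false {C (a + (N + suc i))} (¬true⇒false λ Gx → <-irrefl refl (≤-trans
        (≤-trans (s≤s (m≤m+n b i)) (≤-reflexive (trans (cong (λ x → suc (x + i)) (sym a+N≡b)) (shape a N i))))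
        (max _ (subst (a + (N + suc i) <_) (sym n≡) (+-monoʳ-< a (+-monoʳ-< N (s<s i<r)))) Gx))) Cx
  in a , at a N r n≡ (λ x x<a Cx → ∧-false {C x} (min x x<a) Cx) high
       (true-≤ᵇ (proj₂ (∧-true {C a} Ga))) (true-≤ᵇ (proj₂ (∧-true {C (a + N)} b′)))
  where
  F = 9 * (T * T)
  G : ℕ → Bool
  G x = C x ∧ (F * deg n C D x ≤ᵇ # n C)
  shape : ∀ a N r → suc (a + N + r) ≡ a + (N + suc r)
  shape = solve-∀
  2≤F : 2 ≤ F
  2≤F = ≤-trans (s≤s (s≤s z≤n)) (9 ⊛ *-mono-≤ {1} {T} {1} 1≤T 1≤T)
    where
    1≤T : 1 ≤ T
    1≤T = ≤-trans (s≤s z≤n) 8≤T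
  1≤κ : 1 ≤ # n C
  1≤κ = ≤-trans (<⇒≤ 2≤F) F≤κ
  X = # n (λ x → C x ∧ not (F * deg n C D x ≤ᵇ # n C))
  partition : # n C ≡ # n G + X
  partition = trans (∑-cong n (λ x _ → bool (C x) _)) (∑-+ n _ _)
    where
    bool : ∀ c d → ⟦ c ⟧ ≡ ⟦ c ∧ d ⟧ + ⟦ c ∧ not d ⟧
    bool true true = refl
    bool true false = refl
    bool false d = refl
  G-positive : 0 < # n G
  G-positive = n≢0⇒n>0 λ G≡0 → <-irrefl refl (*-cancelʳ-≤ 2 1 (# n C) {{>-nonZero 1≤κ}} (begin
    2 * # n C    ≤⟨ *-monoˡ-≤ (# n C) 2≤F ⟩
    F * # n C    ≡⟨ cong (F *_) (trans partition (cong (_+ X) G≡0)) ⟩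
    F * X        ≤⟨ few-large-deg n C D F 1≤κ closed ⟩
    # n C        ≡⟨ sym (*-identityˡ (# n C)) ⟩
    1 * # n C    ∎))
    where open ≤-Reasoning
  at : ∀ a N r → n ≡ a + (N + suc r) →
    (∀ x → x < a → C x ≡ true → (F * deg n C D x ≤ᵇ # n C) ≡ false) →
    (∀ i → i < r → C (a + (N + suc i)) ≡ true → (F * deg n C D (a + (N + suc i)) ≤ᵇ # n C) ≡ false) →
    F * deg n C D a ≤ # n C → F * deg n C D (a + N) ≤ # n C →
    ∃ λ d → ∃ λ ν → 1 ≤ d × 2 * (T * ν) ≤ (T + 8) * m × 2 * (T * # n C) ≤ T * m + 2 * # n C
      × (∀ (P : ℕ → Bool) → (∀ j → j ≤ ν → P (a + j * d) ≡ true) →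
           T * # n (λ x → C x ∧ not (P x)) ≤ 2 * # n C)
  at a N r refl low high sa sb = Interval.progression C D m T a N r 8≤T F≤κ D≤m dense closed low high sa sb

-- Containers

length-concatMap-≤ : ∀ {A B : Set} (f : A → List B) b (xs : List A) → (∀ x → length (f x) ≤ b) →
  length (concatMap f xs) ≤ length xs * b
length-concatMap-≤ f b [] h = z≤n
length-concatMap-≤ f b (x ∷ xs) h = ≤-trans (≤-reflexive (length-++ (f x)))
  (h x ⊹ length-concatMap-≤ f b xs h)

length-∷-concatMap : ∀ {A : Set} (x : A) n (f : ℕ → List A) k → (∀ y → length (f y) ≤ suc n ^ k) →
  length (x ∷ concatMap f (upTo n)) ≤ suc n ^ suc k
length-∷-concatMap x n f k h = m^n>0 (suc n) k
  ⊹ ≤-trans (length-concatMap-≤ f (suc n ^ k) (upTo n) h) (≤-reflexive (cong (_* suc n ^ k) (length-upTo n)))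

∅ : ℕ → Bool
∅ _ = false

insert : ℕ → (ℕ → Bool) → ℕ → Bool
insert x X y = (y ≡ᵇ x) ∨ X y

_⊆_ : (ℕ → Bool) → (ℕ → Bool) → Set
P ⊆ Q = ∀ x → P x ≡ true → Q x ≡ true

≡ᵇ-true : ∀ y x → (y ≡ᵇ x) ≡ true → y ≡ x
≡ᵇ-true y x e = ≡ᵇ⇒≡ y x (subst True (sym e) tt)

≡ᵇ-refl : ∀ x → (x ≡ᵇ x) ≡ true
≡ᵇ-refl zero = refl
≡ᵇ-refl (suc x) = ≡ᵇ-refl x

#-singleton : ∀ n x → x < n → # n (_≡ᵇ x) ≡ 1
#-singleton (suc n) zero _ = cong suc (∑-zero n (λ _ _ → refl))
#-singleton (suc n) (suc x) l = #-singleton n x (s<s⁻¹ l)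

#-insert : ∀ n x X → x < n → X x ≡ false → # n (insert x X) ≡ suc (# n X)
#-insert n x X x<n fx = begin
  # n (insert x X)                         ≡⟨ ∑-cong n (λ y _ → disjoint y) ⟩
  ∑ n (λ y → ⟦ y ≡ᵇ x ⟧ + ⟦ X y ⟧)         ≡⟨ ∑-+ n _ _ ⟩
  # n (_≡ᵇ x) + # n X                      ≡⟨ cong (_+ # n X) (#-singleton n x x<n) ⟩
  suc (# n X)                              ∎
  where
  open ≡-Reasoning
  disjoint : ∀ y → ⟦ insert x X y ⟧ ≡ ⟦ y ≡ᵇ x ⟧ + ⟦ X y ⟧
  disjoint y with by-cases (y ≡ᵇ x)
  ... | inj₂ f rewrite f = refl
  ... | inj₁ t rewrite t | ≡ᵇ-true y x t | fx = refl

smallSets : ℕ → ℕ → List (ℕ → Bool)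
smallSets n zero = ∅ ∷ []
smallSets n (suc q) = ∅ ∷ concatMap (λ x → map (insert x) (smallSets n q)) (upTo n)

length-smallSets : ∀ n q → length (smallSets n q) ≤ suc n ^ q
length-smallSets n zero = ≤-refl
length-smallSets n (suc q) = length-∷-concatMap ∅ n _ q
  (λ x → ≤-trans (≤-reflexive (length-map (insert x) (smallSets n q))) (length-smallSets n q))

∈-insert : ∀ n q x X → x < n → X ∈ smallSets n q → insert x X ∈ smallSets n (suc q)
∈-insert n q x X x<n X∈ = there (∈-concatMap⁺ (λ x → map (insert x) (smallSets n q))
  (lose (∈-upTo⁺ x<n) (∈-map⁺ (insert x) X∈)))

-- The final alternative is the fork of a round: q elements are enough to make D grow, while an X
-- exhausting Q says that A has few elements of the kind Q.
sample : ∀ n q (Q : ℕ → Bool) → ∃ λ X → X ∈ smallSets n q × X ⊆ Q × # n X ≤ q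
  × (q ≤ # n X ⊎ (∀ y → y < n → Q y ≡ true → X y ≡ true))
sample n zero Q = ∅ , here refl , (λ _ ()) , ≤-reflexive (∑-zero n (λ _ _ → refl)) , inj₁ z≤n
sample n (suc q) Q with search n Q
... | inj₂ none = ∅ , here refl , (λ _ ()) , ≤-trans (≤-reflexive (∑-zero n (λ _ _ → refl))) z≤n
  , inj₂ (λ y l e → trans (sym (none y l)) e)
... | inj₁ (x , x<n , Qx) with sample n q (λ y → Q y ∧ not (y ≡ᵇ x))
...   | X , X∈ , X⊆ , small , alt = insert x X , ∈-insert n q x X x<n X∈ , sub
        , ≤-trans (≤-reflexive size) (s≤s small) , full alt
  where
  fresh : X x ≡ false
  fresh = ¬true⇒false λ t → true≢false (trans (sym (≡ᵇ-refl x)) (not-true (proj₂ (∧-true {Q x} (X⊆ x t)))))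
  size : # n (insert x X) ≡ suc (# n X)
  size = #-insert n x X x<n fresh
  sub : insert x X ⊆ Q
  sub y e with by-cases (y ≡ᵇ x)
  ... | inj₁ t = trans (cong Q (≡ᵇ-true y x t)) Qx
  ... | inj₂ f = proj₁ (∧-true (X⊆ y (trans (cong (_∨ X y) (sym f)) e)))
  full : _ → _
  full (inj₁ l) = inj₁ (≤-trans (s≤s l) (≤-reflexive (sym size)))
  full (inj₂ all) = inj₂ λ y l e → cover y l e
    where
    cover : ∀ y → y < n → Q y ≡ true → insert x X y ≡ true
    cover y l e with by-cases (y ≡ᵇ x)
    ... | inj₁ t = cong (_∨ X y) t
    ... | inj₂ f = trans (cong (_∨ X y) f) (all y l (true-∧ e (cong not f)))

addTranslate : ℕ → (X D : ℕ → Bool) → ℕ → Bool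
addTranslate y X D d = D d ∨ ((y ≤ᵇ d) ∧ X (d ∸ y))

#-addTranslate : ∀ n y X D → y < n → # (n + n) D + deg n X D y ≤ # (n + n) (addTranslate y X D)
#-addTranslate n y X D y<n = begin
  # (n + n) D + deg n X D y
    ≡⟨ cong (# (n + n) D +_) (∑-cong n (λ x _ → sym (translated x))) ⟩
  # (n + n) D + # n (λ x → new (y + x))
    ≤⟨ +-monoʳ-≤ _ (∑-window n (n + n) y (λ d → ⟦ new d ⟧) (+-monoˡ-≤ n (<⇒≤ y<n))) ⟩
  # (n + n) D + # (n + n) new
    ≡⟨ sym (∑-+ (n + n) _ _) ⟩
  ∑ (n + n) (λ d → ⟦ D d ⟧ + ⟦ new d ⟧)
    ≡⟨ ∑-cong (n + n) (λ d _ → bool (D d) ((y ≤ᵇ d) ∧ X (d ∸ y))) ⟩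
  # (n + n) (addTranslate y X D) ∎
  where
  open ≤-Reasoning
  new : ℕ → Bool
  new d = ((y ≤ᵇ d) ∧ X (d ∸ y)) ∧ not (D d)
  bool : ∀ d z → ⟦ d ⟧ + ⟦ z ∧ not d ⟧ ≡ ⟦ d ∨ z ⟧
  bool true true = refl
  bool true false = refl
  bool false true = refl
  bool false false = refl
  translated : ∀ x → ⟦ new (y + x) ⟧ ≡ ⟦ X x ∧ not (D (y + x)) ⟧
  translated x rewrite ≤ᵇ-true (m≤m+n y x) | m+n∸m≡n y x = refl

-- Which translates get added depends on A, so every sequence of at most k of them is listed; D
-- stands at the head of each list because the greedy choice may stop at any moment.
grow : ℕ → ℕ → (X D : ℕ → Bool) → List (ℕ → Bool)
grow n zero X D = D ∷ []
grow n (suc k) X D = D ∷ concatMap (λ y → grow n k X (addTranslate y X D)) (upTo n)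

length-grow : ∀ n k X D → length (grow n k X D) ≤ suc n ^ k
length-grow n zero X D = ≤-refl
length-grow n (suc k) X D = length-∷-concatMap D n _ k (λ y → length-grow n k X _)

D∈grow : ∀ n k X D → D ∈ grow n k X D
D∈grow n zero X D = here refl
D∈grow n (suc k) X D = here refl

-- A greedy choice of translates stops after k steps, since each of them adds
-- at least θ elements of S to D.
saturate : ∀ n m θ (α S : ℕ → Bool) → (∀ x y → α x ≡ true → α y ≡ true → S (x + y) ≡ true) →
  # (n + n) S ≤ m → ∀ X → X ⊆ α → ∀ k D → D ⊆ S → m < # (n + n) D + suc k * θ →
  ∃ λ D′ → D′ ∈ grow n k X D × D ⊆ D′ × D′ ⊆ S × (∀ y → y < n → α y ≡ true → (θ ≤ᵇ deg n X D′ y) ≡ false)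
saturate n m θ α S sums S≤m X X⊆α k D D⊆S fuel with search n (λ y → α y ∧ (θ ≤ᵇ deg n X D y))
... | inj₂ none = D , D∈grow n k X D , (λ _ e → e) , D⊆S , λ y l e → trans (cong (_∧ _) (sym e)) (none y l)
... | inj₁ (y , y<n , e) = next k fuel
  where
  αy : α y ≡ true
  αy = proj₁ (∧-true e)
  D₁ : ℕ → Bool
  D₁ = addTranslate y X D
  gain : # (n + n) D + θ ≤ # (n + n) D₁
  gain = ≤-trans (+-monoʳ-≤ (# (n + n) D) (true-≤ᵇ {θ} (proj₂ (∧-true {α y} e)))) (#-addTranslate n y X D y<n)
  D₁⊆S : D₁ ⊆ S
  D₁⊆S d t with by-cases (D d)
  ... | inj₁ Dd = D⊆S d Dd
  ... | inj₂ f with ∧-true {y ≤ᵇ d} (trans (cong (_∨ ((y ≤ᵇ d) ∧ X (d ∸ y))) (sym f)) t)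
  ...   | y≤d , Xd = trans (cong S (sym (m+[n∸m]≡n (true-≤ᵇ {y} y≤d)))) (sums y (d ∸ y) αy (X⊆α _ Xd))
  next : ∀ k → m < # (n + n) D + suc k * θ →
    ∃ λ D′ → D′ ∈ grow n k X D × D ⊆ D′ × D′ ⊆ S × (∀ y → y < n → α y ≡ true → (θ ≤ᵇ deg n X D′ y) ≡ false)
  next zero l = ⊥-elim (<-irrefl refl (<-≤-trans l (begin
    # (n + n) D + (θ + 0)    ≡⟨ cong (# (n + n) D +_) (+-identityʳ θ) ⟩
    # (n + n) D + θ          ≤⟨ gain ⟩
    # (n + n) D₁             ≤⟨ #-mono (n + n) (λ d _ → D₁⊆S d) ⟩
    # (n + n) S              ≤⟨ S≤m ⟩
    m                        ∎)))
    where open ≤-Reasoning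
  next (suc k) l with saturate n m θ α S sums S≤m X X⊆α k D₁ D₁⊆S
    (<-≤-trans l (≤-trans (≤-reflexive (sym (+-assoc (# (n + n) D) θ (suc k * θ)))) (+-monoˡ-≤ (suc k * θ) gain)))
  ... | D′ , D′∈ , D₁⊆D′ , rest = D′
    , there (∈-concatMap⁺ (λ y → grow n k X (addTranslate y X D)) (lose (∈-upTo⁺ y<n) D′∈))
    , (λ d t → D₁⊆D′ d (cong (_∨ ((y ≤ᵇ d) ∧ X (d ∸ y))) t)) , rest

State : Set
State = (ℕ → Bool) × (ℕ → Bool)

filtered : ℕ → ℕ → (X D C : ℕ → Bool) → ℕ → Bool
filtered n θ X D C y = C y ∧ not (θ ≤ᵇ deg n X D y)

heavy : ℕ → ℕ → (C D : ℕ → Bool) → ℕ → Bool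
heavy n E C D x = # n C ≤ᵇ E * deg n C D x

-- Meant for an X that contains all heavy elements of A, so that A survives the deletion.
trimmed : ℕ → ℕ → (X C D : ℕ → Bool) → ℕ → Bool
trimmed n E X C D y = C y ∧ (not (heavy n E C D y) ∨ X y)

light : ∀ c θ y → ⟦ c ∧ not (θ ≤ᵇ y) ⟧ * y ≤ θ * ⟦ c ∧ not (θ ≤ᵇ y) ⟧
light false θ y = z≤n
light true θ y with by-cases (θ ≤ᵇ y)
... | inj₁ t rewrite t = z≤n
... | inj₂ f rewrite f = ≤-trans (≤-reflexive (*-identityˡ y))
      (≤-trans (<⇒≤ (false-≤ᵇ {θ} f)) (≤-reflexive (sym (*-identityʳ θ))))

-- If filtering removes ℓ elements from C and D gains g elements, this says that
-- ℓ + g ≥ |C|/2E, without subtraction.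
filtered-progress : ∀ n θ E (X C D D′ : ℕ → Bool) → 1 ≤ E → 1 ≤ θ → # n X ≡ 2 * E * θ →
  (∀ x → X x ≡ true → heavy n E C D x ≡ true) → D ⊆ D′ →
  # n C + 2 * E * (# n (filtered n θ X D′ C) + # (n + n) D) ≤ 2 * E * (# n C + # (n + n) D′)
filtered-progress n θ E X C D D′ 1≤E 1≤θ #X X-heavy D⊆D′ =
  *-cancelˡ-≤ (E * θ) {{m*n≢0 E θ {{>-nonZero 1≤E}} {{>-nonZero 1≤θ}}}}
    (≤-from (E * θ * l) (identity E θ κ κ′ l g δ P δ′)
      (lower ⊹ E ⊛ upper ⊹ E * θ * (2 * E) ⊛ gained ⊹ E * θ * (2 * E + 1) ⊛ lost))
  where
  open ≤-Reasoning
  C′ : ℕ → Bool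
  C′ = filtered n θ X D′ C
  κ = # n C
  κ′ = # n C′
  δ = # (n + n) D
  δ′ = # (n + n) D′
  l = # n (λ y → C y ∧ not (C′ y))
  g = # (n + n) (λ d → D′ d ∧ not (D d))
  P = ∑ n (λ x → ⟦ X x ⟧ * deg n C D x)
  identity : ∀ E θ κ κ′ l g δ P δ′ →
    E * θ * (κ + 2 * E * (κ′ + δ))
      + (E * P + E * (2 * E * θ * (l + g) + θ * κ′) + E * θ * (2 * E) * δ′ + E * θ * (2 * E + 1) * κ) + E * θ * l
    ≡ E * θ * (2 * E * (κ + δ′))
      + (2 * E * θ * κ + E * P + E * θ * (2 * E) * (δ + g) + E * θ * (2 * E + 1) * (l + κ′))
  identity = solve-∀
  gained : δ + g ≤ δ′
  gained = ≤-trans (≤-reflexive (sym (∑-+ (n + n) _ _))) (∑-mono (n + n) (λ d _ → bool (D d) (D′ d) (D⊆D′ d)))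
    where
    bool : ∀ d d′ → (d ≡ true → d′ ≡ true) → ⟦ d ⟧ + ⟦ d′ ∧ not d ⟧ ≤ ⟦ d′ ⟧
    bool true d′ h rewrite h refl = ≤-refl
    bool false true h = ≤-refl
    bool false false h = ≤-refl
  lost : l + κ′ ≤ κ
  lost = ≤-trans (≤-reflexive (sym (∑-+ n _ _))) (∑-mono n (λ y _ → bool (C y) (not (θ ≤ᵇ deg n X D′ y))))
    where
    bool : ∀ c z → ⟦ c ∧ not (c ∧ z) ⟧ + ⟦ c ∧ z ⟧ ≤ ⟦ c ⟧
    bool true true = ≤-refl
    bool true false = ≤-refl
    bool false z = ≤-refl
  lower : 2 * E * θ * κ ≤ E * P
  lower = begin
    2 * E * θ * κ                              ≡⟨ cong (_* κ) (sym #X) ⟩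
    # n X * κ                                  ≡⟨ *-comm (# n X) κ ⟩
    κ * # n X                                  ≡⟨ sym (∑-* n κ _) ⟩
    ∑ n (λ x → κ * ⟦ X x ⟧)                    ≤⟨ ∑-mono n (λ x _ → each (X x) (deg n C D x) (λ t → true-≤ᵇ {κ} (X-heavy x t))) ⟩
    ∑ n (λ x → E * (⟦ X x ⟧ * deg n C D x))    ≡⟨ ∑-* n E _ ⟩
    E * P                                      ∎
    where
    each : ∀ b y → (b ≡ true → κ ≤ E * y) → κ * ⟦ b ⟧ ≤ E * (⟦ b ⟧ * y)
    each false y _ = ≤-trans (≤-reflexive (*-zeroʳ κ)) z≤n
    each true y h = ≤-trans (≤-reflexive (*-identityʳ κ))
      (≤-trans (h refl) (≤-reflexive (cong (E *_) (sym (*-identityˡ y)))))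
  upper : P ≤ 2 * E * θ * (l + g) + θ * κ′
  upper = begin
    P
      ≤⟨ ∑-mono n (λ x x<n → ⟦ X x ⟧ ⊛ deg≤ x x<n) ⟩
    ∑ n (λ x → ⟦ X x ⟧ * (l + g + # n (λ y → C′ y ∧ not (D′ (x + y)))))
      ≡⟨ ∑-cong n (λ x _ → distrib ⟦ X x ⟧ (l + g) _) ⟩
    ∑ n (λ x → (l + g) * ⟦ X x ⟧ + ⟦ X x ⟧ * # n (λ y → C′ y ∧ not (D′ (x + y))))
      ≡⟨ trans (∑-+ n _ _) (cong₂ _+_ (∑-* n (l + g) _)
           (∑-cong n (λ x _ → sym (∑-* n ⟦ X x ⟧ (λ y → ⟦ C′ y ∧ not (D′ (x + y)) ⟧))))) ⟩
    (l + g) * # n X + ∑ n (λ x → ∑ n (λ y → ⟦ X x ⟧ * ⟦ C′ y ∧ not (D′ (x + y)) ⟧))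
      ≡⟨ cong₂ _+_ (trans (cong ((l + g) *_) #X) (*-comm (l + g) _)) (∑-swap n n _) ⟩
    2 * E * θ * (l + g) + ∑ n (λ y → ∑ n (λ x → ⟦ X x ⟧ * ⟦ C′ y ∧ not (D′ (x + y)) ⟧))
      ≤⟨ +-monoʳ-≤ _ (∑-mono n (λ y _ → column y)) ⟩
    2 * E * θ * (l + g) + ∑ n (λ y → θ * ⟦ C′ y ⟧)
      ≡⟨ cong (2 * E * θ * (l + g) +_) (∑-* n θ _) ⟩
    2 * E * θ * (l + g) + θ * κ′ ∎
    where
    distrib : ∀ x a b → x * (a + b) ≡ a * x + x * b
    distrib = solve-∀
    bool : ∀ c c′ d d′ → ⟦ c ∧ not d ⟧ ≤ ⟦ c ∧ not c′ ⟧ + ⟦ d′ ∧ not d ⟧ + ⟦ c′ ∧ not d′ ⟧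
    bool false _ _ _ = z≤n
    bool true _ true _ = z≤n
    bool true false false _ = s≤s z≤n
    bool true true false true = s≤s z≤n
    bool true true false false = s≤s z≤n
    deg≤ : ∀ x → x < n → deg n C D x ≤ l + g + # n (λ y → C′ y ∧ not (D′ (x + y)))
    deg≤ x x<n = begin
      deg n C D x
        ≤⟨ ∑-mono n (λ y _ → bool (C y) (C′ y) (D (x + y)) (D′ (x + y))) ⟩
      ∑ n (λ y → ⟦ C y ∧ not (C′ y) ⟧ + ⟦ D′ (x + y) ∧ not (D (x + y)) ⟧ + ⟦ C′ y ∧ not (D′ (x + y)) ⟧)
        ≡⟨ trans (∑-+ n _ _) (cong (_+ # n (λ y → C′ y ∧ not (D′ (x + y)))) (∑-+ n _ _)) ⟩
      l + # n (λ y → D′ (x + y) ∧ not (D (x + y))) + # n (λ y → C′ y ∧ not (D′ (x + y)))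
        ≤⟨ +-monoˡ-≤ _ (+-monoʳ-≤ l (∑-window n (n + n) x (λ d → ⟦ D′ d ∧ not (D d) ⟧) (+-monoˡ-≤ n (<⇒≤ x<n)))) ⟩
      l + g + # n (λ y → C′ y ∧ not (D′ (x + y))) ∎
    ind : ∀ a b c → ⟦ a ⟧ * ⟦ b ∧ not c ⟧ ≡ ⟦ b ⟧ * ⟦ a ∧ not c ⟧
    ind true true c = refl
    ind true false c = refl
    ind false true c = refl
    ind false false c = refl
    column : ∀ y → ∑ n (λ x → ⟦ X x ⟧ * ⟦ C′ y ∧ not (D′ (x + y)) ⟧) ≤ θ * ⟦ C′ y ⟧
    column y = begin
      ∑ n (λ x → ⟦ X x ⟧ * ⟦ C′ y ∧ not (D′ (x + y)) ⟧)
        ≡⟨ ∑-cong n (λ x _ → trans (ind (X x) (C′ y) _) (cong (λ z → ⟦ C′ y ⟧ * ⟦ X x ∧ not (D′ z) ⟧) (+-comm x y))) ⟩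
      ∑ n (λ x → ⟦ C′ y ⟧ * ⟦ X x ∧ not (D′ (y + x)) ⟧)
        ≡⟨ ∑-* n ⟦ C′ y ⟧ _ ⟩
      ⟦ C′ y ⟧ * deg n X D′ y
        ≤⟨ light (C y) θ (deg n X D′ y) ⟩
      θ * ⟦ C′ y ⟧ ∎

-- Elements that are not heavy contribute at most |C|²/E missing pairs, so at least |C|/E elements
-- are heavy. All but 2Eθ ≤ |C|/2E of them are deleted.
trimmed-progress : ∀ n θ E (X C D : ℕ → Bool) → 1 ≤ # n C → # n X ≤ 2 * E * θ → 2 * E * (2 * E * θ) ≤ # n C →
  2 * (# n C * # n C) < E * misses n C D →
  # n C + 2 * E * (# n (trimmed n E X C D) + # (n + n) D) ≤ 2 * E * (# n C + # (n + n) D)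
trimmed-progress n θ E X C D 1≤κ #X small many =
  ≤-from 0 (identity E κ κ′ q h c (# (n + n) D) (# n X))
    (2 * E ⊛ #trimmed ⊹ 2 * E ⊛ ≤-reflexive (sym partition) ⊹ 2 * E ⊛ #X ⊹ small ⊹ 2 ⊛ κ≤Eh)
  where
  open ≤-Reasoning
  H : ℕ → Bool
  H = heavy n E C D
  κ = # n C
  κ′ = # n (trimmed n E X C D)
  h = # n (λ x → C x ∧ H x)
  c = # n (λ x → C x ∧ not (H x))
  q = 2 * E * θ
  identity : ∀ E κ κ′ q h c δ ξ →
    κ + 2 * E * (κ′ + δ) + (2 * E * (c + ξ) + 2 * E * κ + 2 * E * q + κ + 2 * (E * h)) + 0
    ≡ 2 * E * (κ + δ) + (2 * E * κ′ + 2 * E * (h + c) + 2 * E * ξ + 2 * E * q + 2 * κ)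
  identity = solve-∀
  partition : κ ≡ h + c
  partition = trans (∑-cong n (λ x _ → bool (C x) (H x))) (∑-+ n _ _)
    where
    bool : ∀ c h → ⟦ c ⟧ ≡ ⟦ c ∧ h ⟧ + ⟦ c ∧ not h ⟧
    bool true true = refl
    bool true false = refl
    bool false h = refl
  #trimmed : κ′ ≤ c + # n X
  #trimmed = ≤-trans (∑-mono n (λ y _ → bool (C y) (H y) (X y))) (≤-reflexive (∑-+ n _ _))
    where
    bool : ∀ c h x → ⟦ c ∧ (not h ∨ x) ⟧ ≤ ⟦ c ∧ not h ⟧ + ⟦ x ⟧
    bool true true x = ≤-refl
    bool true false x = s≤s z≤n
    bool false h x = z≤n
  Emisses : E * misses n C D ≤ E * κ * h + κ * κ
  Emisses = begin
    E * misses n C D                                          ≡⟨ sym (∑-* n E _) ⟩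
    ∑ n (λ x → E * (⟦ C x ⟧ * deg n C D x))                   ≤⟨ ∑-mono n (λ x _ → each (C x) (deg n C D x) (#-mono n (λ y _ → proj₁ ∘ ∧-true))) ⟩
    ∑ n (λ x → E * κ * ⟦ C x ∧ H x ⟧ + κ * ⟦ C x ⟧)           ≡⟨ trans (∑-+ n _ _) (cong₂ _+_ (∑-* n (E * κ) _) (∑-* n κ _)) ⟩
    E * κ * h + κ * κ                                         ∎
    where
    each : ∀ b y → y ≤ κ → E * (⟦ b ⟧ * y) ≤ E * κ * ⟦ b ∧ (κ ≤ᵇ E * y) ⟧ + κ * ⟦ b ⟧
    each false y _ = ≤-trans (≤-reflexive (*-zeroʳ E)) z≤n
    each true y y≤κ with by-cases (κ ≤ᵇ E * y)
    ... | inj₁ t rewrite t = ≤-trans (E ⊛ ≤-trans (≤-reflexive (*-identityˡ y)) y≤κ)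
            (≤-trans (≤-reflexive (sym (*-identityʳ (E * κ)))) (m≤m+n (E * κ * 1) (κ * 1)))
    ... | inj₂ f rewrite f = ≤-trans (E ⊛ ≤-reflexive (*-identityˡ y))
            (≤-trans (<⇒≤ (false-≤ᵇ {κ} f)) (≤-trans (≤-reflexive (sym (*-identityʳ κ))) (m≤n+m (κ * 1) (E * κ * 0))))
  κ≤Eh : κ ≤ E * h
  κ≤Eh = *-cancelˡ-≤ κ {{>-nonZero 1≤κ}} (≤-from 1 (shape E κ h (misses n C D)) (many ⊹ Emisses))
    where
    shape : ∀ E κ h s → κ * κ + (E * s + (E * κ * h + κ * κ)) + 1 ≡ κ * (E * h) + (1 + 2 * (κ * κ) + E * s)
    shape = solve-∀

-- Enumeration of the containers and its length.

round : ℕ → ℕ → ℕ → State → List State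
round n θ E (C , D) = concatMap
  (λ X → (trimmed n E X C D , D) ∷ map (λ D′ → filtered n θ X D′ C , D′) (grow n θ X D))
  (smallSets n (2 * E * θ))

-- States after any number of rounds up to r are kept, since different sets A stop at different
-- times.
stages : ℕ → ℕ → ℕ → ℕ → State → List State
stages n θ E zero st = st ∷ []
stages n θ E (suc r) st = st ∷ concatMap (stages n θ E r) (round n θ E st)

initial : ℕ → ℕ → (X D : ℕ → Bool) → State
initial n θ X D = filtered n θ X D (λ _ → true) , D

containers : ℕ → ℕ → ℕ → List State
containers n θ E = concatMap
  (λ X → concatMap (λ D → stages n θ E (24 * E) (initial n θ X D)) (grow n θ X ∅))
  (smallSets n (2 * E * θ))

1+^≤^suc : ∀ n k → 1 ≤ n → 1 + suc n ^ k ≤ suc n ^ suc k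
1+^≤^suc n k 1≤n = ≤-trans (+-monoˡ-≤ (suc n ^ k) (m^n>0 (suc n) k))
  (+-monoʳ-≤ (suc n ^ k) (≤-trans (≤-reflexive (sym (*-identityˡ (suc n ^ k)))) (*-monoˡ-≤ (suc n ^ k) 1≤n)))

length-round : ∀ n θ E st → 1 ≤ n → length (round n θ E st) ≤ suc n ^ (2 * E * θ + suc θ)
length-round n θ E (C , D) 1≤n = begin
  length (round n θ E (C , D))
    ≤⟨ length-concatMap-≤ _ (suc n ^ suc θ) (smallSets n (2 * E * θ)) (λ X → ≤-trans (s≤s
         (≤-trans (≤-reflexive (length-map _ (grow n θ X D))) (length-grow n θ X D))) (1+^≤^suc n θ 1≤n)) ⟩
  length (smallSets n (2 * E * θ)) * suc n ^ suc θ
    ≤⟨ *-monoˡ-≤ (suc n ^ suc θ) (length-smallSets n (2 * E * θ)) ⟩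
  suc n ^ (2 * E * θ) * suc n ^ suc θ
    ≡⟨ sym (^-distribˡ-+-* (suc n) (2 * E * θ) (suc θ)) ⟩
  suc n ^ (2 * E * θ + suc θ) ∎
  where open ≤-Reasoning

length-stages : ∀ n θ E r st → 1 ≤ n → length (stages n θ E r st) ≤ suc n ^ (r * suc (2 * E * θ + suc θ))
length-stages n θ E zero st 1≤n = ≤-refl
length-stages n θ E (suc r) st 1≤n = begin
  suc (length (concatMap (stages n θ E r) (round n θ E st)))
    ≤⟨ s≤s (length-concatMap-≤ _ (suc n ^ (r * suc p)) (round n θ E st) (λ st′ → length-stages n θ E r st′ 1≤n)) ⟩
  suc (length (round n θ E st) * suc n ^ (r * suc p))
    ≤⟨ s≤s (*-monoˡ-≤ (suc n ^ (r * suc p)) (length-round n θ E st 1≤n)) ⟩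
  suc (suc n ^ p * suc n ^ (r * suc p))
    ≡⟨ cong suc (sym (^-distribˡ-+-* (suc n) p (r * suc p))) ⟩
  suc (suc n ^ (p + r * suc p))
    ≤⟨ 1+^≤^suc n (p + r * suc p) 1≤n ⟩
  suc n ^ (suc r * suc p) ∎
  where
  open ≤-Reasoning
  p = 2 * E * θ + suc θ

length-containers : ∀ n θ E → 1 ≤ n →
  length (containers n θ E) ≤ suc n ^ (suc (24 * E) * suc (2 * E * θ + suc θ))
length-containers n θ E 1≤n = begin
  length (containers n θ E)
    ≤⟨ length-concatMap-≤ _ (suc n ^ θ * suc n ^ (24 * E * suc p)) (smallSets n (2 * E * θ)) (λ X →
         ≤-trans (length-concatMap-≤ _ (suc n ^ (24 * E * suc p)) (grow n θ X ∅) (λ D → length-stages n θ E (24 * E) _ 1≤n))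
           (*-monoˡ-≤ (suc n ^ (24 * E * suc p)) (length-grow n θ X ∅))) ⟩
  length (smallSets n q) * (suc n ^ θ * suc n ^ (24 * E * suc p))
    ≤⟨ *-monoˡ-≤ (suc n ^ θ * suc n ^ (24 * E * suc p)) (length-smallSets n q) ⟩
  suc n ^ q * (suc n ^ θ * suc n ^ (24 * E * suc p))
    ≡⟨ trans (cong (suc n ^ q *_) (sym (^-distribˡ-+-* (suc n) θ (24 * E * suc p))))
         (sym (^-distribˡ-+-* (suc n) q (θ + 24 * E * suc p))) ⟩
  suc n ^ (q + (θ + 24 * E * suc p))
    ≤⟨ ^-monoʳ-≤ (suc n) (≤-from 2 (shape q θ (24 * E * suc p)) (≤-refl {0})) ⟩
  suc n ^ (suc (24 * E) * suc p) ∎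
  where
  open ≤-Reasoning
  q = 2 * E * θ
  p = q + suc θ
  shape : ∀ q θ x → q + (θ + x) + 0 + 2 ≡ suc (q + suc θ) + x + 0
  shape = solve-∀

-- α is the set A and S its sumset. The test `thin` stays abstract: the rounds only use that a C
-- failing it has at least m/4 elements.
module Containers (n m θ E : ℕ) (α S : ℕ → Bool)
  (sums : ∀ x y → α x ≡ true → α y ≡ true → S (x + y) ≡ true)
  (S≤m : # (n + n) S ≤ m) (α<n : ∀ x → α x ≡ true → x < n)
  (1≤E : 1 ≤ E) (1≤θ : 1 ≤ θ) (m≤θ² : m ≤ θ * θ)
  (1≤α : 1 ≤ # n α) (4E²θ≤α : 2 * E * (2 * E * θ) ≤ # n α)
  (thin : ℕ → Bool) (thick : ∀ κ → thin κ ≡ false → m ≤ 4 * κ) where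

  Final : State → Set
  Final (C , D) = thin (# n C) ≡ true ⊎ E * misses n C D ≤ 2 * (# n C * # n C)

  Valid : State → Set
  Valid (C , D) = α ⊆ C × D ⊆ S

  -- |C| + m - |D| is at most r m / 8E; every round lowers it by m / 8E.
  potential : ℕ → State → Set
  potential r (C , D) = 8 * E * (# n C + m) ≤ r * m + 8 * E * # (n + n) D

  -- This is where m ≤ θ² enters: θ translates are allowed, and one more would give (θ + 1)θ > m new
  -- elements.
  saturated : ∀ X → X ⊆ α → ∀ D → D ⊆ S →
    ∃ λ D′ → D′ ∈ grow n θ X D × D ⊆ D′ × D′ ⊆ S × (∀ y → y < n → α y ≡ true → (θ ≤ᵇ deg n X D′ y) ≡ false)
  saturated X X⊆α D D⊆S = saturate n m θ α S sums S≤m X X⊆α θ D D⊆S (begin-strict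
    m                              ≤⟨ m≤θ² ⟩
    θ * θ                          <⟨ m<n+m (θ * θ) 1≤θ ⟩
    suc θ * θ                      ≤⟨ m≤n+m (suc θ * θ) (# (n + n) D) ⟩
    # (n + n) D + suc θ * θ        ∎)
    where open ≤-Reasoning

  drop : ∀ r C D C′ D′ → m ≤ 4 * # n C →
    # n C + 2 * E * (# n C′ + # (n + n) D) ≤ 2 * E * (# n C + # (n + n) D′) →
    potential (suc r) (C , D) → potential r (C′ , D′)
  drop r C D C′ D′ m≤4κ progress pot = ≤-from 0
    (shape E m r (# n C) (# n C′) (# (n + n) D) (# (n + n) D′)) (4 ⊛ progress ⊹ pot ⊹ m≤4κ)
    where
    shape : ∀ E m r κ κ′ δ δ′ →
      8 * E * (κ′ + m) + (4 * (2 * E * (κ + δ′)) + (suc r * m + 8 * E * δ) + 4 * κ) + 0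
      ≡ r * m + 8 * E * δ′ + (4 * (κ + 2 * E * (κ′ + δ)) + 8 * E * (κ + m) + m)
    shape = solve-∀

  step : ∀ r st → Valid st → thin (# n (proj₁ st)) ≡ false →
    2 * (# n (proj₁ st) * # n (proj₁ st)) < E * misses n (proj₁ st) (proj₂ st) → potential (suc r) st →
    ∃ λ st′ → st′ ∈ round n θ E st × Valid st′ × potential r st′
  step r (C , D) (α⊆C , D⊆S) notThin many pot
    with sample n (2 * E * θ) (λ x → α x ∧ heavy n E C D x)
  ... | X , X∈ , X⊆ , #X≤ , inj₂ all =
    (trimmed n E X C D , D)
    , ∈-concatMap⁺ _ (lose X∈ (here refl))
    , ((λ y αy → true-∧ (α⊆C y αy) (keep y αy)) , D⊆S)
    , drop r C D (trimmed n E X C D) D (thick _ notThin)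
        (trimmed-progress n θ E X C D (≤-trans 1≤α α≤C) #X≤ (≤-trans 4E²θ≤α α≤C) many) pot
    where
    α≤C : # n α ≤ # n C
    α≤C = #-mono n (λ x _ → α⊆C x)
    keep : ∀ y → α y ≡ true → not (heavy n E C D y) ∨ X y ≡ true
    keep y αy with by-cases (heavy n E C D y)
    ... | inj₂ f = cong (λ z → not z ∨ X y) f
    ... | inj₁ t = trans (cong (λ z → not z ∨ X y) t) (all y (α<n y αy) (true-∧ αy t))
  ... | X , X∈ , X⊆ , #X≤ , inj₁ ≤#X with saturated X (λ x t → proj₁ (∧-true (X⊆ x t))) D D⊆S
  ...   | D′ , D′∈ , D⊆D′ , D′⊆S , light′ =
    (filtered n θ X D′ C , D′)
    , ∈-concatMap⁺ _ (lose X∈ (there (∈-map⁺ _ D′∈)))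
    , ((λ y αy → true-∧ (α⊆C y αy) (cong not (light′ y (α<n y αy) αy))) , D′⊆S)
    , drop r C D (filtered n θ X D′ C) D′ (thick _ notThin)
        (filtered-progress n θ E X C D D′ 1≤E 1≤θ (≤-antisym #X≤ ≤#X) (λ x t → proj₂ (∧-true {α x} (X⊆ x t))) D⊆D′) pot

  reach : ∀ r st → Valid st → potential r st → ∃ λ st′ → st′ ∈ stages n θ E r st × Valid st′ × Final st′
  -- An exhausted potential would give |C| + m ≤ |D| ≤ m, although C contains the nonempty A.
  reach zero (C , D) (α⊆C , D⊆S) pot = ⊥-elim (<-irrefl refl (begin-strict
    m                    <⟨ m<n+m m (≤-trans 1≤α (#-mono n (λ x _ → α⊆C x))) ⟩
    # n C + m            ≤⟨ *-cancelˡ-≤ (8 * E) {{m*n≢0 8 E {{_}} {{>-nonZero 1≤E}}}} pot ⟩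
    # (n + n) D          ≤⟨ #-mono (n + n) (λ d _ → D⊆S d) ⟩
    # (n + n) S          ≤⟨ S≤m ⟩
    m                    ∎))
    where open ≤-Reasoning
  reach (suc r) (C , D) valid pot with by-cases (thin (# n C)) | by-cases (E * misses n C D ≤ᵇ 2 * (# n C * # n C))
  ... | inj₁ t | _ = (C , D) , here refl , valid , inj₁ t
  ... | inj₂ _ | inj₁ t = (C , D) , here refl , valid , inj₂ (true-≤ᵇ t)
  ... | inj₂ f | inj₂ g with step r (C , D) valid f (false-≤ᵇ g) pot
  ...   | st , st∈ , valid′ , pot′ with reach r st valid′ pot′
  ...     | st′ , st′∈ , valid″ , final = st′ , there (∈-concatMap⁺ _ (lose st∈ st′∈)) , valid″ , final

  -- Each surviving y has at least (2E - 1)θ of its 2Eθ sums with X inside D, and each x in X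
  -- accounts for at most |D| ≤ m such pairs; hence (2E - 1)|C| ≤ 2E m.
  initial-size : ∀ X D → # n X ≡ 2 * E * θ → D ⊆ S → # n (proj₁ (initial n θ X D)) ≤ 2 * m
  initial-size X D #X D⊆S = *-cancelˡ-≤ (E * θ) {{m*n≢0 E θ {{>-nonZero 1≤E}} {{>-nonZero 1≤θ}}}}
    (≤-from 0 (shape E θ κ m) (pairs ⊹ *-monoˡ-≤ (θ * κ) 1≤E))
    where
    open ≤-Reasoning
    C : ℕ → Bool
    C = filtered n θ X D (λ _ → true)
    κ = # n C
    shape : ∀ E θ κ m → E * θ * κ + (θ * κ + 2 * E * θ * m + E * (θ * κ)) + 0
      ≡ E * θ * (2 * m) + (2 * E * θ * κ + 1 * (θ * κ))
    shape = solve-∀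
    bool : ∀ x d → ⟦ x ⟧ ≡ ⟦ x ∧ not d ⟧ + ⟦ x ∧ d ⟧
    bool true true = refl
    bool true false = refl
    bool false d = refl
    ind : ∀ x d → ⟦ x ∧ d ⟧ ≡ ⟦ x ⟧ * ⟦ d ⟧
    ind true true = refl
    ind true false = refl
    ind false d = refl
    both : ℕ
    both = ∑ n (λ y → # n (λ x → X x ∧ D (y + x)))
    row : ∀ y → 2 * E * θ * ⟦ C y ⟧ ≤ θ * ⟦ C y ⟧ + # n (λ x → X x ∧ D (y + x))
    row y = begin
      2 * E * θ * ⟦ C y ⟧
        ≡⟨ trans (*-comm _ ⟦ C y ⟧) (cong (⟦ C y ⟧ *_) (sym #X)) ⟩
      ⟦ C y ⟧ * # n X
        ≡⟨ cong (⟦ C y ⟧ *_) (trans (∑-cong n (λ x _ → bool (X x) (D (y + x)))) (∑-+ n _ _)) ⟩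
      ⟦ C y ⟧ * (deg n X D y + # n (λ x → X x ∧ D (y + x)))
        ≡⟨ *-distribˡ-+ ⟦ C y ⟧ _ _ ⟩
      ⟦ C y ⟧ * deg n X D y + ⟦ C y ⟧ * # n (λ x → X x ∧ D (y + x))
        ≤⟨ light true θ (deg n X D y) ⊹ ≤-trans (*-monoˡ-≤ _ (⟦⟧≤1 (C y))) (≤-reflexive (*-identityˡ _)) ⟩
      θ * ⟦ C y ⟧ + # n (λ x → X x ∧ D (y + x)) ∎
    both≤ : both ≤ 2 * E * θ * m
    both≤ = begin
      both
        ≡⟨ ∑-swap n n (λ y x → ⟦ X x ∧ D (y + x) ⟧) ⟩
      ∑ n (λ x → ∑ n (λ y → ⟦ X x ∧ D (y + x) ⟧))
        ≤⟨ ∑-mono n column ⟩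
      ∑ n (λ x → m * ⟦ X x ⟧)
        ≡⟨ trans (∑-* n m _) (trans (cong (m *_) #X) (*-comm m _)) ⟩
      2 * E * θ * m ∎
      where
      column : ∀ x → x < n → ∑ n (λ y → ⟦ X x ∧ D (y + x) ⟧) ≤ m * ⟦ X x ⟧
      column x x<n = begin
        ∑ n (λ y → ⟦ X x ∧ D (y + x) ⟧)
          ≡⟨ ∑-cong n (λ y _ → trans (ind (X x) _) (cong (λ z → ⟦ X x ⟧ * ⟦ D z ⟧) (+-comm y x))) ⟩
        ∑ n (λ y → ⟦ X x ⟧ * ⟦ D (x + y) ⟧)
          ≡⟨ ∑-* n ⟦ X x ⟧ _ ⟩
        ⟦ X x ⟧ * # n (λ y → D (x + y))
          ≤⟨ ⟦ X x ⟧ ⊛ (≤-trans (∑-window n (n + n) x (λ d → ⟦ D d ⟧) (+-monoˡ-≤ n (<⇒≤ x<n)))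
               (≤-trans (#-mono (n + n) (λ d _ → D⊆S d)) S≤m)) ⟩
        ⟦ X x ⟧ * m
          ≡⟨ *-comm ⟦ X x ⟧ m ⟩
        m * ⟦ X x ⟧ ∎
    pairs : 2 * E * θ * κ ≤ θ * κ + 2 * E * θ * m
    pairs = begin
      2 * E * θ * κ                                                      ≡⟨ sym (∑-* n (2 * E * θ) _) ⟩
      ∑ n (λ y → 2 * E * θ * ⟦ C y ⟧)                                    ≤⟨ ∑-mono n (λ y _ → row y) ⟩
      ∑ n (λ y → θ * ⟦ C y ⟧ + # n (λ x → X x ∧ D (y + x)))              ≡⟨ trans (∑-+ n _ _) (cong (_+ both) (∑-* n θ _)) ⟩
      θ * κ + both                                                       ≤⟨ +-monoʳ-≤ (θ * κ) both≤ ⟩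
      θ * κ + 2 * E * θ * m                                              ∎

  container : ∃ λ st → st ∈ containers n θ E × Valid st × Final st
  container =
    let X , X∈ , X⊆α , #X≤ , alt = sample n (2 * E * θ) α
        D , D∈ , _ , D⊆S , light′ = saturated X X⊆α ∅ (λ _ ())
        st , st∈ , rest = reach (24 * E) (initial n θ X D)
          ((λ y αy → cong not (light′ y (α<n y αy) αy)) , D⊆S)
          (start X D (initial-size X D (≤-antisym #X≤ (full X alt)) D⊆S))
    in st , ∈-containers X D st X∈ D∈ st∈ , rest
    where
    -- |C| + m is at most 3m, that is, 24E units of m/8E.
    start : ∀ X D → # n (proj₁ (initial n θ X D)) ≤ 2 * m → potential (24 * E) (initial n θ X D)
    start X D l = ≤-from (8 * E * # (n + n) D) (shape E m (# n (proj₁ (initial n θ X D))) (# (n + n) D)) (8 * E ⊛ l)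
      where
      shape : ∀ E m κ δ → 8 * E * (κ + m) + 8 * E * (2 * m) + 8 * E * δ ≡ 24 * E * m + 8 * E * δ + 8 * E * κ
      shape = solve-∀
    -- Even an X that exhausts A has 2Eθ elements, because |A| ≥ 4E²θ.
    full : ∀ X → 2 * E * θ ≤ # n X ⊎ (∀ y → y < n → α y ≡ true → X y ≡ true) → 2 * E * θ ≤ # n X
    full X (inj₁ l) = l
    full X (inj₂ all) = ≤-trans (≤-trans (m≤n*m (2 * E * θ) (2 * E) {{m*n≢0 2 E {{_}} {{>-nonZero 1≤E}}}}) 4E²θ≤α) (#-mono n all)
    ∈-containers : ∀ X D st → X ∈ smallSets n (2 * E * θ) → D ∈ grow n θ X ∅ →
      st ∈ stages n θ E (24 * E) (initial n θ X D) → st ∈ containers n θ E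
    ∈-containers X D st X∈ D∈ st∈ = ∈-concatMap⁺ (λ X → concatMap (λ D → stages n θ E (24 * E) (initial n θ X D)) (grow n θ X ∅))
      (lose X∈ (∈-concatMap⁺ (λ D → stages n θ E (24 * E) (initial n θ X D)) (lose D∈ st∈)))

-- Binomial coefficients

bin : ℕ → ℕ → ℕ
bin n zero = 1
bin zero (suc k) = 0
bin (suc n) (suc k) = bin n k + bin n (suc k)

bin-suc-mono : ∀ n k → bin n k ≤ bin (suc n) k
bin-suc-mono n zero = ≤-refl
bin-suc-mono n (suc k) = m≤n+m _ (bin n k)

bin-monoˡ : ∀ {m n} k → m ≤ n → bin m k ≤ bin n k
bin-monoˡ {m} {n} k m≤n with d , refl ← m≤n⇒∃[o]m+o≡n m≤n = go d
  where
  go : ∀ d → bin m k ≤ bin (m + d) k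
  go zero = ≤-reflexive (cong (λ x → bin x k) (sym (+-identityʳ m)))
  go (suc d) = ≤-trans (go d) (≤-trans (bin-suc-mono (m + d) k) (≤-reflexive (cong (λ x → bin x k) (sym (+-suc m d)))))

-- Vandermonde's identity, keeping only the choices with at most one of the w new elements.
bin-+ : ∀ w W k → bin W (suc k) + w * bin W k ≤ bin (w + W) (suc k)
bin-+ zero W k = ≤-reflexive (+-identityʳ _)
bin-+ (suc w) W k = begin
  bin W (suc k) + (bin W k + w * bin W k)     ≡⟨ shape (bin W (suc k)) (bin W k) (w * bin W k) ⟩
  bin W k + (bin W (suc k) + w * bin W k)     ≤⟨ bin-monoˡ k (m≤n+m W w) ⊹ bin-+ w W k ⟩
  bin (w + W) k + bin (w + W) (suc k)         ∎
  where
  open ≤-Reasoning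
  shape : ∀ a b c → a + (b + c) ≡ b + (a + c)
  shape = solve-∀

bin-absorb : ∀ n k → suc k * bin n (suc k) + k * bin n k ≡ n * bin n k
bin-absorb zero zero = refl
bin-absorb zero (suc k) = trans (cong₂ _+_ (*-zeroʳ (suc (suc k))) (*-zeroʳ (suc k))) refl
bin-absorb (suc n) zero = trans (shape (bin n 1)) (cong suc (bin-absorb n zero))
  where
  shape : ∀ x → (1 + x) + 0 + 0 ≡ suc (x + 0 + 0)
  shape = solve-∀
bin-absorb (suc n) (suc k) = begin
  suc (suc k) * (bin n (suc k) + bin n (suc (suc k))) + suc k * (bin n k + bin n (suc k))
    ≡⟨ shape₁ k (bin n k) (bin n (suc k)) (bin n (suc (suc k))) ⟩
  (suc (suc k) * bin n (suc (suc k)) + suc k * bin n (suc k)) + (suc k * bin n (suc k) + k * bin n k) + (bin n k + bin n (suc k))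
    ≡⟨ cong₂ (λ x y → x + y + (bin n k + bin n (suc k))) (bin-absorb n (suc k)) (bin-absorb n k) ⟩
  n * bin n (suc k) + n * bin n k + (bin n k + bin n (suc k))
    ≡⟨ shape₂ n (bin n k) (bin n (suc k)) ⟩
  suc n * (bin n k + bin n (suc k)) ∎
  where
  open ≡-Reasoning
  shape₁ : ∀ k a b c → (2 + k) * (b + c) + (1 + k) * (a + b)
    ≡ ((2 + k) * c + (1 + k) * b) + ((1 + k) * b + k * a) + (a + b)
  shape₁ = solve-∀
  shape₂ : ∀ n a b → n * b + n * a + (a + b) ≡ (1 + n) * (a + b)
  shape₂ = solve-∀

bin-zero : ∀ n k → n < k → bin n k ≡ 0
bin-zero zero (suc k) _ = refl
bin-zero (suc n) (suc k) l rewrite bin-zero n k (s<s⁻¹ l) | bin-zero n (suc k) (m<n⇒m<1+n (s<s⁻¹ l)) = refl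

bin-suc : ∀ n k → suc k * bin n (suc k) ≡ (n ∸ k) * bin n k
bin-suc n k with k ≤? n
... | yes k≤n = +-cancelʳ-≡ (k * bin n k) _ _ (begin
  suc k * bin n (suc k) + k * bin n k     ≡⟨ bin-absorb n k ⟩
  n * bin n k                             ≡⟨ cong (_* bin n k) (sym (m∸n+n≡m k≤n)) ⟩
  (n ∸ k + k) * bin n k                   ≡⟨ *-distribʳ-+ (bin n k) (n ∸ k) k ⟩
  (n ∸ k) * bin n k + k * bin n k         ∎)
  where open ≡-Reasoning
... | no k≰n rewrite bin-zero n k (≰⇒> k≰n) | bin-zero n (suc k) (m<n⇒m<1+n (≰⇒> k≰n)) =
  trans (*-zeroʳ (suc k)) (sym (*-zeroʳ (n ∸ k)))

-- The quotient of the two binomial coefficients is a product of factors (u - i)/(v - i), each at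
-- most u/v.
bin-shrink : ∀ u v k → u ≤ v → bin u k * v ^ k ≤ u ^ k * bin v k
bin-shrink u v zero _ = ≤-refl
bin-shrink u v (suc k) u≤v = *-cancelˡ-≤ (suc k) (begin
  suc k * (bin u (suc k) * (v * v ^ k))      ≡⟨ shape₁ (suc k) (bin u (suc k)) v (v ^ k) ⟩
  suc k * bin u (suc k) * v * v ^ k          ≡⟨ cong (λ x → x * v * v ^ k) (bin-suc u k) ⟩
  (u ∸ k) * bin u k * v * v ^ k              ≡⟨ shape₂ (u ∸ k) (bin u k) v (v ^ k) ⟩
  (u ∸ k) * v * (bin u k * v ^ k)            ≤⟨ *-mono-≤ ratio (bin-shrink u v k u≤v) ⟩
  u * (v ∸ k) * (u ^ k * bin v k)            ≡⟨ shape₃ u (v ∸ k) (u ^ k) (bin v k) ⟩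
  u * u ^ k * ((v ∸ k) * bin v k)            ≡⟨ cong (u * u ^ k *_) (sym (bin-suc v k)) ⟩
  u * u ^ k * (suc k * bin v (suc k))        ≡⟨ shape₄ (u * u ^ k) (suc k) (bin v (suc k)) ⟩
  suc k * (u * u ^ k * bin v (suc k))        ∎)
  where
  open ≤-Reasoning
  shape₁ : ∀ a b c d → a * (b * (c * d)) ≡ a * b * c * d
  shape₁ = solve-∀
  shape₂ : ∀ a b c d → a * b * c * d ≡ a * c * (b * d)
  shape₂ = solve-∀
  shape₃ : ∀ a b c d → a * b * (c * d) ≡ a * c * (b * d)
  shape₃ = solve-∀
  shape₄ : ∀ a b c → a * (b * c) ≡ b * (a * c)
  shape₄ = solve-∀
  ratio : (u ∸ k) * v ≤ u * (v ∸ k)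
  ratio = begin
    (u ∸ k) * v        ≡⟨ *-distribʳ-∸ v u k ⟩
    u * v ∸ k * v      ≤⟨ ∸-monoʳ-≤ (u * v) (*-monoʳ-≤ k u≤v) ⟩
    u * v ∸ k * u      ≡⟨ cong (u * v ∸_) (*-comm k u) ⟩
    u * v ∸ u * k      ≡⟨ sym (*-distribˡ-∸ u v k) ⟩
    u * (v ∸ k)        ∎

-- Here the factors (V - i)/(v - i) are at most 2, since V + i ≤ 2v.
bin-double : ∀ V v k → V + k ≤ v + v → bin V k ≤ 2 ^ k * bin v k
bin-double V v zero _ = ≤-refl
bin-double V v (suc k) l = *-cancelˡ-≤ (suc k) (begin
  suc k * bin V (suc k)                     ≡⟨ bin-suc V k ⟩
  (V ∸ k) * bin V k                         ≤⟨ *-mono-≤ ratio (bin-double V v k (≤-trans (+-monoʳ-≤ V (n≤1+n k)) l)) ⟩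
  2 * (v ∸ k) * (2 ^ k * bin v k)           ≡⟨ shape₁ (v ∸ k) (2 ^ k) (bin v k) ⟩
  2 * 2 ^ k * ((v ∸ k) * bin v k)           ≡⟨ cong (2 * 2 ^ k *_) (sym (bin-suc v k)) ⟩
  2 * 2 ^ k * (suc k * bin v (suc k))       ≡⟨ shape₂ (2 * 2 ^ k) (suc k) (bin v (suc k)) ⟩
  suc k * (2 * 2 ^ k * bin v (suc k))       ∎)
  where
  open ≤-Reasoning
  shape₁ : ∀ a b c → 2 * a * (b * c) ≡ 2 * b * (a * c)
  shape₁ = solve-∀
  shape₂ : ∀ a b c → a * (b * c) ≡ b * (a * c)
  shape₂ = solve-∀
  ratio : V ∸ k ≤ 2 * (v ∸ k)
  ratio = begin
    V ∸ k                ≤⟨ m≤n+o⇒m∸n≤o V k (begin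
        V                    ≡⟨ sym (m+n∸n≡m V k) ⟩
        V + k ∸ k            ≤⟨ ∸-monoˡ-≤ k (≤-trans (+-monoʳ-≤ V (n≤1+n k)) l) ⟩
        v + v ∸ k            ≤⟨ a∸k≤ (v + v) ⟩
        k + (v + v ∸ (k + k)) ∎) ⟩
    v + v ∸ (k + k)      ≡⟨ cong₂ _∸_ (double v) (double k) ⟩
    2 * v ∸ 2 * k        ≡⟨ sym (*-distribˡ-∸ 2 v k) ⟩
    2 * (v ∸ k)          ∎
    where
    double : ∀ x → x + x ≡ 2 * x
    double x = cong (x +_) (sym (+-identityʳ x))
    a∸k≤ : ∀ a → a ∸ k ≤ k + (a ∸ (k + k))
    a∸k≤ a = ≤-trans (m≤n+m∸n (a ∸ k) k) (≤-reflexive (cong (k +_) (∸-+-assoc a k k)))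

bernoulli : ∀ F k → (F + k) * F ^ k ≤ F * suc F ^ k
bernoulli F zero = ≤-reflexive (cong (_* 1) (+-identityʳ F))
bernoulli F (suc k) = begin
  (F + suc k) * (F * F ^ k)              ≤⟨ ≤-from (F ^ k * k) (shape F k (F ^ k)) (≤-refl {0}) ⟩
  suc F * ((F + k) * F ^ k)              ≤⟨ suc F ⊛ bernoulli F k ⟩
  suc F * (F * suc F ^ k)                ≡⟨ shape₂ F (suc F) (suc F ^ k) ⟩
  F * (suc F * suc F ^ k)                ∎
  where
  open ≤-Reasoning
  shape : ∀ F k x → (F + (1 + k)) * (F * x) + 0 + x * k ≡ (1 + F) * ((F + k) * x) + 0
  shape = solve-∀
  shape₂ : ∀ F G x → G * (F * x) ≡ F * (G * x)
  shape₂ = solve-∀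

-- Bernoulli's inequality gives (1 + 1/F)^F ≥ 2, and an exponent s ≥ F w contains w such blocks.
2^w*F^s≤sucF^s : ∀ F w s → 1 ≤ F → F * w ≤ s → 2 ^ w * F ^ s ≤ suc F ^ s
2^w*F^s≤sucF^s F w s 1≤F Fw≤s with r , refl ← m≤n⇒∃[o]m+o≡n Fw≤s = begin
  2 ^ w * F ^ (F * w + r)              ≡⟨ cong (2 ^ w *_) (^-distribˡ-+-* F (F * w) r) ⟩
  2 ^ w * (F ^ (F * w) * F ^ r)        ≡⟨ sym (*-assoc (2 ^ w) _ _) ⟩
  2 ^ w * F ^ (F * w) * F ^ r          ≤⟨ *-mono-≤ (blocks w) (^-monoˡ-≤ r (n≤1+n F)) ⟩
  suc F ^ (F * w) * suc F ^ r          ≡⟨ sym (^-distribˡ-+-* (suc F) (F * w) r) ⟩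
  suc F ^ (F * w + r)                  ∎
  where
  open ≤-Reasoning
  block : 2 * F ^ F ≤ suc F ^ F
  block = *-cancelˡ-≤ F {{>-nonZero 1≤F}} (≤-trans (≤-reflexive (shape F (F ^ F))) (bernoulli F F))
    where
    shape : ∀ F x → F * (2 * x) ≡ (F + F) * x
    shape = solve-∀
  blocks : ∀ w → 2 ^ w * F ^ (F * w) ≤ suc F ^ (F * w)
  blocks zero rewrite *-zeroʳ F = ≤-refl
  blocks (suc w) = begin
    2 * 2 ^ w * F ^ (F * suc w)                   ≡⟨ cong (λ x → 2 * 2 ^ w * F ^ x) (*-suc F w) ⟩
    2 * 2 ^ w * F ^ (F + F * w)                   ≡⟨ cong (2 * 2 ^ w *_) (^-distribˡ-+-* F F (F * w)) ⟩
    2 * 2 ^ w * (F ^ F * F ^ (F * w))             ≡⟨ shape (2 ^ w) (F ^ F) (F ^ (F * w)) ⟩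
    2 * F ^ F * (2 ^ w * F ^ (F * w))             ≤⟨ *-mono-≤ block (blocks w) ⟩
    suc F ^ F * suc F ^ (F * w)                   ≡⟨ sym (^-distribˡ-+-* (suc F) F (F * w)) ⟩
    suc F ^ (F + F * w)                           ≡⟨ cong (suc F ^_) (sym (*-suc F w)) ⟩
    suc F ^ (F * suc w)                           ∎
    where
    shape : ∀ a b c → 2 * a * (b * c) ≡ 2 * b * (a * c)
    shape = solve-∀

^-distrib-* : ∀ s a b → (a * b) ^ s ≡ a ^ s * b ^ s
^-distrib-* zero a b = refl
^-distrib-* (suc s) a b = trans (cong (a * b *_) (^-distrib-* s a b)) (shape a b (a ^ s) (b ^ s))
  where
  shape : ∀ a b c d → a * b * (c * d) ≡ a * c * (b * d)
  shape = solve-∀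

thin-bin : ∀ F w s κ v → 1 ≤ F → F * w ≤ s → 1 ≤ v → suc F * κ ≤ F * v → 2 ^ w * bin κ s ≤ bin v s
thin-bin F w s κ v 1≤F Fw≤s 1≤v thin = *-cancelˡ-≤ (F ^ s * v ^ s)
  {{m*n≢0 (F ^ s) (v ^ s) {{m^n≢0 F s {{>-nonZero 1≤F}}}} {{m^n≢0 v s {{>-nonZero 1≤v}}}}}} (begin
  F ^ s * v ^ s * (2 ^ w * bin κ s)          ≡⟨ shape₁ (F ^ s) (v ^ s) (2 ^ w) (bin κ s) ⟩
  2 ^ w * F ^ s * (bin κ s * v ^ s)          ≤⟨ *-mono-≤ (2^w*F^s≤sucF^s F w s 1≤F Fw≤s) (bin-shrink κ v s κ≤v) ⟩
  suc F ^ s * (κ ^ s * bin v s)              ≡⟨ sym (*-assoc (suc F ^ s) (κ ^ s) (bin v s)) ⟩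
  suc F ^ s * κ ^ s * bin v s                ≡⟨ cong (_* bin v s) (sym (^-distrib-* s (suc F) κ)) ⟩
  (suc F * κ) ^ s * bin v s                  ≤⟨ *-monoˡ-≤ (bin v s) (^-monoˡ-≤ s thin) ⟩
  (F * v) ^ s * bin v s                      ≡⟨ cong (_* bin v s) (^-distrib-* s F v) ⟩
  F ^ s * v ^ s * bin v s                    ∎)
  where
  open ≤-Reasoning
  shape₁ : ∀ a b c d → a * b * (c * d) ≡ c * a * (d * b)
  shape₁ = solve-∀
  κ≤v : κ ≤ v
  κ≤v = *-cancelˡ-≤ F {{>-nonZero 1≤F}} (≤-trans (m≤n+m (F * κ) κ) thin)

-- Sets as vectors of booleans

at : ∀ {n} → Subset n → ℕ → Bool
at [] _ = false
at (b ∷ A) zero = b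
at (b ∷ A) (suc i) = at A i

lookup-at : ∀ {n} (A : Subset n) i → lookup A i ≡ at A (toℕ i)
lookup-at (b ∷ A) Fin.zero = refl
lookup-at (b ∷ A) (Fin.suc i) = lookup-at A i

at-< : ∀ {n} (A : Subset n) i → at A i ≡ true → i < n
at-< (b ∷ A) zero _ = z<s
at-< (b ∷ A) (suc i) e = s<s (at-< A i e)

countFin-# : ∀ n (f : Fin n → Bool) (p : ℕ → Bool) → (∀ i → f i ≡ p (toℕ i)) → countFin f ≡ # n p
countFin-# n f p h = trans (cong sum (map-tabulate id (λ i → ⟦ f i ⟧))) (go n f p h)
  where
  go : ∀ n (f : Fin n → Bool) (p : ℕ → Bool) → (∀ i → f i ≡ p (toℕ i)) → sum (tabulate (λ i → ⟦ f i ⟧)) ≡ # n p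
  go zero f p h = refl
  go (suc n) f p h = cong₂ _+_ (cong ⟦_⟧ (h Fin.zero)) (go n (f ∘ Fin.suc) (p ∘ suc) (h ∘ Fin.suc))

card-at : ∀ {n} (A : Subset n) → card A ≡ # n (at A)
card-at {n} A = countFin-# n (lookup A) (at A) (lookup-at A)

-- Sums and counts over lists.

sumL : ∀ {A : Set} → (A → ℕ) → List A → ℕ
sumL f [] = 0
sumL f (x ∷ xs) = f x + sumL f xs

sumL-++ : ∀ {A : Set} (f : A → ℕ) xs ys → sumL f (xs ++ ys) ≡ sumL f xs + sumL f ys
sumL-++ f [] ys = refl
sumL-++ f (x ∷ xs) ys = trans (cong (f x +_) (sumL-++ f xs ys)) (sym (+-assoc (f x) _ _))

sumL-map : ∀ {A B : Set} (f : B → ℕ) (g : A → B) xs → sumL f (map g xs) ≡ sumL (f ∘ g) xs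
sumL-map f g [] = refl
sumL-map f g (x ∷ xs) = cong (f (g x) +_) (sumL-map f g xs)

sumL-cong : ∀ {A : Set} {f g : A → ℕ} xs → (∀ x → f x ≡ g x) → sumL f xs ≡ sumL g xs
sumL-cong [] h = refl
sumL-cong (x ∷ xs) h = cong₂ _+_ (h x) (sumL-cong xs h)

sumL-* : ∀ {A : Set} c (f : A → ℕ) xs → sumL (λ x → c * f x) xs ≡ c * sumL f xs
sumL-* c f [] = sym (*-zeroʳ c)
sumL-* c f (x ∷ xs) = trans (cong (c * f x +_) (sumL-* c f xs)) (sym (*-distribˡ-+ c (f x) _))

sumL-zero : ∀ {A : Set} (xs : List A) → sumL (λ _ → 0) xs ≡ 0
sumL-zero [] = refl
sumL-zero (x ∷ xs) = sumL-zero xs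

count : ∀ {A : Set} → (A → Bool) → List A → ℕ
count p xs = length (filterᵇ p xs)

count-++ : ∀ {A : Set} (p : A → Bool) xs ys → count p (xs ++ ys) ≡ count p xs + count p ys
count-++ p [] ys = refl
count-++ p (x ∷ xs) ys with p x
... | true = cong suc (count-++ p xs ys)
... | false = count-++ p xs ys

count-map : ∀ {A B : Set} (p : B → Bool) (f : A → B) xs → count p (map f xs) ≡ count (p ∘ f) xs
count-map p f [] = refl
count-map p f (x ∷ xs) with p (f x)
... | true = cong suc (count-map p f xs)
... | false = count-map p f xs

count-≤ : ∀ {A : Set} M (p : A → Bool) (f : A → ℕ) xs → (∀ x → p x ≡ true → M ≤ f x) → M * count p xs ≤ sumL f xs
count-≤ M p f [] h = ≤-reflexive (*-zeroʳ M)
count-≤ M p f (x ∷ xs) h with p x in e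
... | true = ≤-trans (≤-reflexive (*-suc M _)) (h x e ⊹ count-≤ M p f xs h)
... | false = ≤-trans (count-≤ M p f xs h) (m≤n+m _ (f x))

-- Counting sets by weights.

wt : ∀ {n} → (ℕ → ℕ) → Subset n → ℕ
wt w [] = 1
wt w (b ∷ A) = (if b then w 0 else 1) * wt (w ∘ suc) A

-- Summed over all subsets, this is the elementary symmetric polynomial of degree s in the weights.
layer : ∀ n → ℕ → (ℕ → ℕ) → Subset n → ℕ
layer n s w A = if # n (at A) ≡ᵇ s then wt w A else 0

if-* : ∀ b c x → (if b then c * x else 0) ≡ c * (if b then x else 0)
if-* true c x = refl
if-* false c x = sym (*-zeroʳ c)

-- Replace each element i by w i copies of itself.
symmetric-≤-bin : ∀ n s w → sumL (layer n s w) (allSubsets n) ≤ bin (∑ n w) s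
symmetric-≤-bin zero zero w = ≤-refl
symmetric-≤-bin zero (suc s) w = z≤n
symmetric-≤-bin (suc n) s w = ≤-trans (≤-reflexive (begin
  sumL (layer (suc n) s w) (allSubsets (suc n))
    ≡⟨ sumL-++ (layer (suc n) s w) (map (false ∷_) (allSubsets n)) _ ⟩
  sumL (layer (suc n) s w) (map (false ∷_) (allSubsets n)) + sumL (layer (suc n) s w) (map (true ∷_) (allSubsets n))
    ≡⟨ cong₂ _+_ (sumL-map (layer (suc n) s w) (false ∷_) (allSubsets n)) (sumL-map (layer (suc n) s w) (true ∷_) (allSubsets n)) ⟩
  sumL (λ A → layer (suc n) s w (false ∷ A)) (allSubsets n) + sumL (λ A → layer (suc n) s w (true ∷ A)) (allSubsets n)
    ≡⟨ cong (_+ sumL (λ A → layer (suc n) s w (true ∷ A)) (allSubsets n))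
         (sumL-cong (allSubsets n) (λ A → cong (λ x → if # n (at A) ≡ᵇ s then x else 0) (+-identityʳ _))) ⟩
  sumL (layer n s (w ∘ suc)) (allSubsets n) + sumL (λ A → layer (suc n) s w (true ∷ A)) (allSubsets n) ∎)) (rest s)
  where
  open ≡-Reasoning
  W = ∑ n (w ∘ suc)
  rest : ∀ s → sumL (layer n s (w ∘ suc)) (allSubsets n) + sumL (λ A → layer (suc n) s w (true ∷ A)) (allSubsets n)
    ≤ bin (w 0 + W) s
  rest zero = ≤-trans (symmetric-≤-bin n zero (w ∘ suc) ⊹ ≤-reflexive (sumL-zero (allSubsets n))) ≤-refl
  rest (suc s) = ≤-trans (symmetric-≤-bin n (suc s) (w ∘ suc) ⊹ ≤-trans (≤-reflexive
      (trans (sumL-cong (allSubsets n) (λ A → if-* (# n (at A) ≡ᵇ s) (w 0) (wt (w ∘ suc) A)))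
        (sumL-* (w 0) (layer n s (w ∘ suc)) (allSubsets n))))
      (w 0 ⊛ symmetric-≤-bin n s (w ∘ suc)))
    (bin-+ (w 0) W s)

-- Markov's inequality for the product weight. Weight 0 off a container confines the total to
-- subsets of the container, and a large weight penalises elements that should be rare.
weighted-count : ∀ n s M w (p : Subset n → Bool) →
  (∀ A → p A ≡ true → # n (at A) ≡ s × M ≤ wt w A) → M * count p (allSubsets n) ≤ bin (∑ n w) s
weighted-count n s M w p h = ≤-trans (count-≤ M p (layer n s w) (allSubsets n) each) (symmetric-≤-bin n s w)
  where
  each : ∀ A → p A ≡ true → M ≤ layer n s w A
  each A e with refl , l ← h A e rewrite ≡ᵇ-refl (# n (at A)) = l

wt-inside : ∀ {n} (A : Subset n) l (w : ℕ → ℕ) (P : ℕ → Bool) →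
  (∀ i → at A i ≡ true → w i ≡ (if P i then 1 else l)) → wt w A ≡ l ^ # n (λ i → at A i ∧ not (P i))
wt-inside [] l w P h = refl
wt-inside (false ∷ A) l w P h = trans (+-identityʳ _) (wt-inside A l (w ∘ suc) (P ∘ suc) (h ∘ suc))
wt-inside (true ∷ A) l w P h rewrite h 0 refl with P 0
... | true = trans (+-identityʳ _) (wt-inside A l (w ∘ suc) (P ∘ suc) (h ∘ suc))
... | false = cong (l *_) (wt-inside A l (w ∘ suc) (P ∘ suc) (h ∘ suc))

bin-≤-count : ∀ n v s (p : Subset n → Bool) → v ≤ n →
  (∀ A → # n (at A) ≡ s → (∀ i → at A i ≡ true → i < v) → p A ≡ true) → bin v s ≤ count p (allSubsets n)
bin-≤-count n zero (suc s) p _ h = z≤n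
bin-≤-count zero zero zero p _ h rewrite h [] refl (λ _ ()) = ≤-refl
bin-≤-count (suc n) zero zero p _ h = begin
  1                                                         ≤⟨ bin-≤-count n zero zero (p ∘ (false ∷_)) z≤n
                                                                 (λ A e l → h (false ∷ A) e (shift A l)) ⟩
  count (p ∘ (false ∷_)) (allSubsets n)                     ≡⟨ sym (count-map p (false ∷_) (allSubsets n)) ⟩
  count p (map (false ∷_) (allSubsets n))                   ≤⟨ m≤m+n _ _ ⟩
  count p (map (false ∷_) (allSubsets n)) + count p (map (true ∷_) (allSubsets n)) ≡⟨ sym (count-++ p (map (false ∷_) (allSubsets n)) _) ⟩
  count p (allSubsets (suc n))                              ∎
  where
  open ≤-Reasoning
  shift : ∀ (A : Subset n) → (∀ i → at A i ≡ true → i < 0) → ∀ i → at (false ∷ A) i ≡ true → i < 0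
  shift A l (suc i) e with () ← l i e
bin-≤-count (suc n) (suc v) s p v≤n h = begin
  bin (suc v) s                                                                       ≤⟨ rest s h ⟩
  count (p ∘ (false ∷_)) (allSubsets n) + count (p ∘ (true ∷_)) (allSubsets n)        ≡⟨ sym (cong₂ _+_ (count-map p (false ∷_) (allSubsets n)) (count-map p (true ∷_) (allSubsets n))) ⟩
  count p (map (false ∷_) (allSubsets n)) + count p (map (true ∷_) (allSubsets n))    ≡⟨ sym (count-++ p (map (false ∷_) (allSubsets n)) _) ⟩
  count p (allSubsets (suc n))                                                        ∎
  where
  open ≤-Reasoning
  shift : ∀ b (A : Subset n) → (∀ i → at A i ≡ true → i < v) → ∀ i → at (b ∷ A) i ≡ true → i < suc v
  shift b A l zero e = z<s
  shift b A l (suc i) e = s<s (l i e)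
  rest : ∀ s → (∀ A → # (suc n) (at A) ≡ s → (∀ i → at A i ≡ true → i < suc v) → p A ≡ true) →
    bin (suc v) s ≤ count (p ∘ (false ∷_)) (allSubsets n) + count (p ∘ (true ∷_)) (allSubsets n)
  rest zero h = ≤-trans (bin-≤-count n v zero (p ∘ (false ∷_)) (s≤s⁻¹ v≤n) (λ A e l → h (false ∷ A) e (shift false A l))) (m≤m+n _ _)
  rest (suc s) h = ≤-trans (bin-≤-count n v s (p ∘ (true ∷_)) (s≤s⁻¹ v≤n) (λ A e l → h (true ∷ A) (cong suc e) (shift true A l))
      ⊹ bin-≤-count n v (suc s) (p ∘ (false ∷_)) (s≤s⁻¹ v≤n) (λ A e l → h (false ∷ A) e (shift false A l)))
    (≤-reflexive (+-comm (count (p ∘ (true ∷_)) (allSubsets n)) _))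

any-true : ∀ {A : Set} (p : A → Bool) {x} xs → x ∈ xs → p x ≡ true → any p xs ≡ true
any-true p (x ∷ xs) (here refl) e = cong (_∨ any p xs) e
any-true p (x ∷ xs) (there x∈) e with p x
... | true = refl
... | false = any-true p xs x∈ e

any-witness : ∀ {A : Set} (p : A → Bool) xs → any p xs ≡ true → ∃ λ x → p x ≡ true
any-witness p (x ∷ xs) e with p x in px
... | true = x , px
... | false = any-witness p xs e

any-false : ∀ {A : Set} (p : A → Bool) {x} xs → any p xs ≡ false → x ∈ xs → p x ≡ false
any-false p xs e x∈ = ¬true⇒false λ t → true≢false (trans (sym (any-true p xs x∈ t)) e)

∈-filterᵇ : ∀ {A : Set} (p : A → Bool) {x} xs → x ∈ filterᵇ p xs → p x ≡ true
∈-filterᵇ p (y ∷ xs) x∈ with p y in e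
∈-filterᵇ p (y ∷ xs) (here refl) | true = e
∈-filterᵇ p (y ∷ xs) (there x∈) | true = ∈-filterᵇ p xs x∈
∈-filterᵇ p (y ∷ xs) x∈ | false = ∈-filterᵇ p xs x∈

-- Sumsets and the family

sumset : ∀ {n} → Subset n → ℕ → Bool
sumset {n} A t = anyFin {n} (λ i → anyFin {n} (λ j → lookup A i ∧ (lookup A j ∧ (toℕ i + toℕ j ≡ᵇ t))))

sumsetSize-# : ∀ {n} (A : Subset n) → sumsetSize A ≡ # (n + n) (sumset A)
sumsetSize-# {n} A = countFin-# (n + n) (λ t → sumset A (toℕ t)) (sumset A) (λ _ → refl)

sumset-sums : ∀ {n} (A : Subset n) x y → at A x ≡ true → at A y ≡ true → sumset A (x + y) ≡ true
sumset-sums {n} A x y ax ay = any-true _ (allFin n) (∈-allFin i) (any-true _ (allFin n) (∈-allFin j)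
  (true-∧ (trans (lookup-at A i) (trans (cong (at A) i≡) ax)) (true-∧ (trans (lookup-at A j) (trans (cong (at A) j≡) ay))
    (trans (cong (_≡ᵇ x + y) (cong₂ _+_ i≡ j≡)) (≡ᵇ-refl (x + y))))))
  where
  i = fromℕ< (at-< A x ax)
  j = fromℕ< (at-< A y ay)
  i≡ : toℕ i ≡ x
  i≡ = toℕ-fromℕ< (at-< A x ax)
  j≡ : toℕ j ≡ y
  j≡ = toℕ-fromℕ< (at-< A y ay)

sumset-witness : ∀ {n} (A : Subset n) t → sumset A t ≡ true →
  ∃ λ x → ∃ λ y → at A x ≡ true × at A y ≡ true × x + y ≡ t
sumset-witness {n} A t e with any-witness _ (allFin n) e
... | i , ei with any-witness _ (allFin n) ei
...   | j , ej with ∧-true {lookup A i} ej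
...     | ai , ej′ with ∧-true {lookup A j} ej′
...       | aj , sum≡ = toℕ i , toℕ j , trans (sym (lookup-at A i)) ai , trans (sym (lookup-at A j)) aj , ≡ᵇ-true _ t sum≡

#-bounded : ∀ n c (p : ℕ → Bool) → (∀ t → p t ≡ true → t < c) → # n p ≤ c
#-bounded n c p h with ≤-total n c
... | inj₁ n≤c = ≤-trans (#≤n n p) n≤c
... | inj₂ c≤n with r , refl ← m≤n⇒∃[o]m+o≡n c≤n = begin
  # (c + r) p                           ≡⟨ ∑-split c r _ ⟩
  # c p + # r (λ i → p (c + i))         ≡⟨ cong (# c p +_) (∑-zero r (λ i _ → cong ⟦_⟧
                                             (¬true⇒false λ t → <⇒≱ (h (c + i) t) (m≤m+n c i)))) ⟩
  # c p + 0                             ≡⟨ +-identityʳ _ ⟩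
  # c p                                 ≤⟨ #≤n c p ⟩
  c                                     ∎
  where open ≤-Reasoning

family-elim : ∀ n s m (A : Subset n) → A ∈ family n s m → # n (at A) ≡ s × # (n + n) (sumset A) ≤ m
family-elim n s m A A∈ with ∧-true {card A ≡ᵇ s} (∈-filterᵇ (λ A → (card A ≡ᵇ s) ∧ (sumsetSize A ≤ᵇ m)) (allSubsets n) A∈)
... | c , t = trans (sym (card-at A)) (≡ᵇ-true _ s c) , subst (_≤ m) (sumsetSize-# A) (true-≤ᵇ {sumsetSize A} t)

-- Sums of two elements among v consecutive positions take at most 2v - 1 values. The condition on v
-- admits m/2 rounded up.
bin-≤-family : ∀ n s m v → 1 ≤ v → v ≤ n → v + v ≤ suc m → bin v s ≤ length (family n s m)
bin-≤-family n s m (suc v) 1≤v v≤n 2v≤ = bin-≤-count n (suc v) s _ v≤n λ A #A below →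
  true-∧ (trans (cong (_≡ᵇ s) (trans (card-at A) #A)) (≡ᵇ-refl s))
    (≤ᵇ-true (subst (_≤ m) (sym (sumsetSize-# A)) (≤-trans (#-bounded (n + n) (v + suc v) (sumset A) (bound A below)) (s≤s⁻¹ 2v≤))))
  where
  bound : ∀ A → (∀ i → at A i ≡ true → i < suc v) → ∀ t → sumset A t ≡ true → t < v + suc v
  bound A below t e with x , y , ax , ay , refl ← sumset-witness A t e = +-mono-≤-< (s≤s⁻¹ (below x ax)) (below y ay)

-- A + A contains the translate a + A for any a in A.
s≤m : ∀ n s m (A : Subset n) → 1 ≤ s → # n (at A) ≡ s → # (n + n) (sumset A) ≤ m → s ≤ m
s≤m n s m A 1≤s refl S≤m with a , a<n , αa ← #-positive n (at A) 1≤s = begin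
  # n (at A)                        ≤⟨ #-mono n (λ x _ αx → sumset-sums A a x αa αx) ⟩
  # n (λ x → sumset A (a + x))      ≤⟨ ∑-window n (n + n) a (λ t → ⟦ sumset A t ⟧) (+-monoˡ-≤ n (<⇒≤ a<n)) ⟩
  # (n + n) (sumset A)              ≤⟨ S≤m ⟩
  m                                 ∎
  where open ≤-Reasoning

-- Progressions, shifted so that the position i stands for the integer i + 1.
prog : ℕ → ℕ → ℕ → ℕ → Bool
prog a d k i = inAP (ℤ.+ suc a) (ℤ.+ d) k (ℤ.+ suc i)

prog-true : ∀ a d k j → j < k → prog a d k (a + j * d) ≡ true
prog-true a d k j j<k = any-true (λ i → ⌊ ((ℤ.+ suc a) ℤ.+ (ℤ.+ i) ℤ.* (ℤ.+ d)) ℤ.≟ (ℤ.+ suc (a + j * d)) ⌋) (upTo k) (∈-upTo⁺ j<k)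
  (isYes-true ((ℤ.+ suc a) ℤ.+ (ℤ.+ j) ℤ.* (ℤ.+ d)) (ℤ.+ suc (a + j * d)) (cong (λ x → (ℤ.+ suc a) ℤ.+ x) (sym (ℤ.pos-* j d))))
  where
  isYes-true : ∀ x y → x ≡ y → ⌊ x ℤ.≟ y ⌋ ≡ true
  isYes-true x y e with x ℤ.≟ y
  ... | yes _ = refl
  ... | no ne = ⊥-elim (ne e)

-- `GoodAP` for η = 1/g with denominators cleared: the length bound is m/2 + m/g.
Good : ∀ {n} → ℕ → ℕ → ℕ → Subset n → Set
Good {n} g m s A = ∃ λ a → ∃ λ d → ∃ λ k →
  1 ≤ d × 2 * (g * k) ≤ (g + 2) * m × g * # n (λ i → at A i ∧ not (prog a d k i)) ≤ s

count-false : ∀ {A : Set} (xs : List A) → count (λ _ → false) xs ≡ 0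
count-false [] = refl
count-false (x ∷ xs) = count-false xs

count-any : ∀ {A B : Set} M b (p : B → A → Bool) cs xs → (∀ c → M * count (p c) xs ≤ b) →
  M * count (λ x → any (λ c → p c x) cs) xs ≤ length cs * b
count-any M b p [] xs h = ≤-trans (≤-reflexive (cong (M *_) (count-false xs))) (≤-reflexive (*-zeroʳ M))
count-any M b p (c ∷ cs) xs h = begin
  M * count (λ x → p c x ∨ any (λ c → p c x) cs) xs                  ≤⟨ M ⊛ count-∨ (p c) _ xs ⟩
  M * (count (p c) xs + count (λ x → any (λ c → p c x) cs) xs)       ≡⟨ *-distribˡ-+ M _ _ ⟩
  M * count (p c) xs + M * count (λ x → any (λ c → p c x) cs) xs     ≤⟨ h c ⊹ count-any M b p cs xs h ⟩
  b + length cs * b                                                  ∎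
  where
  open ≤-Reasoning
  count-∨ : ∀ p q xs → count (λ x → p x ∨ q x) xs ≤ count p xs + count q xs
  count-∨ p q [] = z≤n
  count-∨ p q (x ∷ xs) with p x | q x
  ... | true | true = s≤s (≤-trans (count-∨ p q xs) (+-monoʳ-≤ _ (n≤1+n _)))
  ... | true | false = s≤s (count-∨ p q xs)
  ... | false | true = ≤-trans (s≤s (count-∨ p q xs)) (≤-reflexive (sym (+-suc _ _)))
  ... | false | false = count-∨ p q xs

n<2^n : ∀ n → n < 2 ^ n
n<2^n zero = s≤s z≤n
n<2^n (suc n) = ≤-trans (+-mono-≤ (m^n>0 2 n) (n<2^n n)) (≤-reflexive (cong (2 ^ n +_) (sym (+-identityʳ _))))

-- Elements outside the progression get weight l, so that a set with more than s/g
-- of them has weight at least 8^s, while all weights together stay below m.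
module Finite (n m s g v w l T F E : ℕ)
  (l≡ : l ≡ 8 ^ g) (T≡ : T ≡ 12 * l) (F≡ : F ≡ 9 * (T * T)) (E≡ : E ≡ 2 * (F * F))
  (m≤2v : m ≤ v + v) (Fw≤s : F * w ≤ s) (4F≤m : 4 * F ≤ m) (2g≤m : 2 * g ≤ m) (1≤s : 1 ≤ s) where

  g≤l : g ≤ l
  g≤l = ≤-trans (<⇒≤ (n<2^n g)) (≤-trans (^-monoˡ-≤ g (s≤s (s≤s z≤n))) (≤-reflexive (sym l≡)))

  1≤l : 1 ≤ l
  1≤l = ≤-trans (m^n>0 8 g) (≤-reflexive (sym l≡))

  8≤T : 8 ≤ T
  8≤T = ≤-trans (≤-trans (m≤m+n 8 4) (12 ⊛ 1≤l)) (≤-reflexive (sym T≡))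

  1≤T : 1 ≤ T
  1≤T = ≤-trans (s≤s z≤n) 8≤T

  1≤F : 1 ≤ F
  1≤F = ≤-trans (≤-trans (s≤s z≤n) (9 ⊛ *-mono-≤ 1≤T 1≤T)) (≤-reflexive (sym F≡))

  instance
    nonZero-F : NonZero F
    nonZero-F = >-nonZero 1≤F
    nonZero-T : NonZero T
    nonZero-T = >-nonZero 1≤T

  1≤m : 1 ≤ m
  1≤m = ≤-trans (≤-trans 1≤F (m≤n*m F 4)) 4F≤m

  1≤v : 1 ≤ v
  1≤v = n≢0⇒n>0 λ v≡0 → <-irrefl refl (≤-trans 1≤m (subst (λ x → m ≤ x + x) v≡0 m≤2v))

  w≤s : w ≤ s
  w≤s = ≤-trans (m≤n*m w F) Fw≤s

  -- Below this threshold the s-subsets of C are a fraction of at most 2^-w of binom(v, s), by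
  -- `thin-bin`; above it, `dense` is exactly the density that `stability` asks for.
  thin : ℕ → Bool
  thin κ = suc F * κ ≤ᵇ F * v

  dense : ∀ κ → thin κ ≡ false → F * m ≤ (2 * F + 2) * κ
  dense κ f = ≤-from 2 (shape F m v κ) (F ⊛ m≤2v ⊹ 2 ⊛ false-≤ᵇ {suc F * κ} f)
    where
    shape : ∀ F m v κ → F * m + (F * (v + v) + 2 * ((1 + F) * κ)) + 2 ≡ (2 * F + 2) * κ + (F * m + 2 * (1 + F * v))
    shape = solve-∀

  thick : ∀ κ → thin κ ≡ false → m ≤ 4 * κ
  thick κ f = *-cancelˡ-≤ F (≤-from 0 (shape F m κ) (dense κ f ⊹ 2 ⊛ *-monoˡ-≤ κ 1≤F))
    where
    shape : ∀ F m κ → F * m + ((2 * F + 2) * κ + 2 * (F * κ)) + 0 ≡ F * (4 * κ) + (F * m + 2 * (1 * κ))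
    shape = solve-∀

  Final : State → Set
  Final (C , D) = thin (# n C) ≡ true ⊎ E * misses n C D ≤ 2 * (# n C * # n C)

  -- `p` marks the sets given up because of this container. Their number has to survive a union
  -- bound over at most 2^w/g containers.
  Treatment : State → Set
  Treatment (C , D) = ∃ λ (p : Subset n → Bool) → 2 ^ w * count p (allSubsets n) ≤ bin v s
    × (∀ A → # n (at A) ≡ s → at A ⊆ C → # (n + n) D ≤ m → Final (C , D) → p A ≡ false → Good g m s A)

  treat-thin : ∀ C D → thin (# n C) ≡ true → Treatment (C , D)
  treat-thin C D t = p , bound , λ A #A A⊆C _ _ f → ⊥-elim (true≢false (trans (sym (p-true A #A A⊆C)) f))
    where
    p : Subset n → Bool
    p A = (# n (at A) ≡ᵇ s) ∧ (1 ≤ᵇ wt (λ i → ⟦ C i ⟧) A)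
    p-elim : ∀ A → p A ≡ true → # n (at A) ≡ s × 1 ≤ wt (λ i → ⟦ C i ⟧) A
    p-elim A e = ≡ᵇ-true _ s (proj₁ (∧-true {# n (at A) ≡ᵇ s} e)) , true-≤ᵇ {1} (proj₂ (∧-true {# n (at A) ≡ᵇ s} e))
    bound : 2 ^ w * count p (allSubsets n) ≤ bin v s
    bound = begin
      2 ^ w * count p (allSubsets n)          ≡⟨ cong (2 ^ w *_) (sym (*-identityˡ _)) ⟩
      2 ^ w * (1 * count p (allSubsets n))    ≤⟨ 2 ^ w ⊛ weighted-count n s 1 _ p p-elim ⟩
      2 ^ w * bin (# n C) s                   ≤⟨ thin-bin F w s (# n C) v 1≤F Fw≤s 1≤v (true-≤ᵇ {suc F * # n C} t) ⟩
      bin v s                                 ∎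
      where open ≤-Reasoning
    p-true : ∀ A → # n (at A) ≡ s → at A ⊆ C → p A ≡ true
    p-true A #A A⊆C = true-∧ (trans (cong (_≡ᵇ s) #A) (≡ᵇ-refl s)) (≤ᵇ-true (≤-reflexive
      (sym (trans (wt-inside A 1 _ (λ _ → true) (λ i e → cong ⟦_⟧ (A⊆C i e))) (^-zeroˡ (# n (λ i → at A i ∧ not true)))))))

  treat-progression : ∀ C D a d ν → 1 ≤ d → 2 * (T * ν) ≤ (T + 8) * m → 2 * (T * # n C) ≤ T * m + 2 * # n C →
    T * # n (λ x → C x ∧ not (prog a d (suc ν) x)) ≤ 2 * # n C → Treatment (C , D)
  treat-progression C D a d ν 1≤d length≤ κ≤ outside≤ = cases (by-cases (4 * s ≤ᵇ m))
    where
    open ≤-Reasoning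
    P : ℕ → Bool
    P = prog a d (suc ν)
    κ = # n C
    e = # n (λ x → C x ∧ not (P x))
    7κ≤4m : 7 * κ ≤ 4 * m
    7κ≤4m = *-cancelˡ-≤ T (≤-from 0 (shape T κ m) (4 ⊛ κ≤ ⊹ *-monoˡ-≤ κ 8≤T))
      where
      shape : ∀ T κ m → T * (7 * κ) + (4 * (T * m + 2 * κ) + T * κ) + 0 ≡ T * (4 * m) + (4 * (2 * (T * κ)) + 8 * κ)
      shape = solve-∀
    6le≤κ : 6 * (l * e) ≤ κ
    6le≤κ = *-cancelˡ-≤ 2 (begin
      2 * (6 * (l * e))     ≡⟨ shape l e ⟩
      12 * l * e            ≡⟨ cong (_* e) (sym T≡) ⟩
      T * e                 ≤⟨ outside≤ ⟩
      2 * κ                 ∎)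
      where
      shape : ∀ l e → 2 * (6 * (l * e)) ≡ 12 * l * e
      shape = solve-∀
    -- The progression has ν + 1 terms: 2g ≤ m pays for the extra one, and T = 12l ≥ 12g keeps the
    -- error 8gm/T below m.
    short : 2 * (g * suc ν) ≤ (g + 2) * m
    short = *-cancelˡ-≤ T (≤-from (4 * (l * m) + 8 * (m * r)) (shape T)
      (g ⊛ length≤ ⊹ T ⊛ 2g≤m ⊹ ≤-reflexive (sym (trans (cong (_* m) T≡) refl))))
      where
      r = l ∸ g
      l≡g+r : l ≡ g + r
      l≡g+r = sym (m+[n∸m]≡n g≤l)
      shape : ∀ T → T * (2 * (g * suc ν)) + (g * ((T + 8) * m) + T * m + T * m) + (4 * (l * m) + 8 * (m * r))
        ≡ T * ((g + 2) * m) + (g * (2 * (T * ν)) + T * (2 * g) + 12 * l * m)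
      shape T = trans (cong (λ x → T * (2 * (g * suc ν)) + (g * ((T + 8) * m) + T * m + T * m) + (4 * (x * m) + 8 * (m * r))) l≡g+r)
        (trans (identity T g ν m r) (cong (λ x → T * ((g + 2) * m) + (g * (2 * (T * ν)) + T * (2 * g) + 12 * x * m)) (sym l≡g+r)))
        where
        identity : ∀ T g ν m r →
          T * (2 * (g * (1 + ν))) + (g * ((T + 8) * m) + T * m + T * m) + (4 * ((g + r) * m) + 8 * (m * r))
          ≡ T * ((g + 2) * m) + (g * (2 * (T * ν)) + T * (2 * g) + 12 * (g + r) * m)
        identity = solve-∀
    good : ∀ (A : Subset n) → g * # n (λ i → at A i ∧ not (P i)) ≤ s → Good g m s A
    good A o = a , d , suc ν , 1≤d , short , o
    -- If m < 4s, then C itself has at most s/g elements off P and nothing is marked. If 4s ≤ m,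
    -- there is room for the summand s in `W+s≤`, which `bin-double` requires.
    cases : (4 * s ≤ᵇ m) ≡ true ⊎ (4 * s ≤ᵇ m) ≡ false → Treatment (C , D)
    cases (inj₂ f) = (λ _ → false) , ≤-trans (≤-reflexive (trans (cong (2 ^ w *_) (count-false (allSubsets n))) (*-zeroʳ (2 ^ w)))) z≤n
      , λ A _ A⊆C _ _ _ → good A (begin
        g * # n (λ i → at A i ∧ not (P i))    ≤⟨ g ⊛ #-mono n (λ i _ t → both A A⊆C i t) ⟩
        g * e                                 ≤⟨ *-monoˡ-≤ e g≤l ⟩
        l * e                                 ≤⟨ *-cancelˡ-≤ 42 (≤-from (26 * s + 4) (shape (l * e) κ m s)
                                                   (7 ⊛ 6le≤κ ⊹ 7κ≤4m ⊹ 4 ⊛ false-≤ᵇ {4 * s} f)) ⟩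
        s                                     ∎)
      where
      shape : ∀ x κ m s → 42 * x + (7 * κ + 4 * m + 4 * (4 * s)) + (26 * s + 4) ≡ 42 * s + (7 * (6 * x) + 7 * κ + 4 * (1 + m))
      shape = solve-∀
      both : ∀ A → at A ⊆ C → ∀ i → at A i ∧ not (P i) ≡ true → C i ∧ not (P i) ≡ true
      both A A⊆C i t = true-∧ (A⊆C i (proj₁ (∧-true {at A i} t))) (proj₂ (∧-true {at A i} t))
    cases (inj₁ t) = p , bound , λ A #A A⊆C _ _ f → good A (few A #A A⊆C f)
      where
      wP : ℕ → ℕ
      wP i = if C i then (if P i then 1 else l) else 0
      p : Subset n → Bool
      p A = (# n (at A) ≡ᵇ s) ∧ (8 ^ s ≤ᵇ wt wP A)
      p-elim : ∀ A → p A ≡ true → # n (at A) ≡ s × 8 ^ s ≤ wt wP A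
      p-elim A e = ≡ᵇ-true _ s (proj₁ (∧-true {# n (at A) ≡ᵇ s} e)) , true-≤ᵇ {8 ^ s} (proj₂ (∧-true {# n (at A) ≡ᵇ s} e))
      few : ∀ A → # n (at A) ≡ s → at A ⊆ C → p A ≡ false → g * # n (λ i → at A i ∧ not (P i)) ≤ s
      few A #A A⊆C f = ≮⇒≥ λ s<ge → true≢false (trans (sym (true-∧ (trans (cong (_≡ᵇ s) #A) (≡ᵇ-refl s))
        (≤ᵇ-true (begin
          8 ^ s                                            ≤⟨ ^-monoʳ-≤ 8 (<⇒≤ s<ge) ⟩
          8 ^ (g * # n (λ i → at A i ∧ not (P i)))         ≡⟨ sym (^-*-assoc 8 g _) ⟩
          (8 ^ g) ^ # n (λ i → at A i ∧ not (P i))         ≡⟨ cong (_^ # n (λ i → at A i ∧ not (P i))) (sym l≡) ⟩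
          l ^ # n (λ i → at A i ∧ not (P i))               ≡⟨ sym (wt-inside A l wP P (λ i e → cong (λ c → if c then (if P i then 1 else l) else 0) (A⊆C i e))) ⟩
          wt wP A                                          ∎)))) f)
      W = ∑ n wP
      W≤ : W ≤ κ + l * e
      W≤ = ≤-trans (∑-mono n (λ i _ → each (C i) (P i)))
        (≤-reflexive (trans (∑-+ n _ _) (cong (κ +_) (∑-* n l _))))
        where
        each : ∀ c p → (if c then (if p then 1 else l) else 0) ≤ ⟦ c ⟧ + l * ⟦ c ∧ not p ⟧
        each true true = s≤s z≤n
        each true false = ≤-trans (≤-reflexive (sym (*-identityʳ l))) (m≤n+m (l * 1) 1)
        each false p = z≤n
      -- W is at most 7κ/6 ≤ 2m/3, and s is at most m/4.
      W+s≤ : W + s ≤ v + v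
      W+s≤ = ≤-trans (*-cancelˡ-≤ 12 (≤-from m (shape W s κ (l * e) m) (12 ⊛ W≤ ⊹ 2 ⊛ 6le≤κ ⊹ 2 ⊛ 7κ≤4m ⊹ 3 ⊛ true-≤ᵇ {4 * s} t))) m≤2v
        where
        shape : ∀ W s κ x m → 12 * (W + s) + (12 * (κ + x) + 2 * κ + 2 * (4 * m) + 3 * m) + m
          ≡ 12 * m + (12 * W + 2 * (6 * x) + 2 * (7 * κ) + 3 * (4 * s))
        shape = solve-∀
      -- Of the weight 8^s, a factor 2^s is spent on `bin-double` and the remaining 4^s exceeds 2^w.
      bound : 2 ^ w * count p (allSubsets n) ≤ bin v s
      bound = *-cancelˡ-≤ (2 ^ s) {{m^n≢0 2 s}} (begin
        2 ^ s * (2 ^ w * c)         ≤⟨ 2 ^ s ⊛ *-monoˡ-≤ c (≤-trans (^-monoʳ-≤ 2 w≤s) (^-monoˡ-≤ s (m≤m+n 2 2))) ⟩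
        2 ^ s * (4 ^ s * c)         ≡⟨ sym (*-assoc (2 ^ s) (4 ^ s) c) ⟩
        2 ^ s * 4 ^ s * c           ≡⟨ cong (_* c) (sym (^-distrib-* s 2 4)) ⟩
        8 ^ s * c                   ≤⟨ weighted-count n s (8 ^ s) wP p p-elim ⟩
        bin W s                     ≤⟨ bin-double W v s W+s≤ ⟩
        2 ^ s * bin v s             ∎)
        where
        c = count p (allSubsets n)

  -- The enumeration also contains states at which the process would go on, or which no A of the
  -- family produces; nothing is marked there.
  treat-none : ∀ C D → ¬ (Final (C , D) × # (n + n) D ≤ m) → Treatment (C , D)
  treat-none C D never = (λ _ → false)
    , ≤-trans (≤-reflexive (trans (cong (2 ^ w *_) (count-false (allSubsets n))) (*-zeroʳ (2 ^ w)))) z≤n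
    , λ _ _ _ D≤m final _ → ⊥-elim (never (final , D≤m))

  treat-thick : ∀ C D → thin (# n C) ≡ false → E * misses n C D ≤ 2 * (# n C * # n C) → # (n + n) D ≤ m →
    Treatment (C , D)
  treat-thick C D notThin closed D≤m =
    let a , d , ν , 1≤d , length≤ , κ≤ , outside = stability n C D m T 8≤T
          (≤-trans (≤-reflexive (sym F≡)) (*-cancelˡ-≤ 4 (≤-trans 4F≤m (thick (# n C) notThin)))) D≤m
          (subst (λ f → f * m ≤ (2 * f + 2) * # n C) F≡ (dense (# n C) notThin))
          (subst (λ f → f * f * misses n C D ≤ # n C * # n C) F≡ FFclosed)
    in treat-progression C D a d ν 1≤d length≤ κ≤
         (outside (prog a d (suc ν)) (λ j j≤ν → prog-true a d (suc ν) j (s≤s j≤ν)))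
    where
    FFclosed : F * F * misses n C D ≤ # n C * # n C
    FFclosed = *-cancelˡ-≤ 2 (≤-trans (≤-reflexive (trans (sym (*-assoc 2 (F * F) (misses n C D)))
      (cong (_* misses n C D) (sym E≡)))) closed)

  treat : ∀ st → Treatment st
  treat (C , D) = cases (by-cases (thin (# n C)))
    (by-cases (E * misses n C D ≤ᵇ 2 * (# n C * # n C))) (by-cases (# (n + n) D ≤ᵇ m))
    where
    cases : thin (# n C) ≡ true ⊎ thin (# n C) ≡ false →
      (E * misses n C D ≤ᵇ 2 * (# n C * # n C)) ≡ true ⊎ (E * misses n C D ≤ᵇ 2 * (# n C * # n C)) ≡ false →
      (# (n + n) D ≤ᵇ m) ≡ true ⊎ (# (n + n) D ≤ᵇ m) ≡ false → Treatment (C , D)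
    cases (inj₁ t) _ _ = treat-thin C D t
    cases (inj₂ f) (inj₁ c) (inj₁ D≤m) = treat-thick C D f (true-≤ᵇ c) (true-≤ᵇ D≤m)
    cases (inj₂ f) (inj₁ c) (inj₂ D≰m) = treat-none C D λ (_ , D≤m) → <⇒≱ (false-≤ᵇ D≰m) D≤m
    cases (inj₂ f) (inj₂ c) _ = treat-none C D λ
      { (inj₁ t , _) → true≢false (trans (sym t) f)
      ; (inj₂ closed , _) → <⇒≱ (false-≤ᵇ {E * misses n C D} c) closed }

  few-bad : ∀ θ → 1 ≤ θ → m ≤ θ * θ → 2 * E * (2 * E * θ) ≤ s → g * length (containers n θ E) ≤ 2 ^ w →
    ∃ λ (bad : Subset n → Bool) → g * count bad (allSubsets n) ≤ bin v s
      × (∀ A → A ∈ family n s m → bad A ≡ false → Good g m s A)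
  few-bad θ 1≤θ m≤θ² 4E²θ≤s number = bad , bound , good
    where
    open ≤-Reasoning
    cs = containers n θ E
    bad : Subset n → Bool
    bad A = any (λ st → proj₁ (treat st) A) cs
    c = count bad (allSubsets n)
    bound : g * c ≤ bin v s
    bound = *-cancelˡ-≤ (2 ^ w) {{m^n≢0 2 w}} (begin
      2 ^ w * (g * c)                ≡⟨ shape (2 ^ w) g c ⟩
      g * (2 ^ w * c)                ≤⟨ g ⊛ count-any (2 ^ w) (bin v s) (λ st → proj₁ (treat st)) cs (allSubsets n)
                                          (λ st → proj₁ (proj₂ (treat st))) ⟩
      g * (length cs * bin v s)      ≡⟨ sym (*-assoc g (length cs) (bin v s)) ⟩
      g * length cs * bin v s        ≤⟨ *-monoˡ-≤ (bin v s) number ⟩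
      2 ^ w * bin v s                ∎)
      where
      shape : ∀ a b c → a * (b * c) ≡ b * (a * c)
      shape = solve-∀
    1≤E : 1 ≤ E
    1≤E = ≤-trans (≤-trans (s≤s z≤n) (2 ⊛ *-mono-≤ 1≤F 1≤F)) (≤-reflexive (sym E≡))
    good : ∀ A → A ∈ family n s m → bad A ≡ false → Good g m s A
    good A A∈ f =
      let #A , S≤m = family-elim n s m A A∈
          (C , D) , st∈ , (A⊆C , D⊆S) , final = Containers.container n m θ E (at A) (sumset A) (sumset-sums A) S≤m
            (at-< A) 1≤E 1≤θ m≤θ² (subst (1 ≤_) (sym #A) 1≤s) (subst (2 * E * (2 * E * θ) ≤_) (sym #A) 4E²θ≤s) thin thick
      in proj₂ (proj₂ (treat (C , D))) A #A A⊆C (≤-trans (#-mono (n + n) (λ d _ → D⊆S d)) S≤m) final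
           (any-false (λ st → proj₁ (treat st) A) cs f st∈)

-- Rational inequalities with natural coefficients

toℚᵘ-ℕ→ℚ : ∀ k → ℚ.toℚᵘ (ℕ→ℚ k) ℚᵘ.≃ mkℚᵘ (ℤ.+ k) 0
toℚᵘ-ℕ→ℚ k = ℚ.toℚᵘ-fromℚᵘ (mkℚᵘ (ℤ.+ k) 0)

ℕ→ℚ-* : ∀ a b → ℕ→ℚ (a * b) ≡ ℕ→ℚ a ℚ.* ℕ→ℚ b
ℕ→ℚ-* a b = ℚ.toℚᵘ-injective (begin
  ℚ.toℚᵘ (ℕ→ℚ (a * b))                    ≈⟨ toℚᵘ-ℕ→ℚ (a * b) ⟩
  mkℚᵘ (ℤ.+ (a * b)) 0                    ≈⟨ *≡* (cong (ℤ._* ℤ.1ℤ) (ℤ.pos-* a b)) ⟩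
  mkℚᵘ (ℤ.+ a) 0 ℚᵘ.* mkℚᵘ (ℤ.+ b) 0        ≈⟨ ℚᵘ.≃-sym (ℚᵘ.*-cong (toℚᵘ-ℕ→ℚ a) (toℚᵘ-ℕ→ℚ b)) ⟩
  ℚ.toℚᵘ (ℕ→ℚ a) ℚᵘ.* ℚ.toℚᵘ (ℕ→ℚ b)        ≈⟨ ℚᵘ.≃-sym (ℚ.toℚᵘ-homo-* (ℕ→ℚ a) (ℕ→ℚ b)) ⟩
  ℚ.toℚᵘ (ℕ→ℚ a ℚ.* ℕ→ℚ b)                  ∎)
  where open import Relation.Binary.Reasoning.Setoid ℚᵘ.≃-setoid

ℕ→ℚ-+ : ∀ a b → ℕ→ℚ (a + b) ≡ ℕ→ℚ a ℚ.+ ℕ→ℚ b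
ℕ→ℚ-+ a b = ℚ.toℚᵘ-injective (begin
  ℚ.toℚᵘ (ℕ→ℚ (a + b))                    ≈⟨ toℚᵘ-ℕ→ℚ (a + b) ⟩
  mkℚᵘ (ℤ.+ (a + b)) 0                    ≈⟨ *≡* (cong (ℤ._* ℤ.1ℤ) (sym (cong₂ ℤ._+_ (ℤ.*-identityʳ (ℤ.+ a)) (ℤ.*-identityʳ (ℤ.+ b))))) ⟩
  mkℚᵘ (ℤ.+ a) 0 ℚᵘ.+ mkℚᵘ (ℤ.+ b) 0        ≈⟨ ℚᵘ.≃-sym (ℚᵘ.+-cong (toℚᵘ-ℕ→ℚ a) (toℚᵘ-ℕ→ℚ b)) ⟩
  ℚ.toℚᵘ (ℕ→ℚ a) ℚᵘ.+ ℚ.toℚᵘ (ℕ→ℚ b)        ≈⟨ ℚᵘ.≃-sym (ℚ.toℚᵘ-homo-+ (ℕ→ℚ a) (ℕ→ℚ b)) ⟩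
  ℚ.toℚᵘ (ℕ→ℚ a ℚ.+ ℕ→ℚ b)                  ∎)
  where open import Relation.Binary.Reasoning.Setoid ℚᵘ.≃-setoid

ℕ→ℚ-mono : ∀ {a b} → a ≤ b → ℕ→ℚ a ℚ.≤ ℕ→ℚ b
ℕ→ℚ-mono {a} {b} a≤b = ℚ.toℚᵘ-cancel-≤ (begin
  ℚ.toℚᵘ (ℕ→ℚ a)      ≃⟨ toℚᵘ-ℕ→ℚ a ⟩
  mkℚᵘ (ℤ.+ a) 0      ≤⟨ *≤* (ℤ.*-monoʳ-≤-nonNeg ℤ.1ℤ (ℤ.+≤+ a≤b)) ⟩
  mkℚᵘ (ℤ.+ b) 0      ≃⟨ ℚᵘ.≃-sym (toℚᵘ-ℕ→ℚ b) ⟩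
  ℚ.toℚᵘ (ℕ→ℚ b)      ∎)
  where open ℚᵘ.≤-Reasoning

ℕ→ℚ-cancel : ∀ {a b} → ℕ→ℚ a ℚ.≤ ℕ→ℚ b → a ≤ b
ℕ→ℚ-cancel {a} {b} l = cancel (begin
  mkℚᵘ (ℤ.+ a) 0      ≃⟨ ℚᵘ.≃-sym (toℚᵘ-ℕ→ℚ a) ⟩
  ℚ.toℚᵘ (ℕ→ℚ a)      ≤⟨ ℚ.toℚᵘ-mono-≤ l ⟩
  ℚ.toℚᵘ (ℕ→ℚ b)      ≃⟨ toℚᵘ-ℕ→ℚ b ⟩
  mkℚᵘ (ℤ.+ b) 0      ∎)
  where
  open ℚᵘ.≤-Reasoning
  cancel : mkℚᵘ (ℤ.+ a) 0 ℚᵘ.≤ mkℚᵘ (ℤ.+ b) 0 → a ≤ b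
  cancel (*≤* l) = ℤ.drop‿+≤+ (subst₂ ℤ._≤_ (ℤ.*-identityʳ (ℤ.+ a)) (ℤ.*-identityʳ (ℤ.+ b)) l)

inv : ℕ → ℚ
inv K = (ℤ.+ 1) ℚ./ suc K

toℚᵘ-inv : ∀ K → ℚ.toℚᵘ (inv K) ℚᵘ.≃ mkℚᵘ (ℤ.+ 1) K
toℚᵘ-inv K = ℚ.toℚᵘ-fromℚᵘ (mkℚᵘ (ℤ.+ 1) K)

inv-* : ∀ K → inv K ℚ.* ℕ→ℚ (suc K) ≡ 1ℚ
inv-* K = ℚ.toℚᵘ-injective (begin
  ℚ.toℚᵘ (inv K ℚ.* ℕ→ℚ (suc K))                ≈⟨ ℚ.toℚᵘ-homo-* (inv K) (ℕ→ℚ (suc K)) ⟩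
  ℚ.toℚᵘ (inv K) ℚᵘ.* ℚ.toℚᵘ (ℕ→ℚ (suc K))      ≈⟨ ℚᵘ.*-cong (toℚᵘ-inv K) (toℚᵘ-ℕ→ℚ (suc K)) ⟩
  mkℚᵘ (ℤ.+ 1) K ℚᵘ.* mkℚᵘ (ℤ.+ suc K) 0        ≈⟨ *≡* (cong ℤ.+_ (shape K)) ⟩
  ℚ.toℚᵘ 1ℚ                                     ∎)
  where
  open import Relation.Binary.Reasoning.Setoid ℚᵘ.≃-setoid
  shape : ∀ K → (suc K + 0) * 1 ≡ suc K * 1 + 0
  shape = solve-∀

0<inv : ∀ K → 0ℚ ℚ.< inv K
0<inv K = ℚ.positive⁻¹ (inv K) {{ℚ.normalize-pos 1 (suc K)}}

0≤inv : ∀ K → 0ℚ ℚ.≤ inv K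
0≤inv K = ℚ.<⇒≤ (0<inv K)

∣inv∣ : ∀ K → ℚ.∣ inv K ∣ ≡ inv K
∣inv∣ K = ℚ.0≤p⇒∣p∣≡p (0≤inv K)

inv-anti : ∀ {K L} → K ≤ L → inv L ℚ.≤ inv K
inv-anti {K} {L} K≤L = ℚ.toℚᵘ-cancel-≤ (begin
  ℚ.toℚᵘ (inv L)      ≃⟨ toℚᵘ-inv L ⟩
  mkℚᵘ (ℤ.+ 1) L      ≤⟨ *≤* (ℤ.*-monoˡ-≤-nonNeg ℤ.1ℤ (ℤ.+≤+ (s≤s K≤L))) ⟩
  mkℚᵘ (ℤ.+ 1) K      ≃⟨ ℚᵘ.≃-sym (toℚᵘ-inv K) ⟩
  ℚ.toℚᵘ (inv K)      ∎)
  where open ℚᵘ.≤-Reasoning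

inv-below : ∀ ε → 0ℚ ℚ.< ε → ∃ λ K → inv K ℚ.≤ ε
inv-below (mkℚ (ℤ.+_ zero) K _) (ℚ.*<* (ℤ.+<+ ()))
-- A positive numerator is at least 1, so the denominator of ε itself serves.
inv-below ε@(mkℚ (ℤ.+_ (suc p)) K _) _ = K , ℚ.toℚᵘ-cancel-≤ (begin
  ℚ.toℚᵘ (inv K)             ≃⟨ toℚᵘ-inv K ⟩
  mkℚᵘ (ℤ.+ 1) K             ≤⟨ *≤* (ℤ.*-monoʳ-≤-nonNeg (ℤ.+ suc K) (ℤ.+≤+ (s≤s (z≤n {p})))) ⟩
  mkℚᵘ (ℤ.+ suc p) K         ∎)
  where open ℚᵘ.≤-Reasoning
inv-below (mkℚ ℤ.-[1+ p ] K _) (ℚ.*<* ())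

positive-suc : ∀ K → ℚ.Positive (ℕ→ℚ (suc K))
positive-suc K = ℚ.normalize-pos (suc K) 1

≤-inv : ∀ K a b → suc K * a ≤ b → ℕ→ℚ a ℚ.≤ inv K ℚ.* ℕ→ℚ b
≤-inv K a b l = ℚ.*-cancelʳ-≤-pos (ℕ→ℚ (suc K)) {{positive-suc K}} (begin
  ℕ→ℚ a ℚ.* ℕ→ℚ (suc K)                ≡⟨ trans (sym (ℕ→ℚ-* a (suc K))) (cong ℕ→ℚ (*-comm a (suc K))) ⟩
  ℕ→ℚ (suc K * a)                    ≤⟨ ℕ→ℚ-mono l ⟩
  ℕ→ℚ b                                ≡⟨ sym (ℚ.*-identityˡ (ℕ→ℚ b)) ⟩
  1ℚ ℚ.* ℕ→ℚ b                         ≡⟨ cong (ℚ._* ℕ→ℚ b) (sym (inv-* K)) ⟩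
  inv K ℚ.* ℕ→ℚ (suc K) ℚ.* ℕ→ℚ b      ≡⟨ swap (inv K) (ℕ→ℚ (suc K)) (ℕ→ℚ b) ⟩
  inv K ℚ.* ℕ→ℚ b ℚ.* ℕ→ℚ (suc K)      ∎)
  where
  open ℚ.≤-Reasoning
  open +-*-Solver
  swap : ∀ a b c → a ℚ.* b ℚ.* c ≡ a ℚ.* c ℚ.* b
  swap = solve 3 (λ a b c → a :* b :* c := a :* c :* b) refl

inv-≤ : ∀ K a b → ℕ→ℚ a ℚ.≤ inv K ℚ.* ℕ→ℚ b → suc K * a ≤ b
inv-≤ K a b l = ℕ→ℚ-cancel (begin
  ℕ→ℚ (suc K * a)                              ≡⟨ ℕ→ℚ-* (suc K) a ⟩
  ℕ→ℚ (suc K) ℚ.* ℕ→ℚ a                          ≤⟨ ℚ.*-monoˡ-≤-nonNeg (ℕ→ℚ (suc K)) {{ℚ.pos⇒nonNeg (ℕ→ℚ (suc K)) {{positive-suc K}}}} l ⟩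
  ℕ→ℚ (suc K) ℚ.* (inv K ℚ.* ℕ→ℚ b)              ≡⟨ swap (inv K) (ℕ→ℚ (suc K)) (ℕ→ℚ b) ⟩
  inv K ℚ.* ℕ→ℚ (suc K) ℚ.* ℕ→ℚ b                ≡⟨ cong (ℚ._* ℕ→ℚ b) (inv-* K) ⟩
  1ℚ ℚ.* ℕ→ℚ b                                   ≡⟨ ℚ.*-identityˡ (ℕ→ℚ b) ⟩
  ℕ→ℚ b                                          ∎)
  where
  open ℚ.≤-Reasoning
  open +-*-Solver
  swap : ∀ a b c → b ℚ.* (a ℚ.* c) ≡ a ℚ.* b ℚ.* c
  swap = solve 3 (λ a b c → b :* (a :* c) := a :* b :* c) refl

½-* : ½ ℚ.* ℕ→ℚ 2 ≡ 1ℚ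
½-* = refl

half+inv : ∀ K k m → 2 * (suc K * k) ≤ (suc K + 2) * m →
  ℕ→ℚ k ℚ.≤ ½ ℚ.* ℕ→ℚ m ℚ.+ inv K ℚ.* ℕ→ℚ m
half+inv K k m l = ℚ.*-cancelˡ-≤-pos (ℕ→ℚ 2) (ℚ.*-cancelˡ-≤-pos G {{positive-suc K}} (begin
  G ℚ.* (ℕ→ℚ 2 ℚ.* ℕ→ℚ k)
    ≡⟨ swap G (ℕ→ℚ 2) (ℕ→ℚ k) ⟩
  ℕ→ℚ 2 ℚ.* (G ℚ.* ℕ→ℚ k)
    ≡⟨ sym (trans (ℕ→ℚ-* 2 (suc K * k)) (cong (ℕ→ℚ 2 ℚ.*_) (ℕ→ℚ-* (suc K) k))) ⟩
  ℕ→ℚ (2 * (suc K * k))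
    ≤⟨ ℕ→ℚ-mono l ⟩
  ℕ→ℚ ((suc K + 2) * m)
    ≡⟨ trans (ℕ→ℚ-* (suc K + 2) m) (cong (ℚ._* M) (ℕ→ℚ-+ (suc K) 2)) ⟩
  (G ℚ.+ ℕ→ℚ 2) ℚ.* M
    ≡⟨ units G (ℕ→ℚ 2) M ⟩
  1ℚ ℚ.* G ℚ.* M ℚ.+ 1ℚ ℚ.* ℕ→ℚ 2 ℚ.* M
    ≡⟨ cong₂ (λ x y → x ℚ.* G ℚ.* M ℚ.+ y ℚ.* ℕ→ℚ 2 ℚ.* M) (sym ½-*) (sym (inv-* K)) ⟩
  ½ ℚ.* ℕ→ℚ 2 ℚ.* G ℚ.* M ℚ.+ inv K ℚ.* G ℚ.* ℕ→ℚ 2 ℚ.* M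
    ≡⟨ collect ½ (inv K) G (ℕ→ℚ 2) M ⟩
  G ℚ.* (ℕ→ℚ 2 ℚ.* (½ ℚ.* M ℚ.+ inv K ℚ.* M)) ∎))
  where
  open ℚ.≤-Reasoning
  open +-*-Solver
  G = ℕ→ℚ (suc K)
  M = ℕ→ℚ m
  swap : ∀ a b c → a ℚ.* (b ℚ.* c) ≡ b ℚ.* (a ℚ.* c)
  swap = solve 3 (λ a b c → a :* (b :* c) := b :* (a :* c)) refl
  units : ∀ g t m → (g ℚ.+ t) ℚ.* m ≡ 1ℚ ℚ.* g ℚ.* m ℚ.+ 1ℚ ℚ.* t ℚ.* m
  units = solve 3 (λ g t m → (g :+ t) :* m := con 1ℚ :* g :* m :+ con 1ℚ :* t :* m) refl
  collect : ∀ h i g t m → h ℚ.* t ℚ.* g ℚ.* m ℚ.+ i ℚ.* g ℚ.* t ℚ.* m ≡ g ℚ.* (t ℚ.* (h ℚ.* m ℚ.+ i ℚ.* m))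
  collect = solve 5 (λ h i g t m → h :* t :* g :* m :+ i :* g :* t :* m := g :* (t :* (h :* m :+ i :* m))) refl

complement-≤ : ∀ K ε N b G → inv K ℚ.≤ ε → N ≤ G + b → suc K * b ≤ N →
  (1ℚ ℚ.- ε) ℚ.* ℕ→ℚ N ℚ.≤ ℕ→ℚ G
complement-≤ K ε N b G inv≤ε N≤ b≤ = begin
  (1ℚ ℚ.- ε) ℚ.* ℕ→ℚ N                              ≡⟨ expand ε (ℕ→ℚ N) ⟩
  ℕ→ℚ N ℚ.+ ℚ.- (ε ℚ.* ℕ→ℚ N)                       ≤⟨ ℚ.+-monoˡ-≤ (ℚ.- (ε ℚ.* ℕ→ℚ N)) bound ⟩
  ℕ→ℚ G ℚ.+ ε ℚ.* ℕ→ℚ N ℚ.+ ℚ.- (ε ℚ.* ℕ→ℚ N)       ≡⟨ cancel (ℕ→ℚ G) (ε ℚ.* ℕ→ℚ N) ⟩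
  ℕ→ℚ G                                             ∎
  where
  open ℚ.≤-Reasoning
  open +-*-Solver
  expand : ∀ e n → (1ℚ ℚ.- e) ℚ.* n ≡ n ℚ.+ ℚ.- (e ℚ.* n)
  expand = solve 2 (λ e n → (con 1ℚ :- e) :* n := n :+ :- (e :* n)) refl
  cancel : ∀ g x → g ℚ.+ x ℚ.+ ℚ.- x ≡ g
  cancel = solve 2 (λ g x → g :+ x :+ :- x := g) refl
  bound : ℕ→ℚ N ℚ.≤ ℕ→ℚ G ℚ.+ ε ℚ.* ℕ→ℚ N
  bound = begin
    ℕ→ℚ N                              ≤⟨ ℕ→ℚ-mono N≤ ⟩
    ℕ→ℚ (G + b)                      ≡⟨ ℕ→ℚ-+ G b ⟩
    ℕ→ℚ G ℚ.+ ℕ→ℚ b                    ≤⟨ ℚ.+-monoʳ-≤ (ℕ→ℚ G) (≤-inv K b N b≤) ⟩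
    ℕ→ℚ G ℚ.+ inv K ℚ.* ℕ→ℚ N          ≤⟨ ℚ.+-monoʳ-≤ (ℕ→ℚ G) (ℚ.*-monoʳ-≤-nonNeg (ℕ→ℚ N) {{nonNegative-ℕ→ℚ}} inv≤ε) ⟩
    ℕ→ℚ G ℚ.+ ε ℚ.* ℕ→ℚ N              ∎
    where
    nonNegative-ℕ→ℚ : ℚ.NonNegative (ℕ→ℚ N)
    nonNegative-ℕ→ℚ = ℚ.normalize-nonNeg N 1

-- From counting bad sets to probabilities.

allSubsets-unique : ∀ n → Unique (allSubsets n)
allSubsets-unique zero = [] ∷ []
allSubsets-unique (suc n) = Unique.++⁺
  (Unique.map⁺ Vec.∷-injectiveʳ (allSubsets-unique n)) (Unique.map⁺ Vec.∷-injectiveʳ (allSubsets-unique n))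
  λ (x∈ , y∈) → heads (∈-map⁻ (false ∷_) x∈) (∈-map⁻ (true ∷_) y∈)
  where
  heads : ∀ {v} → (∃ λ A → A ∈ allSubsets n × v ≡ false ∷ A) → (∃ λ A → A ∈ allSubsets n × v ≡ true ∷ A) → ⊥
  heads (_ , _ , refl) (_ , _ , ())

∈-filterᵇ⁻ : ∀ {A : Set} (p : A → Bool) {x} xs → x ∈ filterᵇ p xs → x ∈ xs
∈-filterᵇ⁻ p (y ∷ xs) x∈ with p y
∈-filterᵇ⁻ p (y ∷ xs) (here e) | true = here e
∈-filterᵇ⁻ p (y ∷ xs) (there x∈) | true = there (∈-filterᵇ⁻ p xs x∈)
∈-filterᵇ⁻ p (y ∷ xs) x∈ | false = there (∈-filterᵇ⁻ p xs x∈)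

length-complement : ∀ {A : Set} (p : A → Bool) xs → length xs ≤ count (not ∘ p) xs + count p xs
length-complement p [] = z≤n
length-complement p (x ∷ xs) with p x
... | true = ≤-trans (s≤s (length-complement p xs)) (≤-reflexive (sym (+-suc _ _)))
... | false = s≤s (length-complement p xs)

count-filterᵇ : ∀ {A : Set} (p q : A → Bool) xs → count p (filterᵇ q xs) ≤ count p xs
count-filterᵇ p q [] = z≤n
count-filterᵇ p q (x ∷ xs) with q x
count-filterᵇ p q (x ∷ xs) | true with p x
... | true = s≤s (count-filterᵇ p q xs)
... | false = count-filterᵇ p q xs
count-filterᵇ p q (x ∷ xs) | false with p x
... | true = m≤n⇒m≤1+n (count-filterᵇ p q xs)
... | false = count-filterᵇ p q xs

member : ∀ {A : Set} (xs : List A) → 0 < length xs → ∃ λ x → x ∈ xs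
member (x ∷ xs) _ = x , here refl

halve : ∀ m → ∃ λ v → m ≤ v + v × v + v ≤ suc m
halve zero = 0 , z≤n , z≤n
halve (suc zero) = 1 , s≤s z≤n , ≤-refl
halve (suc (suc m)) with v , l , u ← halve m =
  suc v , ≤-trans (s≤s (s≤s l)) (≤-reflexive (cong suc (sym (+-suc v v))))
        , ≤-trans (≤-reflexive (cong suc (+-suc v v))) (s≤s (s≤s u))

n<2^1+log : ∀ n → n < 2 ^ suc ⌊log₂ n ⌋
n<2^1+log n = ≰⇒> λ l → <-irrefl refl
  (≤-trans (≤-reflexive (sym (⌊log₂[2^n]⌋≡n (suc ⌊log₂ n ⌋)))) (⌊log₂⌋-mono-≤ l))

Good⇒GoodAP : ∀ {n} K m s (A : Subset n) → Good (suc K) m s A → GoodAP m s (inv K) A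
Good⇒GoodAP {n} K m s A (a , d , k , 1≤d , short , few) =
  ℤ.+ suc a , ℤ.+ d , k , ℤ.+≤+ 1≤d , half+inv K k m short
  , ≤-inv K (outsideAP A (ℤ.+ suc a) (ℤ.+ d) k) s (≤-trans (≤-reflexive (cong (suc K *_)
      (countFin-# n _ (λ i → at A i ∧ not (prog a d k i)) (λ i → cong (_∧ not (prog a d k _)) (lookup-at A i))))) few)

-- For the range in which an interval of length m/2 does not fit into {1, ..., n}: then {1, ..., n}
-- itself can serve as P.
Good-interval : ∀ {n} g m s (A : Subset n) → n + n ≤ m → Good g m s A
Good-interval {n} g m s A 2n≤m = 0 , 1 , n , ≤-refl
  , ≤-from (2 * m) (shape g n m) (g ⊛ 2n≤m)
  , ≤-trans (≤-reflexive (trans (cong (g *_) (∑-zero n λ i i<n → ∧-not-true (at A i)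
      (trans (cong (prog 0 1 n) (sym (*-identityʳ i))) (prog-true 0 1 n i i<n)))) (*-zeroʳ g))) z≤n
  where
  shape : ∀ g n m → 2 * (g * n) + g * m + 2 * m ≡ (g + 2) * m + g * (n + n)
  shape = solve-∀

-- Since s ≤ m, the hypothesis also yields 4M²YL² ≤ s. So s/(ML) is at least 1, and rounding it down
-- to θ loses at most a factor 2, which the 4 compensates in θ² ≥ m.
scale : ∀ M L Y s m → 1 ≤ M → 1 ≤ L → 1 ≤ Y → 1 ≤ s → s ≤ m → 4 * (M * M) * Y * (m * (L * L)) ≤ s * s →
  ∃ λ θ → 1 ≤ θ × M * L * θ ≤ s × m ≤ θ * θ × Y ≤ s
scale M L Y s m 1≤M 1≤L 1≤Y 1≤s s≤m hyp = θ , 1≤θ , MLθ≤s , m≤θ² , Y≤s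
  where
  open ≤-Reasoning
  instance
    nonZero-s : NonZero s
    nonZero-s = >-nonZero 1≤s
    nonZero-M : NonZero M
    nonZero-M = >-nonZero 1≤M
    nonZero-L : NonZero L
    nonZero-L = >-nonZero 1≤L
    nonZero-Y : NonZero Y
    nonZero-Y = >-nonZero 1≤Y
    nonZero-ML : NonZero (M * L)
    nonZero-ML = m*n≢0 M L
  4M²YL²≤s : 4 * (M * M) * Y * (L * L) ≤ s
  4M²YL²≤s = *-cancelˡ-≤ s (begin
    s * (4 * (M * M) * Y * (L * L))      ≡⟨ shape s M Y L ⟩
    4 * (M * M) * Y * (s * (L * L))      ≤⟨ 4 * (M * M) * Y ⊛ *-monoˡ-≤ (L * L) s≤m ⟩
    4 * (M * M) * Y * (m * (L * L))      ≤⟨ hyp ⟩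
    s * s                                ∎)
    where
    shape : ∀ s M Y L → s * (4 * (M * M) * Y * (L * L)) ≡ 4 * (M * M) * Y * (s * (L * L))
    shape = solve-∀
  ML≤s : M * L ≤ s
  ML≤s = begin
    M * L                          ≤⟨ m≤n*m (M * L) (4 * M * Y * L) {{m*n≢0 (4 * M * Y) L {{m*n≢0 (4 * M) Y {{m*n≢0 4 M}}}}}} ⟩
    4 * M * Y * L * (M * L)        ≡⟨ shape M Y L ⟩
    4 * (M * M) * Y * (L * L)      ≤⟨ 4M²YL²≤s ⟩
    s                              ∎
    where
    shape : ∀ M Y L → 4 * M * Y * L * (M * L) ≡ 4 * (M * M) * Y * (L * L)
    shape = solve-∀
  Y≤s : Y ≤ s
  Y≤s = begin
    Y                              ≤⟨ m≤n*m Y (4 * (M * M)) {{m*n≢0 4 (M * M) {{_}} {{m*n≢0 M M}}}} ⟩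
    4 * (M * M) * Y                ≤⟨ m≤m*n (4 * (M * M) * Y) (L * L) {{m*n≢0 L L}} ⟩
    4 * (M * M) * Y * (L * L)      ≤⟨ 4M²YL²≤s ⟩
    s                              ∎
  θ : ℕ
  θ = s / (M * L)
  1≤θ : 1 ≤ θ
  1≤θ = m≥n⇒m/n>0 ML≤s
  MLθ≤s : M * L * θ ≤ s
  MLθ≤s = ≤-trans (≤-reflexive (*-comm (M * L) θ)) (m/n*n≤m s (M * L))
  s≤2θML : s ≤ 2 * (θ * (M * L))
  s≤2θML = begin
    s                                   ≡⟨ m≡m%n+[m/n]*n s (M * L) ⟩
    s % (M * L) + θ * (M * L)           ≤⟨ +-monoˡ-≤ (θ * (M * L)) (≤-trans (<⇒≤ (m%n<n s (M * L))) (m≤n*m (M * L) θ {{>-nonZero 1≤θ}})) ⟩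
    θ * (M * L) + θ * (M * L)           ≡⟨ cong (θ * (M * L) +_) (sym (+-identityʳ _)) ⟩
    2 * (θ * (M * L))                   ∎
  m≤θ² : m ≤ θ * θ
  m≤θ² = *-cancelˡ-≤ (4 * (M * M) * (L * L)) {{m*n≢0 (4 * (M * M)) (L * L) {{m*n≢0 4 (M * M) {{_}} {{m*n≢0 M M}}}} {{m*n≢0 L L}}}} (begin
    4 * (M * M) * (L * L) * m                      ≤⟨ m≤n*m _ Y ⟩
    Y * (4 * (M * M) * (L * L) * m)                ≡⟨ shape₁ Y M L m ⟩
    4 * (M * M) * Y * (m * (L * L))                ≤⟨ hyp ⟩
    s * s                                          ≤⟨ *-mono-≤ s≤2θML s≤2θML ⟩
    2 * (θ * (M * L)) * (2 * (θ * (M * L)))        ≡⟨ shape₂ θ M L ⟩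
    4 * (M * M) * (L * L) * (θ * θ)                ∎)
    where
    shape₁ : ∀ Y M L m → Y * (4 * (M * M) * (L * L) * m) ≡ 4 * (M * M) * Y * (m * (L * L))
    shape₁ = solve-∀
    shape₂ : ∀ θ M L → 2 * (θ * (M * L)) * (2 * (θ * (M * L))) ≡ 4 * (M * M) * (L * L) * (θ * θ)
    shape₂ = solve-∀

-- The base n + 1 is at most 2^(L+1) ≤ 2^(2L), as L ≥ 1, and the factor g is at most 2^g; the
-- resulting exponent becomes w.
few-containers : ∀ n θ E g L → 1 ≤ n → 1 ≤ θ → 1 ≤ L → n < 2 ^ suc L →
  g * length (containers n θ E) ≤ 2 ^ (g + 2 * L * (suc (24 * E) * (2 * E + 3) * θ))
few-containers n θ E g L 1≤n 1≤θ 1≤L n< = begin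
  g * length (containers n θ E)
    ≤⟨ *-mono-≤ (<⇒≤ (n<2^n g)) (length-containers n θ E 1≤n) ⟩
  2 ^ g * suc n ^ (suc (24 * E) * suc (2 * E * θ + suc θ))
    ≤⟨ 2 ^ g ⊛ ≤-trans (^-monoʳ-≤ (suc n) exponent) (^-monoˡ-≤ (suc (24 * E) * (2 * E + 3) * θ) (≤-trans n< base)) ⟩
  2 ^ g * (2 ^ (2 * L)) ^ (suc (24 * E) * (2 * E + 3) * θ)
    ≡⟨ cong (2 ^ g *_) (^-*-assoc 2 (2 * L) _) ⟩
  2 ^ g * 2 ^ (2 * L * (suc (24 * E) * (2 * E + 3) * θ))
    ≡⟨ sym (^-distribˡ-+-* 2 g _) ⟩
  2 ^ (g + 2 * L * (suc (24 * E) * (2 * E + 3) * θ)) ∎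
  where
  open ≤-Reasoning
  base : 2 ^ suc L ≤ 2 ^ (2 * L)
  base = ^-monoʳ-≤ 2 (≤-trans (+-monoˡ-≤ L 1≤L) (≤-reflexive (cong (L +_) (sym (+-identityʳ L)))))
  exponent : suc (24 * E) * suc (2 * E * θ + suc θ) ≤ suc (24 * E) * (2 * E + 3) * θ
  exponent = ≤-trans (suc (24 * E) ⊛ ≤-from 0 (shape E θ) (2 ⊛ 1≤θ)) (≤-reflexive (sym (*-assoc (suc (24 * E)) (2 * E + 3) θ)))
    where
    shape : ∀ E θ → 1 + (2 * E * θ + (1 + θ)) + 2 * θ + 0 ≡ (2 * E + 3) * θ + 2 * 1
    shape = solve-∀

BadSets : ℕ → ℕ → ℕ → ℕ → Set
BadSets g n m s = ∃ λ (bad : Subset n → Bool) → g * count bad (allSubsets n) ≤ length (family n s m)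
  × (∀ A → A ∈ family n s m → bad A ≡ false → Good g m s A)

module Stage (g l T F E c M Y : ℕ) (1≤g : 1 ≤ g)
  (l≡ : l ≡ 8 ^ g) (T≡ : T ≡ 12 * l) (F≡ : F ≡ 9 * (T * T)) (E≡ : E ≡ 2 * (F * F))
  (c≡ : c ≡ suc (24 * E) * (2 * E + 3)) (M≡ : M ≡ 4 * (c * F)) (Y≡ : Y ≡ 4 * (F * g)) where

  1≤l : 1 ≤ l
  1≤l = ≤-trans (m^n>0 8 g) (≤-reflexive (sym l≡))

  1≤T : 1 ≤ T
  1≤T = ≤-trans (*-mono-≤ {1} {12} (s≤s z≤n) 1≤l) (≤-reflexive (sym T≡))

  1≤F : 1 ≤ F
  1≤F = ≤-trans (*-mono-≤ {1} {9} (s≤s z≤n) (*-mono-≤ 1≤T 1≤T)) (≤-reflexive (sym F≡))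

  E²≤c : E * E ≤ c
  E²≤c = ≤-trans (≤-from (47 * (E * E) + 74 * E + 3) (shape E) (≤-refl {0})) (≤-reflexive (sym c≡))
    where
    shape : ∀ E → E * E + 0 + (47 * (E * E) + 74 * E + 3) ≡ (1 + 24 * E) * (2 * E + 3) + 0
    shape = solve-∀

  1≤c : 1 ≤ c
  1≤c = ≤-trans (*-mono-≤ {1} {suc (24 * E)} {1} (s≤s z≤n) (≤-trans (s≤s z≤n) (m≤n+m 3 (2 * E)))) (≤-reflexive (sym c≡))

  1≤M : 1 ≤ M
  1≤M = ≤-trans (*-mono-≤ {1} {4} (s≤s z≤n) (*-mono-≤ 1≤c 1≤F)) (≤-reflexive (sym M≡))

  1≤Y : 1 ≤ Y
  1≤Y = ≤-trans (*-mono-≤ {1} {4} (s≤s z≤n) (*-mono-≤ 1≤F 1≤g)) (≤-reflexive (sym Y≡))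

  -- The choices of `M` and `Y` come from here: F w splits into 2cFLθ, which is at most s/2 by M =
  -- 4cF, and F g, which is at most s/4 by Y = 4Fg.
  Fw≤s : ∀ L θ s → M * L * θ ≤ s → Y ≤ s → F * (g + 2 * L * (c * θ)) ≤ s
  Fw≤s L θ s MLθ≤s Y≤s = *-cancelˡ-≤ 4 (≤-from s (shape F g L c θ s)
    (2 ⊛ ≤-trans (≤-reflexive (cong (λ x → x * L * θ) (sym M≡))) MLθ≤s
      ⊹ ≤-trans (≤-reflexive (sym Y≡)) Y≤s))
    where
    shape : ∀ F g L c θ s → 4 * (F * (g + 2 * L * (c * θ))) + (2 * s + s) + s
      ≡ 4 * s + (2 * (4 * (c * F) * L * θ) + 4 * (F * g))
    shape = solve-∀

  4E²θ≤s : ∀ L θ s → 1 ≤ L → M * L * θ ≤ s → 2 * E * (2 * E * θ) ≤ s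
  4E²θ≤s L θ s 1≤L MLθ≤s = begin
    2 * E * (2 * E * θ)              ≡⟨ shape₁ E θ ⟩
    4 * (E * E) * 1 * 1 * θ          ≤⟨ *-monoˡ-≤ θ (*-mono-≤ (*-mono-≤ (4 ⊛ E²≤c) 1≤F) 1≤L) ⟩
    4 * c * F * L * θ                ≡⟨ cong (λ x → x * L * θ) (trans (*-assoc 4 c F) (sym M≡)) ⟩
    M * L * θ                        ≤⟨ MLθ≤s ⟩
    s                                ∎
    where
    open ≤-Reasoning
    shape₁ : ∀ E θ → 2 * E * (2 * E * θ) ≡ 4 * (E * E) * 1 * 1 * θ
    shape₁ = solve-∀

  4F≤Y : 4 * F ≤ Y
  4F≤Y = ≤-trans (4 ⊛ ≤-trans (≤-reflexive (sym (*-identityʳ F))) (F ⊛ 1≤g)) (≤-reflexive (sym Y≡))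

  2g≤Y : 2 * g ≤ Y
  2g≤Y = ≤-trans (*-mono-≤ {2} {4} (s≤s (s≤s z≤n)) (≤-trans (≤-reflexive (sym (*-identityˡ g))) (*-monoˡ-≤ g 1≤F)))
    (≤-reflexive (sym Y≡))

  badSets : ∀ n m s → 1 ≤ s → s ≤ m → 1 ≤ m → 2 ≤ n →
    4 * (M * M) * Y * (m * (⌊log₂ n ⌋ * ⌊log₂ n ⌋)) ≤ s * s → BadSets g n m s
  badSets n m s 1≤s s≤m 1≤m 2≤n hyp =
    let v , m≤2v , 2v≤ = halve m
        θ , 1≤θ , MLθ≤s , m≤θ² , Y≤s = scale M L Y s m 1≤M 1≤L 1≤Y 1≤s s≤m hyp
    in cases v m≤2v 2v≤ θ 1≤θ MLθ≤s m≤θ² Y≤s (≤-<-connex v n)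
    where
    L = ⌊log₂ n ⌋
    1≤L : 1 ≤ L
    1≤L = ⌊log₂⌋-mono-≤ 2≤n
    cases : ∀ v → m ≤ v + v → v + v ≤ suc m → ∀ θ → 1 ≤ θ → M * L * θ ≤ s → m ≤ θ * θ → Y ≤ s →
      v ≤ n ⊎ n < v → BadSets g n m s
    cases v m≤2v 2v≤ θ 1≤θ MLθ≤s m≤θ² Y≤s (inj₂ n<v) = (λ _ → false)
      , ≤-trans (≤-reflexive (trans (cong (g *_) (count-false (allSubsets n))) (*-zeroʳ g))) z≤n
      , λ A _ _ → Good-interval g m s A (s≤s⁻¹ (≤-trans (≤-trans (n≤1+n _) (≤-trans (≤-reflexive (sym (cong suc (+-suc n n)))) (n<v ⊹ n<v))) 2v≤))
    cases v m≤2v 2v≤ θ 1≤θ MLθ≤s m≤θ² Y≤s (inj₁ v≤n) =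
      let bad , few , good = Finite.few-bad n m s g v (g + 2 * L * (c * θ)) l T F E l≡ T≡ F≡ E≡ m≤2v (Fw≤s L θ s MLθ≤s Y≤s)
            (≤-trans 4F≤Y (≤-trans Y≤s s≤m)) (≤-trans 2g≤Y (≤-trans Y≤s s≤m)) 1≤s
            θ 1≤θ m≤θ² (4E²θ≤s L θ s 1≤L MLθ≤s)
            (subst (λ x → g * length (containers n θ E) ≤ 2 ^ (g + 2 * L * (x * θ))) (sym c≡)
              (few-containers n θ E g L (≤-trans (s≤s z≤n) 2≤n) 1≤θ 1≤L (n<2^1+log n)))
      in bad , ≤-trans few (bin-≤-family n s m v 1≤v v≤n 2v≤) , good
      where
      1≤v : 1 ≤ v
      1≤v = n≢0⇒n>0 λ v≡0 → <-irrefl refl (≤-trans 1≤m (subst (λ x → m ≤ x + x) v≡0 m≤2v))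

badSets : ∀ g → 1 ≤ g → ∃ λ Z → ∀ n m s → 1 ≤ s → s ≤ m → 1 ≤ m → 2 ≤ n →
  Z * (m * (⌊log₂ n ⌋ * ⌊log₂ n ⌋)) ≤ s * s → BadSets g n m s
badSets g 1≤g = 4 * (M * M) * Y , Stage.badSets g l T F E c M Y 1≤g refl refl refl refl refl refl refl
  where
  l = 8 ^ g
  T = 12 * l
  F = 9 * (T * T)
  E = 2 * (F * F)
  c = suc (24 * E) * (2 * E + 3)
  M = 4 * (c * F)
  Y = 4 * (F * g)

probability : ∀ K ε n m s → inv K ℚ.≤ ε → BadSets (suc K) n m s → ProbAtLeast n s m (GoodAP m s (inv K)) ε
probability K ε n m s inv≤ε (bad , few , good) =
  filterᵇ (not ∘ bad) fam
  , Unique.filter⁺ (T? ∘ not ∘ bad) (Unique.filter⁺ (T? ∘ λ A → (card A ≡ᵇ s) ∧ (sumsetSize A ≤ᵇ m)) (allSubsets-unique n))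
  , All.tabulate (∈-filterᵇ⁻ (not ∘ bad) fam)
  , All.tabulate (λ {A} A∈ → Good⇒GoodAP K m s A
      (good A (∈-filterᵇ⁻ (not ∘ bad) fam A∈) (not-true (∈-filterᵇ (not ∘ bad) fam A∈))))
  , complement-≤ K ε (length fam) (count bad fam) (count (not ∘ bad) fam) inv≤ε (length-complement bad fam)
      (≤-trans (suc K ⊛ count-filterᵇ bad _ (allSubsets n)) few)
  where
  fam = family n s m

-- Diagonalisation

-- Accuracy 1/(i + 1) is available from N i on. N need not be monotone, so the search for the
-- largest admissible index runs downwards; 0 is the default.
best : (ℕ → ℕ) → ℕ → ℕ → ℕ
best N n zero = zero
best N n (suc j) = if N (suc j) ≤ᵇ n then suc j else best N n j

best-reached : ∀ (N : ℕ → ℕ) n j → N 0 ≤ n → N (best N n j) ≤ n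
best-reached N n zero l = l
best-reached N n (suc j) l with N (suc j) ≤ᵇ n in e
... | true = true-≤ᵇ e
... | false = best-reached N n j l

best-≥ : ∀ (N : ℕ → ℕ) n j i → i ≤ j → N i ≤ n → i ≤ best N n j
best-≥ N n zero i i≤j _ = i≤j
best-≥ N n (suc j) i i≤j l with N (suc j) ≤ᵇ n in e
... | true = i≤j
... | false with m≤n⇒m<n∨m≡n i≤j
...   | inj₁ i<j = best-≥ N n j i (s≤s⁻¹ i<j) l
...   | inj₂ refl = ⊥-elim (<⇒≱ (false-≤ᵇ e) l)

theorem1p3 : (m s : ℕ → ℕ) → (∀ n → 1 ≤ m n) → (∀ n → 1 ≤ s n)
    → LittleOSqOverLogSq m s
    → Σ (ℕ → ℚ) λ η → TendsToZero η
    × (∀ (ε : ℚ) → Data.Rational._<_ 0ℚ ε → ∃ λ N → ∀ n → N ≤ n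
    → 0 < length (family n (s n) (m n))
    → ProbAtLeast n (s n) (m n) (GoodAP (m n) (s n) (η n)) ε)
theorem1p3 m s 1≤m 1≤s o =
  (λ n → inv (rank n))
  , (λ ε 0<ε → let K , inv≤ε = inv-below ε 0<ε in
      -- N K makes the index K admissible, and the summand K makes sure that the search, which
      -- starts at n, passes it.
      N K + K , λ n l → ℚ.≤-trans (ℚ.≤-reflexive (∣inv∣ (rank n))) (small n K ε inv≤ε l))
  , (λ ε 0<ε → let K , inv≤ε = inv-below ε 0<ε in
      -- N 0 ≤ n makes the chosen index admissible even when it is the default 0.
      N 0 + (N K + K) , λ n l nonempty → probability (rank n) ε n (m n) (s n)
        (small n K ε inv≤ε (m+n≤o⇒n≤o (N 0) l))
        (bads (rank n) n (best-reached N n n (m+n≤o⇒m≤o (N 0) l)) nonempty))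
  where
  Z : ℕ → ℕ
  Z K = proj₁ (badSets (suc K) (s≤s z≤n))
  N : ℕ → ℕ
  -- The 2 ensures n ≥ 2, so that the logarithm is at least 1.
  N K = 2 + proj₁ (o (inv (Z K)) (0<inv (Z K)))
  rank : ℕ → ℕ
  rank n = best N n n
  small : ∀ n K ε → inv K ℚ.≤ ε → N K + K ≤ n → inv (rank n) ℚ.≤ ε
  small n K ε inv≤ε l = ℚ.≤-trans (inv-anti (best-≥ N n n K (m+n≤o⇒n≤o (N K) l) (m+n≤o⇒m≤o (N K) l))) inv≤ε
  bads : ∀ K n → N K ≤ n → 0 < length (family n (s n) (m n)) → BadSets (suc K) n (m n) (s n)
  bads K n N≤n nonempty =
    let A , A∈ = member (family n (s n) (m n)) nonempty
        #A , S≤m = family-elim n (s n) (m n) A A∈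
    in proj₂ (badSets (suc K) (s≤s z≤n)) n (m n) (s n) (1≤s n) (s≤m n (s n) (m n) A (1≤s n) #A S≤m) (1≤m n)
         (m+n≤o⇒m≤o 2 N≤n)
         -- With ε = 1/(Z + 1) the hypothesis bounds Z + 1 copies of m log² n; one copy is dropped.
         (≤-trans (m≤n+m _ _) (≤-trans (≤-reflexive (cong (λ x → suc (Z K) * (m n * x)) (sq ⌊log₂ n ⌋)))
           (≤-trans (inv-≤ (Z K) (m n * ⌊log₂ n ⌋ ^ 2) (s n ^ 2) (proj₂ (o (inv (Z K)) (0<inv (Z K))) n (m+n≤o⇒n≤o 2 N≤n)))
             (≤-reflexive (sym (sq (s n)))))))
    where
    sq : ∀ x → x * x ≡ x ^ 2
    sq x = cong (x *_) (sym (*-identityʳ x))
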